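{- Let $E/F$ be an unramified quadratic extension of non-archimedean local fields of characteristic zero, and let $\Gamma_n\subset U$ ($n\geqslant 0$) be the Miyauchi subgroups of the rank $3$ unitary group $U$ attached to $E/F$. Let $\mathrm{vol}$ be the Haar measure on $U$ normalized so that $\mathrm{vol}(\Gamma_0)=1$. Then for every $n\geqslant 1$, $$\mathrm{vol}(\Gamma_n)=q_F^{ -3n}\,(1+q_F^{ -3})^{ -1}.$$
   Context: Let $E/F$ be an unramified quadratic extension of non-archimedean local fields of characteristic zero; $x\mapsto\overline{x}$ denotes the nontrivial element of $\mathrm{Gal}(E/F)$, applied entrywise to matrices. Let $\mathfrak{O}$ be the ring of integers of $E$, $\mathfrak{P}$ its maximal ideal, and let $q_F$ be the cardinality of the residue field of $F$. Let $$J=\begin{pmatrix}0&0&1\\0&1&0\\1&0&0\end{pmatrix},\qquad U=\{g\in \mathrm{GL}_3(E): {}^t\overline{g}Jg=J\},$$ a locally compact topological group. For $n\geqslant 0$ the Miyauchi subgroup $\Gamma_n$ is the compact open subgroup of $U$ $$\Gamma_n=\left\{g\in\begin{pmatrix}\mathfrak{O}&\mathfrak{O}&\mathfrak{P}^{ -n}\\ \mathfrak{P}^n&1+\mathfrak{P}^n&\mathfrak{O}\\ \mathfrak{P}^n&\mathfrak{P}^n&\mathfrak{O}\end{pmatrix}:\det(g)\in\mathfrak{O}^\times\right\}\cap U,$$ where the displayed matrix of sets means that each entry of $g$ lies in the set in the corresponding position (for $n=0$, $1+\mathfrak{P}^0=\mathfrak{O}$). -}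

module Defs where

open import Algebra.Bundles using (CommutativeRing; Group)
open import Algebra.Definitions.RawMonoid using (_×_)
open import Algebra.Morphism.Structures
  using (module RingMorphisms)
import Algebra.Properties.AbelianGroup as AbelianGroupProperties
import Algebra.Properties.Ring as RingProperties
import Algebra.Properties.Semiring.Sum as SemiringSum
open import Data.Empty using (⊥-elim)
open import Data.Fin using (Fin; zero; suc)
open import Data.Fin.Patterns using (0F; 1F; 2F)
open import Data.Fin.Properties using (nonZeroIndex)
open import Data.Integer as ℤ using (ℤ; +_; -[1+_])
import Data.Integer.Properties as ℤₚ
open import Data.Integer.Tactic.RingSolver using (solve-∀)
open import Data.List using (List)
open import Data.List.Relation.Unary.Any using (Any)
open import Data.Nat as ℕ using (ℕ; zero; suc)
import Data.Nat.Properties as ℕₚ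
open import Data.Product using (_,_; proj₁; proj₂; ∃; ∃₂; ∃-syntax; Σ-syntax) renaming (_×_ to _∧_)
open import Data.Rational as ℚ using (ℚ; 0ℚ; 1ℚ)
import Data.Rational.Properties as ℚₚ
open import Function using (_⇔_; _∘_; _on_; Equivalence; Congruent; Bijective)
open import Level using (Level; _⊔_; 0ℓ) renaming (suc to lsuc)
open import Relation.Binary.Bundles using (Setoid)
open import Relation.Binary.PropositionalEquality as ≡ using (_≡_; _≢_)
import Relation.Binary.Construct.Add.Supremum.NonStrict as AddSupremum
import Relation.Binary.Reasoning.Setoid as ≈-Reasoning
open import Relation.Nullary using (¬_)
open import Relation.Nullary.Construct.Add.Supremum using (_⁺; [_]; ⊤⁺)
open import Relation.Unary using (Pred; _∈_; _⊆_; _≐_; _⊥_; ∁; ⋃; Empty)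

------------------------------------------------------------------------
-- ℤ ∪ {∞}

ℤ∞ : Set
ℤ∞ = ℤ ⁺

open AddSupremum ℤ._≤_ using (_≤⊤⁺) renaming (_≤⁺_ to _≤∞_; [_] to [_]≤)

infixl 6 _+∞_

_+∞_ : ℤ∞ → ℤ∞ → ℤ∞
[ k ] +∞ [ l ] = [ k ℤ.+ l ]
[ k ] +∞ ⊤⁺    = ⊤⁺
⊤⁺    +∞ l     = ⊤⁺

≤∞-trans : ∀ {k l m} → k ≤∞ l → l ≤∞ m → k ≤∞ m
≤∞-trans = AddSupremum.≤⁺-trans ℤ._≤_ ℤₚ.≤-trans

+∞-mono-≤∞ : ∀ {k l a b} → [ k ] ≤∞ a → [ l ] ≤∞ b → [ k ℤ.+ l ] ≤∞ a +∞ b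
+∞-mono-≤∞ [ p ]≤       [ q ]≤       = [ ℤₚ.+-mono-≤ p q ]≤
+∞-mono-≤∞ [ p ]≤       ([ _ ] ≤⊤⁺)  = [ _ ] ≤⊤⁺
+∞-mono-≤∞ ([ _ ] ≤⊤⁺)  _            = [ _ ] ≤⊤⁺

------------------------------------------------------------------------
-- Non-archimedean local fields: fields complete for a normalised
-- discrete valuation, with finite residue field.
--
-- Nonzero means ¬ x ≈ 0#; an apartness relation would be redundant,
-- since the values of v decide equality with 0#.

record LocalField (c ℓ : Level) : Set (lsuc (c ⊔ ℓ)) where
  field
    commutativeRing : CommutativeRing c ℓ

  open CommutativeRing commutativeRing public

  field
    1≉0     : ¬ 1# ≈ 0#
    inverse : ∀ x → ¬ x ≈ 0# → ∃[ y ] x * y ≈ 1#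

    v            : Carrier → ℤ∞
    v-cong       : ∀ {x y} → x ≈ y → v x ≡ v y
    v-∞          : ∀ x → v x ≡ ⊤⁺ ⇔ x ≈ 0#
    v-*          : ∀ x y → v (x * y) ≡ v x +∞ v y
    v-+          : ∀ {k} x y → k ≤∞ v x → k ≤∞ v y → k ≤∞ v (x + y)
    v-normalised : ∀ k → ∃[ x ] v x ≡ [ k ]

  𝔓^ : ℤ → Pred Carrier 0ℓ
  𝔓^ k x = [ k ] ≤∞ v x

  𝔒 : Pred Carrier 0ℓ
  𝔒 = 𝔓^ (+ 0)

  𝔓 : Pred Carrier 0ℓ
  𝔓 = 𝔓^ (+ 1)

  𝔒ˣ : Pred Carrier (c ⊔ ℓ)
  𝔒ˣ x = x ∈ 𝔒 ∧ ∃[ y ] (y ∈ 𝔒 ∧ x * y ≈ 1#)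

  Cauchy : (ℕ → Carrier) → Set
  Cauchy s = ∀ k → ∃[ N ] ∀ m n → N ℕ.≤ m → N ℕ.≤ n → (s m - s n) ∈ 𝔓^ k

  _⟶_ : (ℕ → Carrier) → Carrier → Set
  s ⟶ x = ∀ k → ∃[ N ] ∀ n → N ℕ.≤ n → (s n - x) ∈ 𝔓^ k

  _≡_[mod𝔓] : (x y : ∃ 𝔒) → Set
  x ≡ y [mod𝔓] = (proj₁ x - proj₁ y) ∈ 𝔓

  field
    complete : ∀ s → Cauchy s → ∃[ x ] s ⟶ x

    -- 𝔒 / 𝔓 is in bijection with Fin q.
    q                 : ℕ
    residue           : ∃ 𝔒 → Fin q
    residue-cong      : Congruent _≡_[mod𝔓] _≡_ residue
    residue-bijective : Bijective _≡_[mod𝔓] _≡_ residue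

  0∈𝔒 : 0# ∈ 𝔒
  0∈𝔒 = ≡.subst ([ + 0 ] ≤∞_) (≡.sym (Equivalence.from (v-∞ 0#) refl)) ([ + 0 ] ≤⊤⁺)

  instance
    q-nonZero : ℕ.NonZero q
    q-nonZero = nonZeroIndex (residue (0# , 0∈𝔒))

CharacteristicZero : ∀ {c ℓ} → LocalField c ℓ → Set ℓ
CharacteristicZero K = ∀ n → _×_ +-rawMonoid n 1# ≈ 0# → n ≡ 0
  where open LocalField K

-- E has F-basis (e₁ , e₂), and ramification index 1, that is, the
-- normalised valuation of E extends that of F.  (The residue extension
-- is separable, the residue fields being finite.)  The conjugation σ is
-- the nontrivial element of Gal(E/F).

record UnramifiedQuadraticExtension
  {c₁ ℓ₁ c ℓ : Level} (F : LocalField c₁ ℓ₁) (E : LocalField c ℓ)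
  : Set (c₁ ⊔ ℓ₁ ⊔ c ⊔ ℓ) where

  private
    module F = LocalField F
  open LocalField E

  field
    ι                 : F.Carrier → Carrier
    ι-isHomomorphism  : RingMorphisms.IsRingHomomorphism F.rawRing rawRing ι

    e₁ e₂             : Carrier
    spanning          : ∀ x → ∃₂ λ a b → x ≈ ι a * e₁ + ι b * e₂
    independent       : ∀ a b → ι a * e₁ + ι b * e₂ ≈ 0# → a F.≈ F.0# ∧ b F.≈ F.0#

    unramified        : ∀ x → v (ι x) ≡ F.v x

    σ                 : Carrier → Carrier
    σ-isAutomorphism  : RingMorphisms.IsRingIsomorphism rawRing rawRing σ
    σ-fixes           : ∀ x → σ (ι x) ≈ ι x
    σ-nontrivial      : ¬ (∀ x → σ x ≈ x)

------------------------------------------------------------------------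
-- 3 × 3 matrices

module Matrix {c ℓ : Level} (R : CommutativeRing c ℓ) where

  open CommutativeRing R
  open SemiringSum semiring using (sum; sum-cong-≋; ∑-comm; *-distribˡ-sum; *-distribʳ-sum)

  M₃ : Set c
  M₃ = Fin 3 → Fin 3 → Carrier

  infix 4 _≋_
  infixl 7 _·_
  infix 8 _ᵗ

  _≋_ : M₃ → M₃ → Set ℓ
  A ≋ B = ∀ i j → A i j ≈ B i j

  _·_ : M₃ → M₃ → M₃
  (A · B) i j = sum (λ k → A i k * B k j)

  _ᵗ : M₃ → M₃
  (A ᵗ) i j = A j i

  1ᴹ : M₃
  1ᴹ 0F 0F = 1#
  1ᴹ 1F 1F = 1#
  1ᴹ 2F 2F = 1#
  1ᴹ _  _  = 0#

  J : M₃
  J 0F 2F = 1#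
  J 1F 1F = 1#
  J 2F 0F = 1#
  J _  _  = 0#

  det : M₃ → Carrier
  det A =
      A 0F 0F * A 1F 1F * A 2F 2F
    + A 0F 1F * A 1F 2F * A 2F 0F
    + A 0F 2F * A 1F 0F * A 2F 1F
    - A 0F 2F * A 1F 1F * A 2F 0F
    - A 0F 1F * A 1F 0F * A 2F 2F
    - A 0F 0F * A 1F 2F * A 2F 1F

  ≋-refl : ∀ {A} → A ≋ A
  ≋-refl i j = refl

  ≋-sym : ∀ {A B} → A ≋ B → B ≋ A
  ≋-sym p i j = sym (p i j)

  ≋-trans : ∀ {A B C} → A ≋ B → B ≋ C → A ≋ C
  ≋-trans p q i j = trans (p i j) (q i j)

  ·-cong : ∀ {A A′ B B′} → A ≋ A′ → B ≋ B′ → A · B ≋ A′ · B′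
  ·-cong p q i j = sum-cong-≋ (λ k → *-cong (p i k) (q k j))

  ·-assoc : ∀ A B C → A · B · C ≋ A · (B · C)
  ·-assoc A B C i j = begin
    sum (λ k → sum (λ l → A i l * B l k) * C k j)    ≈⟨ sum-cong-≋ (λ k → *-distribʳ-sum (C k j) (λ l → A i l * B l k)) ⟩
    sum (λ k → sum (λ l → A i l * B l k * C k j))    ≈⟨ ∑-comm (λ k l → A i l * B l k * C k j) ⟩
    sum (λ l → sum (λ k → A i l * B l k * C k j))    ≈⟨ sum-cong-≋ (λ l → sum-cong-≋ (λ k → *-assoc (A i l) (B l k) (C k j))) ⟩
    sum (λ l → sum (λ k → A i l * (B l k * C k j)))  ≈⟨ sum-cong-≋ (λ l → *-distribˡ-sum (A i l) (λ k → B l k * C k j)) ⟨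
    sum (λ l → A i l * sum (λ k → B l k * C k j))    ∎
    where open ≈-Reasoning setoid

  ·-identityˡ : ∀ A → 1ᴹ · A ≋ A
  ·-identityˡ A i j = row i
    where
    x y z : Carrier
    x = A 0F j
    y = A 1F j
    z = A 2F j

    0*-+ : ∀ u w → 0# * u + w ≈ w
    0*-+ u w = trans (+-congʳ (zeroˡ u)) (+-identityˡ w)

    row : ∀ i → (1ᴹ · A) i j ≈ A i j
    row 0F = trans (+-cong (*-identityˡ x) (trans (0*-+ y _) (0*-+ z _))) (+-identityʳ x)
    row 1F = trans (0*-+ x _) (trans (+-cong (*-identityˡ y) (0*-+ z _)) (+-identityʳ y))
    row 2F = trans (0*-+ x _) (trans (0*-+ y _) (trans (+-identityʳ _) (*-identityˡ z)))

  1ᴹ-ᵗ : 1ᴹ ᵗ ≋ 1ᴹ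
  1ᴹ-ᵗ 0F 0F = refl
  1ᴹ-ᵗ 0F 1F = refl
  1ᴹ-ᵗ 0F 2F = refl
  1ᴹ-ᵗ 1F 0F = refl
  1ᴹ-ᵗ 1F 1F = refl
  1ᴹ-ᵗ 1F 2F = refl
  1ᴹ-ᵗ 2F 0F = refl
  1ᴹ-ᵗ 2F 1F = refl
  1ᴹ-ᵗ 2F 2F = refl

  ·-ᵗ : ∀ A B → (A · B) ᵗ ≋ B ᵗ · A ᵗ
  ·-ᵗ A B i j = sum-cong-≋ (λ k → *-comm (A j k) (B k i))

  ·-identityʳ : ∀ A → A · 1ᴹ ≋ A
  ·-identityʳ A i j = begin
    (A · 1ᴹ) i j      ≈⟨ ·-ᵗ A 1ᴹ j i ⟩
    (1ᴹ ᵗ · A ᵗ) j i  ≈⟨ ·-cong {B = A ᵗ} 1ᴹ-ᵗ ≋-refl j i ⟩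
    (1ᴹ · A ᵗ) j i    ≈⟨ ·-identityˡ (A ᵗ) j i ⟩
    A i j             ∎
    where open ≈-Reasoning setoid

------------------------------------------------------------------------
-- Congruences modulo powers of 𝔓

module Congruences {c ℓ : Level} (K : LocalField c ℓ) where

  open LocalField K
  open RingProperties ring using (-1*x≈-x; -‿distribʳ-*; -‿involutive; -‿+-comm)
  open import Algebra.Properties.CommutativeSemigroup +-commutativeSemigroup using (interchange)

  +∞-identityˡ : ∀ a → [ + 0 ] +∞ a ≡ a
  +∞-identityˡ [ k ] = ≡.cong [_] (ℤₚ.+-identityˡ k)
  +∞-identityˡ ⊤⁺    = ≡.refl

  private
    []-injective : ∀ {k l : ℤ} → _≡_ {A = ℤ∞} [ k ] [ l ] → k ≡ l
    []-injective ≡.refl = ≡.refl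

    halve : ∀ a → a +∞ a ≡ [ + 0 ] → a ≡ [ + 0 ]
    halve [ + zero ]     _  = ≡.refl
    halve [ + suc n ]    ()
    halve [ -[1+ n ] ]   ()
    halve ⊤⁺             ()

  v-1 : v 1# ≡ [ + 0 ]
  v-1 = idempotent (v 1#) ≡.refl
    where
    idempotent : ∀ a → v 1# ≡ a → a ≡ [ + 0 ]
    idempotent ⊤⁺    eq = ⊥-elim (1≉0 (Equivalence.to (v-∞ 1#) eq))
    idempotent [ k ] eq = ≡.cong [_] (AbelianGroupProperties.identityˡ-unique ℤₚ.+-0-abelianGroup k k
      ([]-injective (begin
        [ k ℤ.+ k ]    ≡⟨ ≡.cong₂ _+∞_ eq eq ⟨
        v 1# +∞ v 1#   ≡⟨ v-* 1# 1# ⟨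
        v (1# * 1#)    ≡⟨ v-cong (*-identityˡ 1#) ⟩
        v 1#           ≡⟨ eq ⟩
        [ k ]          ∎)))
      where open ≡.≡-Reasoning

  v-- : ∀ x → v (- x) ≡ v x
  v-- x = begin
    v (- x)            ≡⟨ v-cong (-1*x≈-x x) ⟨
    v (- 1# * x)       ≡⟨ v-* (- 1#) x ⟩
    v (- 1#) +∞ v x    ≡⟨ ≡.cong (_+∞ v x) (halve (v (- 1#)) squared) ⟩
    [ + 0 ] +∞ v x     ≡⟨ +∞-identityˡ (v x) ⟩
    v x                ∎
    where
    open ≡.≡-Reasoning
    squared : v (- 1#) +∞ v (- 1#) ≡ [ + 0 ]
    squared = ≡.trans (≡.sym (v-* (- 1#) (- 1#)))
             (≡.trans (v-cong (trans (-1*x≈-x (- 1#)) (-‿involutive 1#))) v-1)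

  𝔓^-cong : ∀ {k x y} → x ≈ y → x ∈ 𝔓^ k → y ∈ 𝔓^ k
  𝔓^-cong {k} x≈y = ≡.subst ([ k ] ≤∞_) (v-cong x≈y)

  𝔓^-weaken : ∀ {k l x} → k ℤ.≤ l → x ∈ 𝔓^ l → x ∈ 𝔓^ k
  𝔓^-weaken k≤l = ≤∞-trans [ k≤l ]≤

  𝔓^-neg : ∀ {k x} → x ∈ 𝔓^ k → - x ∈ 𝔓^ k
  𝔓^-neg {k} {x} = ≡.subst ([ k ] ≤∞_) (≡.sym (v-- x))

  𝔓^-* : ∀ {k l x y} → x ∈ 𝔓^ k → y ∈ 𝔓^ l → (x * y) ∈ 𝔓^ (k ℤ.+ l)
  𝔓^-* {k} {l} {x} {y} p q = ≡.subst ([ k ℤ.+ l ] ≤∞_) (≡.sym (v-* x y)) (+∞-mono-≤∞ p q)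

  1∈𝔒 : 1# ∈ 𝔒
  1∈𝔒 = ≡.subst ([ + 0 ] ≤∞_) (≡.sym v-1) [ ℤₚ.≤-refl ]≤

  1∉𝔓 : ¬ 1# ∈ 𝔓
  1∉𝔓 p with ≡.subst ([ + 1 ] ≤∞_) v-1 p
  ... | [ ℤ.+≤+ () ]≤

  infix 4 _~_[_]

  _~_[_] : Carrier → Carrier → ℤ → Set
  x ~ y [ k ] = (x - y) ∈ 𝔓^ k

  ~-refl : ∀ {k} x → x ~ x [ k ]
  ~-refl {k} x = ≡.subst ([ k ] ≤∞_) (≡.sym (Equivalence.from (v-∞ (x - x)) (-‿inverseʳ x))) ([ k ] ≤⊤⁺)

  ~-+ : ∀ {k x y x′ y′} → x ~ y [ k ] → x′ ~ y′ [ k ] → x + x′ ~ y + y′ [ k ]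
  ~-+ {_} {x} {y} {x′} {y′} p q = 𝔓^-cong eq (v-+ (x - y) (x′ - y′) p q)
    where
    eq : (x - y) + (x′ - y′) ≈ (x + x′) - (y + y′)
    eq = trans (interchange x (- y) x′ (- y′)) (+-congˡ (-‿+-comm y y′))

  ~-neg : ∀ {k x y} → x ~ y [ k ] → - x ~ - y [ k ]
  ~-neg {_} {x} {y} p = 𝔓^-cong (sym (-‿+-comm x (- y))) (𝔓^-neg p)

  ~-* : ∀ {k l a b m x y x′ y′} →
        x ~ y [ k ] → x′ ∈ 𝔓^ a → m ℤ.≤ k ℤ.+ a →
        y ∈ 𝔓^ b → x′ ~ y′ [ l ] → m ℤ.≤ b ℤ.+ l →
        x * x′ ~ y * y′ [ m ]
  ~-* {x = x} {y} {x′} {y′} p x′∈ m≤ y∈ q m≤′ =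
    𝔓^-cong eq (v-+ ((x - y) * x′) (y * (x′ - y′))
                    (𝔓^-weaken m≤ (𝔓^-* p x′∈)) (𝔓^-weaken m≤′ (𝔓^-* y∈ q)))
    where
    open ≈-Reasoning setoid
    eq : (x - y) * x′ + y * (x′ - y′) ≈ x * x′ - y * y′
    eq = begin
      (x - y) * x′ + y * (x′ - y′)                       ≈⟨ +-cong (distribʳ x′ x (- y)) (distribˡ y x′ (- y′)) ⟩
      (x * x′ + - y * x′) + (y * x′ + y * - y′)          ≈⟨ +-assoc (x * x′) (- y * x′) (y * x′ + y * - y′) ⟩
      x * x′ + (- y * x′ + (y * x′ + y * - y′))          ≈⟨ +-congˡ (+-assoc (- y * x′) (y * x′) (y * - y′)) ⟨
      x * x′ + ((- y * x′ + y * x′) + y * - y′)          ≈⟨ +-congˡ (+-congʳ (distribʳ x′ (- y) y)) ⟨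
      x * x′ + ((- y + y) * x′ + y * - y′)               ≈⟨ +-congˡ (+-congʳ (trans (*-congʳ (-‿inverseˡ y)) (zeroˡ x′))) ⟩
      x * x′ + (0# + y * - y′)                           ≈⟨ +-congˡ (+-identityˡ (y * - y′)) ⟩
      x * x′ + y * - y′                                  ≈⟨ +-congˡ (-‿distribʳ-* y y′) ⟨
      x * x′ - y * y′                                    ∎

  𝔓^-~ : ∀ {k l x y} → k ℤ.≤ l → x ~ y [ l ] → y ∈ 𝔓^ k → x ∈ 𝔓^ k
  𝔓^-~ {x = x} {y} k≤l p y∈ = 𝔓^-cong eq (v-+ (x - y) y (𝔓^-weaken k≤l p) y∈)
    where
    eq : (x - y) + y ≈ x
    eq = trans (+-assoc x (- y) y) (trans (+-congˡ (-‿inverseˡ y)) (+-identityʳ x))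

  𝔒ˣ-~ : ∀ {x y} → x ~ y [ + 1 ] → y ∈ 𝔒ˣ → x ∈ 𝔒ˣ
  𝔒ˣ-~ {x} {y} x~y (y∈𝔒 , z , z∈𝔒 , yz≈1) = x∈𝔒 , invert (inverse x x≉0)
    where
    0≤1 : + 0 ℤ.≤ + 1
    0≤1 = ℤ.+≤+ ℕ.z≤n

    x∈𝔒 : x ∈ 𝔒
    x∈𝔒 = 𝔓^-~ 0≤1 x~y y∈𝔒

    x∉𝔓 : ¬ x ∈ 𝔓
    x∉𝔓 x∈𝔓 = 1∉𝔓 (𝔓^-cong yz≈1 (𝔓^-* y∈𝔓 z∈𝔒))
      where
      eq : - (x - y) + x ≈ y
      eq = trans (+-congʳ (sym (-‿+-comm x (- y))))
          (trans (+-comm (- x - - y) x)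
          (trans (sym (+-assoc x (- x) (- - y)))
          (trans (+-cong (-‿inverseʳ x) (-‿involutive y)) (+-identityˡ y))))

      y∈𝔓 : y ∈ 𝔓
      y∈𝔓 = 𝔓^-cong eq (v-+ (- (x - y)) x (𝔓^-neg x~y) x∈𝔓)

    x≉0 : ¬ x ≈ 0#
    x≉0 x≈0 = x∉𝔓 (≡.subst ([ + 1 ] ≤∞_) (≡.sym (Equivalence.from (v-∞ x) x≈0)) ([ + 1 ] ≤⊤⁺))

    bound : ∀ a b → a +∞ b ≡ [ + 0 ] → [ + 0 ] ≤∞ a → ¬ [ + 1 ] ≤∞ a → [ + 0 ] ≤∞ b
    bound [ + zero ]   [ l ] eq _  _ = ≡.subst ([ + 0 ] ≤∞_) (≡.trans (≡.sym eq) (+∞-identityˡ [ l ])) [ ℤₚ.≤-refl ]≤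
    bound [ + suc n ]  _     _  _  p = ⊥-elim (p [ ℤ.+≤+ (ℕ.s≤s ℕ.z≤n) ]≤)
    bound [ -[1+ _ ] ] _     _  [ () ]≤ _
    bound ⊤⁺           _     ()

    invert : ∃[ w ] x * w ≈ 1# → ∃[ w ] (w ∈ 𝔒 ∧ x * w ≈ 1#)
    invert (w , xw≈1) =
      w , bound (v x) (v w) (≡.trans (≡.sym (v-* x w)) (≡.trans (v-cong xw≈1) v-1)) x∈𝔒 x∉𝔓 , xw≈1

------------------------------------------------------------------------
-- The unitary group of J and the Miyauchi subgroups

module UnitaryGroup
  {c₁ ℓ₁ c ℓ : Level} {F : LocalField c₁ ℓ₁} {E : LocalField c ℓ}
  (E/F : UnramifiedQuadraticExtension F E) where

  open LocalField E hiding (zero)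
  open UnramifiedQuadraticExtension E/F
  open RingMorphisms.IsRingIsomorphism σ-isAutomorphism
    using () renaming (⟦⟧-cong to σ-cong; +-homo to σ-+; *-homo to σ-*; 0#-homo to σ-0; 1#-homo to σ-1)
  open SemiringSum semiring using (sum; sum-cong-≋)
  open Matrix commutativeRing public
  open Congruences E

  conj : M₃ → M₃
  conj A i j = σ (A i j)

  record Unitary : Set (c ⊔ ℓ) where
    field
      matrix   : M₃
      inv      : M₃
      inverseʳ : matrix · inv ≋ 1ᴹ
      inverseˡ : inv · matrix ≋ 1ᴹ
      unitary  : conj matrix ᵗ · J · matrix ≋ J

  open Unitary

  private
    σ-sum : ∀ {n} (f : Fin n → Carrier) → σ (sum f) ≈ sum (σ ∘ f)
    σ-sum {zero}  f = σ-0
    σ-sum {suc n} f = trans (σ-+ (f zero) (sum (f ∘ suc))) (+-congˡ (σ-sum (f ∘ suc)))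

    conjᵗ-cong : ∀ {A B} → A ≋ B → conj A ᵗ ≋ conj B ᵗ
    conjᵗ-cong p i j = σ-cong (p j i)

    conjᵗ-1ᴹ : conj 1ᴹ ᵗ ≋ 1ᴹ
    conjᵗ-1ᴹ 0F 0F = σ-1
    conjᵗ-1ᴹ 0F 1F = σ-0
    conjᵗ-1ᴹ 0F 2F = σ-0
    conjᵗ-1ᴹ 1F 0F = σ-0
    conjᵗ-1ᴹ 1F 1F = σ-1
    conjᵗ-1ᴹ 1F 2F = σ-0
    conjᵗ-1ᴹ 2F 0F = σ-0
    conjᵗ-1ᴹ 2F 1F = σ-0
    conjᵗ-1ᴹ 2F 2F = σ-1

    conjᵗ-· : ∀ A B → conj (A · B) ᵗ ≋ conj B ᵗ · conj A ᵗ
    conjᵗ-· A B i j = trans (σ-sum (λ k → A j k * B k i))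
      (sum-cong-≋ (λ k → trans (σ-* (A j k) (B k i)) (*-comm (σ (A j k)) (σ (B k i)))))

    M₃-setoid : Setoid c ℓ
    M₃-setoid = record
      { Carrier = M₃
      ; _≈_ = _≋_
      ; isEquivalence = record { refl = ≋-refl ; sym = ≋-sym ; trans = ≋-trans }
      }

    open ≈-Reasoning M₃-setoid

    ·-congˡ : ∀ {A B C} → B ≋ C → A · B ≋ A · C
    ·-congˡ {A} = ·-cong {A} ≋-refl

    ·-congʳ : ∀ {A B C} → B ≋ C → B · A ≋ C · A
    ·-congʳ {A} p = ·-cong {B = A} p ≋-refl

    cancel-middle : ∀ A B C D → B · C ≋ 1ᴹ → (A · B) · (C · D) ≋ A · D
    cancel-middle A B C D p = begin
      (A · B) · (C · D)  ≈⟨ ·-assoc A B (C · D) ⟩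
      A · (B · (C · D))  ≈⟨ ·-congˡ {A} (·-assoc B C D) ⟨
      A · (B · C · D)    ≈⟨ ·-congˡ {A} (·-congʳ {D} p) ⟩
      A · (1ᴹ · D)       ≈⟨ ·-congˡ {A} (·-identityˡ D) ⟩
      A · D              ∎

    product-inverse : ∀ A A′ B B′ → A · A′ ≋ 1ᴹ → B · B′ ≋ 1ᴹ → (A · B) · (B′ · A′) ≋ 1ᴹ
    product-inverse A A′ B B′ p q = ≋-trans (cancel-middle A B B′ A′ q) p

    form-· : ∀ A B → conj (A · B) ᵗ · J · (A · B) ≋ conj B ᵗ · (conj A ᵗ · J · A) · B
    form-· A B = begin
      conj (A · B) ᵗ · J · (A · B)              ≈⟨ ·-congʳ {A · B} (·-congʳ {J} (conjᵗ-· A B)) ⟩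
      conj B ᵗ · conj A ᵗ · J · (A · B)         ≈⟨ ·-congʳ {A · B} (·-assoc (conj B ᵗ) (conj A ᵗ) J) ⟩
      conj B ᵗ · (conj A ᵗ · J) · (A · B)       ≈⟨ ·-assoc (conj B ᵗ · (conj A ᵗ · J)) A B ⟨
      conj B ᵗ · (conj A ᵗ · J) · A · B         ≈⟨ ·-congʳ {B} (·-assoc (conj B ᵗ) (conj A ᵗ · J) A) ⟩
      conj B ᵗ · (conj A ᵗ · J · A) · B         ∎

    unitary-· : ∀ A B → conj A ᵗ · J · A ≋ J → conj B ᵗ · J · B ≋ J →
                conj (A · B) ᵗ · J · (A · B) ≋ J
    unitary-· A B p q = begin
      conj (A · B) ᵗ · J · (A · B)       ≈⟨ form-· A B ⟩
      conj B ᵗ · (conj A ᵗ · J · A) · B  ≈⟨ ·-congʳ {B} (·-congˡ {conj B ᵗ} p) ⟩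
      conj B ᵗ · J · B                   ≈⟨ q ⟩
      J                                  ∎

    unitary-1ᴹ : conj 1ᴹ ᵗ · J · 1ᴹ ≋ J
    unitary-1ᴹ = begin
      conj 1ᴹ ᵗ · J · 1ᴹ  ≈⟨ ·-identityʳ (conj 1ᴹ ᵗ · J) ⟩
      conj 1ᴹ ᵗ · J       ≈⟨ ·-congʳ {J} conjᵗ-1ᴹ ⟩
      1ᴹ · J              ≈⟨ ·-identityˡ J ⟩
      J                   ∎

    unitary-inv : ∀ A A′ → A · A′ ≋ 1ᴹ → conj A ᵗ · J · A ≋ J → conj A′ ᵗ · J · A′ ≋ J
    unitary-inv A A′ p q = begin
      conj A′ ᵗ · J · A′                   ≈⟨ ·-congʳ {A′} (·-congˡ {conj A′ ᵗ} q) ⟨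
      conj A′ ᵗ · (conj A ᵗ · J · A) · A′  ≈⟨ form-· A A′ ⟨
      conj (A · A′) ᵗ · J · (A · A′)       ≈⟨ ·-cong (·-congʳ {J} (conjᵗ-cong p)) p ⟩
      conj 1ᴹ ᵗ · J · 1ᴹ                   ≈⟨ unitary-1ᴹ ⟩
      J                                    ∎

    inv-cong : ∀ A A′ B B′ → A′ · A ≋ 1ᴹ → B · B′ ≋ 1ᴹ → A ≋ B → A′ ≋ B′
    inv-cong A A′ B B′ p q A≋B = begin
      A′             ≈⟨ ·-identityʳ A′ ⟨
      A′ · 1ᴹ        ≈⟨ ·-congˡ {A′} q ⟨
      A′ · (B · B′)  ≈⟨ ·-assoc A′ B B′ ⟨
      A′ · B · B′    ≈⟨ ·-congʳ {B′} (·-congˡ {A′} A≋B) ⟨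
      A′ · A · B′    ≈⟨ ·-congʳ {B′} p ⟩
      1ᴹ · B′        ≈⟨ ·-identityˡ B′ ⟩
      B′             ∎

  U : Group (c ⊔ ℓ) ℓ
  U = record
    { Carrier = Unitary
    ; _≈_ = _≋_ on matrix
    ; _∙_ = λ g h → record
      { matrix   = matrix g · matrix h
      ; inv      = inv h · inv g
      ; inverseʳ = product-inverse (matrix g) (inv g) (matrix h) (inv h) (inverseʳ g) (inverseʳ h)
      ; inverseˡ = product-inverse (inv h) (matrix h) (inv g) (matrix g) (inverseˡ h) (inverseˡ g)
      ; unitary  = unitary-· (matrix g) (matrix h) (unitary g) (unitary h)
      }
    ; ε = record
      { matrix   = 1ᴹ
      ; inv      = 1ᴹ
      ; inverseʳ = ·-identityˡ 1ᴹ
      ; inverseˡ = ·-identityˡ 1ᴹ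
      ; unitary  = unitary-1ᴹ
      }
    ; _⁻¹ = λ g → record
      { matrix   = inv g
      ; inv      = matrix g
      ; inverseʳ = inverseˡ g
      ; inverseˡ = inverseʳ g
      ; unitary  = unitary-inv (matrix g) (inv g) (inverseʳ g) (unitary g)
      }
    ; isGroup = record
      { isMonoid = record
        { isSemigroup = record
          { isMagma = record
            { isEquivalence = record { refl = ≋-refl ; sym = ≋-sym ; trans = ≋-trans }
            ; ∙-cong = ·-cong
            }
          ; assoc = λ g h k → ·-assoc (matrix g) (matrix h) (matrix k)
          }
        ; identity = (λ g → ·-identityˡ (matrix g)) , (λ g → ·-identityʳ (matrix g))
        }
      ; inverse = inverseˡ , inverseʳ
      ; ⁻¹-cong = λ {g} {h} → inv-cong (matrix g) (inv g) (matrix h) (inv h) (inverseˡ g) (inverseʳ h)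
      }
    }

  -- The subspace topology of M₃ = E⁹; GL₃(E) carries it too, inversion
  -- being continuous on GL₃(E) for the topology of E⁹.
  IsOpen : Pred (Pred Unitary (c ⊔ ℓ)) (c ⊔ ℓ)
  IsOpen A = ∀ g → g ∈ A →
    ∃[ N ] ∀ h → (∀ i j → (matrix h i j - matrix g i j) ∈ 𝔓^ N) → h ∈ A

  Γ-entry : ℕ → Fin 3 → Fin 3 → Pred Carrier 0ℓ
  Γ-entry n 0F 0F = 𝔒
  Γ-entry n 0F 1F = 𝔒
  Γ-entry n 0F 2F = 𝔓^ (ℤ.- (+ n))
  Γ-entry n 1F 0F = 𝔓^ (+ n)
  Γ-entry n 1F 1F = λ x → (x - 1#) ∈ 𝔓^ (+ n)
  Γ-entry n 1F 2F = 𝔒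
  Γ-entry n 2F 0F = 𝔓^ (+ n)
  Γ-entry n 2F 1F = 𝔓^ (+ n)
  Γ-entry n 2F 2F = 𝔒

  Γ : ℕ → Pred Unitary (c ⊔ ℓ)
  Γ n g = (∀ i j → matrix g i j ∈ Γ-entry n i j) ∧ det (matrix g) ∈ 𝔒ˣ

  Γ-isOpen : ∀ n → IsOpen (Γ n)
  Γ-isOpen n g (g∈ , det∈) = N , λ h h~g →
    (λ i j → close-entry i j (matrix h i j) (h~g i j)) ,
    𝔒ˣ-~ (det-~ (matrix h) h~g) det∈
    where
    m N : ℤ
    m = ℤ.- (+ n)
    N = + 1 ℤ.+ (+ n ℤ.+ + n)

    n≤N : + n ℤ.≤ N
    n≤N = ℤ.+≤+ (ℕₚ.≤-trans (ℕₚ.m≤m+n n n) (ℕₚ.n≤1+n (n ℕ.+ n)))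

    0≤n : + 0 ℤ.≤ + n
    0≤n = ℤ.+≤+ ℕ.z≤n

    0≤N : + 0 ℤ.≤ N
    0≤N = ℤ.+≤+ ℕ.z≤n

    m≤0 : m ℤ.≤ + 0
    m≤0 = ℤₚ.neg-mono-≤ 0≤n

    m≤n : m ℤ.≤ + n
    m≤n = ℤₚ.≤-trans m≤0 0≤n

    m≤N : m ℤ.≤ N
    m≤N = ℤₚ.≤-trans m≤0 0≤N

    close-entry : ∀ i j x → x ~ matrix g i j [ N ] → x ∈ Γ-entry n i j
    close-entry 0F 0F x p = 𝔓^-~ 0≤N p (g∈ 0F 0F)
    close-entry 0F 1F x p = 𝔓^-~ 0≤N p (g∈ 0F 1F)
    close-entry 0F 2F x p = 𝔓^-~ m≤N p (g∈ 0F 2F)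
    close-entry 1F 0F x p = 𝔓^-~ n≤N p (g∈ 1F 0F)
    close-entry 1F 1F x p = 𝔓^-~ n≤N (~-+ p (~-refl (- 1#))) (g∈ 1F 1F)
    close-entry 1F 2F x p = 𝔓^-~ 0≤N p (g∈ 1F 2F)
    close-entry 2F 0F x p = 𝔓^-~ n≤N p (g∈ 2F 0F)
    close-entry 2F 1F x p = 𝔓^-~ n≤N p (g∈ 2F 1F)
    close-entry 2F 2F x p = 𝔓^-~ 0≤N p (g∈ 2F 2F)

    entry∈ : ∀ i j {x} → x ∈ Γ-entry n i j → x ∈ 𝔓^ m
    entry∈ 0F 0F = 𝔓^-weaken m≤0
    entry∈ 0F 1F = 𝔓^-weaken m≤0
    entry∈ 0F 2F = λ p → p
    entry∈ 1F 0F = 𝔓^-weaken m≤n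
    entry∈ 1F 1F = λ p → 𝔓^-weaken m≤0 (𝔓^-~ ℤₚ.≤-refl (𝔓^-weaken 0≤n p) 1∈𝔒)
    entry∈ 1F 2F = 𝔓^-weaken m≤0
    entry∈ 2F 0F = 𝔓^-weaken m≤n
    entry∈ 2F 1F = 𝔓^-weaken m≤n
    entry∈ 2F 2F = 𝔓^-weaken m≤0

    module _ (A : M₃) (A~g : ∀ i j → A i j ~ matrix g i j [ N ]) where

      product-~ : ∀ i j i′ j′ i″ j″ →
        A i j * A i′ j′ * A i″ j″ ~ matrix g i j * matrix g i′ j′ * matrix g i″ j″ [ + 1 ]
      product-~ i j i′ j′ i″ j″ =
        ~-* {k = N ℤ.+ m} {l = N} {a = m} {b = m ℤ.+ m}
          (~-* (A~g i j) (A∈ i′ j′) ℤₚ.≤-refl (gm i j) (A~g i′ j′) (ℤₚ.≤-reflexive (ℤₚ.+-comm N m)))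
          (A∈ i″ j″) (ℤₚ.≤-reflexive (≡.sym N+m+m))
          (𝔓^-* (gm i j) (gm i′ j′)) (A~g i″ j″)
          (ℤₚ.≤-reflexive (≡.sym (≡.trans (ℤₚ.+-comm (m ℤ.+ m) N) (≡.trans (≡.sym (ℤₚ.+-assoc N m m)) N+m+m))))
        where
        gm : ∀ i j → matrix g i j ∈ 𝔓^ m
        gm i j = entry∈ i j (g∈ i j)

        A∈ : ∀ i j → A i j ∈ 𝔓^ m
        A∈ i j = 𝔓^-~ m≤N (A~g i j) (gm i j)

        N+m+m : N ℤ.+ m ℤ.+ m ≡ + 1
        N+m+m = solve-N (+ n)
          where
          solve-N : ∀ k → + 1 ℤ.+ (k ℤ.+ k) ℤ.+ ℤ.- k ℤ.+ ℤ.- k ≡ + 1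
          solve-N = solve-∀

      det-~ : det A ~ det (matrix g) [ + 1 ]
      det-~ = ~-+ (~-+ (~-+ (~-+ (~-+
          (product-~ 0F 0F 1F 1F 2F 2F)
          (product-~ 0F 1F 1F 2F 2F 0F))
          (product-~ 0F 2F 1F 0F 2F 1F))
          (~-neg (product-~ 0F 2F 1F 1F 2F 0F)))
          (~-neg (product-~ 0F 1F 1F 0F 2F 2F)))
          (~-neg (product-~ 0F 0F 1F 2F 2F 1F))

------------------------------------------------------------------------
-- Extended reals, as lower Dedekind cuts: x is given by the set of
-- rationals below x.  (∅ is -∞ and ℚ is +∞.)

record ℝ∞ : Set₁ where
  field
    Below   : Pred ℚ 0ℓ
    closed  : ∀ {p q} → p ℚ.< q → q ∈ Below → p ∈ Below
    rounded : ∀ {p} → p ∈ Below → ∃[ q ] (p ℚ.< q ∧ q ∈ Below)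

open ℝ∞ public using (Below)
open ℝ∞

infix 4 _≃_ _≲_

_≃_ _≲_ : ℝ∞ → ℝ∞ → Set
x ≃ y = Below x ≐ Below y
x ≲ y = Below x ⊆ Below y

fromℚ : ℚ → ℝ∞
fromℚ r = record
  { Below   = ℚ._< r
  ; closed  = ℚₚ.<-trans
  ; rounded = ℚₚ.<-dense
  }

infixl 6 _⊕_

_⊕_ : ℝ∞ → ℝ∞ → ℝ∞
x ⊕ y = record
  { Below   = λ r → ∃₂ λ s t → s ∈ Below x ∧ t ∈ Below y ∧ r ≡ s ℚ.+ t
  ; closed  = λ { {p} p<q (s , t , s∈ , t∈ , ≡.refl) →
                  p ℚ.- t , t , closed x (shift p s t p<q) s∈ , t∈ , restore p t }
  ; rounded = λ { (s , t , s∈ , t∈ , ≡.refl) →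
                  let s′ , s<s′ , s′∈ = rounded x s∈ in
                  s′ ℚ.+ t , ℚₚ.+-monoˡ-< t s<s′ , s′ , t , s′∈ , t∈ , ≡.refl }
  }
  where
  open AbelianGroupProperties ℚₚ.+-0-abelianGroup using (//-rightDividesˡ; //-rightDividesʳ)

  restore : ∀ p t → p ≡ p ℚ.- t ℚ.+ t
  restore p t = ≡.sym (//-rightDividesˡ t p)

  shift : ∀ p s t → p ℚ.< s ℚ.+ t → p ℚ.- t ℚ.< s
  shift p s t p<s+t = ≡.subst (p ℚ.- t ℚ.<_) (//-rightDividesʳ t s) (ℚₚ.+-monoˡ-< (ℚ.- t) p<s+t)

supremum : (ℕ → ℝ∞) → ℝ∞
supremum x = record
  { Below   = λ r → ∃[ n ] r ∈ Below (x n)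
  ; closed  = λ { p<q (n , q∈) → n , closed (x n) p<q q∈ }
  ; rounded = λ { (n , p∈) → let q , p<q , q∈ = rounded (x n) p∈ in q , p<q , n , q∈ }
  }

partialSum : (ℕ → ℝ∞) → ℕ → ℝ∞
partialSum x zero    = fromℚ 0ℚ
partialSum x (suc n) = partialSum x n ⊕ x n

-- For nonnegative terms, whose sum is the supremum of the partial sums.
series : (ℕ → ℝ∞) → ℝ∞
series x = supremum (partialSum x)

------------------------------------------------------------------------
-- Left Haar measures: nonzero left-invariant Radon measures on the Borel
-- sets of a group with a given family of open sets

module Haar {g ℓ s t : Level} (G : Group g ℓ)
  (IsOpen : Pred (Pred (Group.Carrier G) s) t) where

  open Group G

  data Borel : Pred Carrier s → Set (g ⊔ ℓ ⊔ lsuc s ⊔ t) where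
    isOpen     : ∀ {A} → IsOpen A → Borel A
    complement : ∀ {A} → Borel A → Borel (∁ A)
    union      : ∀ {A : ℕ → Pred Carrier s} → (∀ i → Borel (A i)) → Borel (⋃ ℕ A)
    resp-≐     : ∀ {A B} → A ≐ B → Borel A → Borel B

  Compact : Pred Carrier s → Set (g ⊔ lsuc s ⊔ t)
  Compact K = ∀ {I : Set s} (V : I → Pred Carrier s) → (∀ i → IsOpen (V i)) →
              K ⊆ ⋃ I V → ∃[ is ] K ⊆ (λ x → Any (λ i → x ∈ V i) is)

  -- The left translate x A.
  translate : Carrier → Pred Carrier s → Pred Carrier s
  translate x A y = (x ⁻¹ ∙ y) ∈ A

  record HaarMeasure : Set (g ⊔ ℓ ⊔ lsuc s ⊔ t ⊔ lsuc 0ℓ) where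
    field
      vol      : ∀ A → Borel A → ℝ∞
      vol-cong : ∀ {A B} (a : Borel A) (b : Borel B) → A ≐ B → vol A a ≃ vol B b

      nonnegative         : ∀ {A} (a : Borel A) → fromℚ 0ℚ ≲ vol A a
      vol-∅               : ∀ {A} (a : Borel A) → Empty A → vol A a ≃ fromℚ 0ℚ
      countably-additive  : ∀ {A : ℕ → Pred Carrier s} (a : ∀ i → Borel (A i)) →
                            (∀ {i j} → i ≢ j → A i ⊥ A j) →
                            vol (⋃ ℕ A) (union a) ≃ series (λ i → vol (A i) (a i))

      finite-on-compacts  : ∀ {K} (k : Borel K) → Compact K → ∃[ r ] vol K k ≲ fromℚ r
      outer-regular       : ∀ {A} (a : Borel A) {q r} → vol A a ≲ fromℚ q → q ℚ.< r →
                            ∃[ V ] Σ[ o ∈ IsOpen V ] (A ⊆ V ∧ vol V (isOpen o) ≲ fromℚ r)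
      inner-regular       : ∀ {V} (o : IsOpen V) {q} → q ∈ Below (vol V (isOpen o)) →
                            ∃[ K ] Σ[ k ∈ Borel K ] (Compact K ∧ K ⊆ V ∧ q ∈ Below (vol K k))

      left-invariant      : ∀ x {A} (a : Borel A) (xa : Borel (translate x A)) →
                            vol (translate x A) xa ≃ vol A a
      nonzero             : ¬ (∀ {A} (a : Borel A) → vol A a ≃ fromℚ 0ℚ)

------------------------------------------------------------------------
-- Negative powers of natural numbers

infix 8 _^-_

_^-_ : (q k : ℕ) .{{_ : ℕ.NonZero q}} → ℚ
q ^- k = (+ 1 ℚ./ q ℕ.^ k) {{ℕₚ.m^n≢0 q k}}

1+q^-k≢0 : ∀ q k .{{_ : ℕ.NonZero q}} → ℚ.NonZero (1ℚ ℚ.+ q ^- k)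
1+q^-k≢0 q k = ℚₚ.pos⇒nonZero (1ℚ ℚ.+ q ^- k)
  {{ℚₚ.pos+pos⇒pos 1ℚ (q ^- k) {{ℚₚ.normalize-pos 1 (q ℕ.^ k) {{ℕₚ.m^n≢0 q k}}}}}}

{-# OPTIONS --safe #-}
module Submission where

-- The volumes are compared along chains of compact open subgroups: if A is a
-- disjoint union of N left translates of B then vol A = N · vol B.  Write
-- K r s m for the variant of Γ n with 𝔓^ (- r) in the corner, 𝔓^ s below the
-- diagonal and 1 + 𝔓^ m in the centre, so that Γ n = K n n n, and q for q_F.
-- Factoring matrices through lower unipotent, diagonal and upper unipotent ones gives
--   [ Γ 0 : K 0 1 0 ] = q³ + 1                      (isotropic lines over the residue field),
--   [ K 0 1 0 : K 0 1 1 ] = q + 1                   (norm-one residues),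
--   [ K k (k+1) (k+1) : K k (k+2) (k+1) ] = q³      (lower unipotents),
--   [ K k (k+2) (k+1) : K k (k+2) (k+2) ] = q       (norm-one elements of 1 + 𝔓^ (k+1)),
--   [ K (k+1) (k+2) (k+2) : K k (k+2) (k+2) ] = q   (upper unipotents),
--   [ Γ (k+1) : K k (k+1) (k+1) ] = q + 1           (P¹ of the residue field of F).
-- Hence the Iwahori subgroups K k (k+1) (k+1) shrink by q³ at each step.
--
-- The coset representatives are exact unitary matrices, which needs coordinates
-- on E: 𝔒 = F.𝔒 + F.𝔒 θ with δ = θ - σ θ a unit (in every residue
-- characteristic), so τ = θ / δ has trace 1, the elements of trace 0 are F δ,
-- and the norm-one elements are the quotients α / σ α.

open import Defs
open import Algebra.Bundles using (CommutativeRing; Group)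
open import Algebra.Morphism.Structures using (module RingMorphisms)
import Algebra.Properties.AbelianGroup as AbelianGroupProperties
import Algebra.Properties.Monoid.Mult as MonoidMult
import Algebra.Properties.Ring as RingProperties
import Algebra.Properties.Semiring.Mult as SemiringMult
import Algebra.Properties.Semiring.Mult.TCOptimised as OptimisedMult
import Algebra.Solver.Ring as RingSolver
open import Algebra.Solver.Ring.AlmostCommutativeRing
  using (AlmostCommutativeRing; fromCommutativeRing; _-Raw-AlmostCommutative⟶_)
open import Data.Empty using (⊥; ⊥-elim)
open import Data.Fin as Fin using (Fin; zero; suc)
open import Data.Fin.Patterns using (0F; 1F; 2F)
import Data.Fin.Properties as Finₚ
open import Data.Integer as ℤ using (ℤ; +_; -[1+_])
import Data.Integer.Properties as ℤₚ
import Data.Integer.Tactic.RingSolver as ℤ-RingSolver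
import Data.Maybe as Maybe
open import Data.Nat as ℕ using (ℕ; zero; suc)
import Data.Nat.Properties as ℕₚ
open import Data.Product using (_,_; proj₁; proj₂; ∃; ∃₂; ∃-syntax; Σ-syntax) renaming (_×_ to _∧_)
open import Data.Product.Function.NonDependent.Propositional using (_×-↔_)
open import Data.Rational as ℚ using (ℚ; 0ℚ; 1ℚ)
import Data.Rational.Properties as ℚₚ
import Data.Rational.Unnormalised as ℚᵘ
import Data.Rational.Unnormalised.Properties as ℚᵘₚ
open import Data.Sum using (_⊎_; inj₁; inj₂; [_,_]′)
open import Data.Sum.Function.Propositional using (_⊎-↔_)
open import Data.Unit using (⊤; tt)
open import Function using (_↔_; Equivalence; Injective; Inverse; it)
open import Function.Properties.Inverse using (↔-refl; ↔-sym; ↔-trans)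
open import Level using (Level; _⊔_)
open import Relation.Binary.Definitions using (tri<; tri≈; tri>)
open import Relation.Binary.PropositionalEquality as ≡ using (_≡_; _≢_)
import Relation.Binary.Construct.Add.Supremum.NonStrict as AddSupremum
import Relation.Binary.Reasoning.Setoid as ≈-Reasoning
open import Relation.Nullary using (¬_; Dec; yes; no)
open import Relation.Nullary.Construct.Add.Supremum using ([_]; ⊤⁺)
open import Relation.Nullary.Decidable using (dec⇒maybe)
open import Relation.Unary using (Pred; _∈_; _∉_; _⊆_; _≐_; ⋃) renaming (_⊥_ to _⊥ᵖ_)

-- The groups `Γ n` and `Γ (suc n)` are not nested: the corner grows while the lower entries shrink.
-- The Iwahori subgroups of consecutive levels are not nested either, so they are compared through
-- their common part `K k (k+2) (k+2)`. The counts come from one fact about columns. The first and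
-- last columns of a unitary matrix are isotropic, so after scaling the leading entry to 1 the other
-- two satisfy z + σ z + y σ y = 0. Here y ranges over E, which contributes q² residue classes, and
-- z is then fixed up to trace zero, which contributes q more. Hence q³ for a lower unipotent step.
-- The obstacle is exactness. Entries of a given matrix have the right trace or norm only modulo a
-- power of 𝔓, while a representative must satisfy the unitary relation on the nose. The element τ
-- corrects traces and the quotients α / σ α correct norms in closed form, so no Hensel-type lifting
-- occurs; completeness enters only in showing that the residue extension is nontrivial.

-- Polynomial identities in a commutative ring, with integer coefficients.

module CommutativeRingSolver {c ℓ : Level} (R : CommutativeRing c ℓ) where

  open CommutativeRing R
  open RingProperties ring
  open OptimisedMult semiring
  open ≈-Reasoning setoid

  fromℤ : ℤ → Carrier
  fromℤ (+ n)    = n × 1#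
  fromℤ -[1+ n ] = - (suc n × 1#)

  private
    cancel-1 : ∀ x y → x - y ≈ (1# + x) - (1# + y)
    cancel-1 x y = sym (begin
      (1# + x) - (1# + y)        ≈⟨ +-congˡ (-‿+-comm 1# y) ⟨
      (1# + x) + (- 1# - y)      ≈⟨ +-congʳ (+-comm 1# x) ⟩
      (x + 1#) + (- 1# - y)      ≈⟨ +-assoc x 1# (- 1# - y) ⟩
      x + (1# + (- 1# - y))      ≈⟨ +-congˡ (+-assoc 1# (- 1#) (- y)) ⟨
      x + ((1# - 1#) - y)        ≈⟨ +-congˡ (+-congʳ (-‿inverseʳ 1#)) ⟩
      x + (0# - y)               ≈⟨ +-congˡ (+-identityˡ (- y)) ⟩
      x - y                      ∎)

  fromℤ-⊖ : ∀ m n → fromℤ (m ℤ.⊖ n) ≈ m × 1# - n × 1#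
  fromℤ-⊖ zero    zero    = sym (-‿inverseʳ 0#)
  fromℤ-⊖ zero    (suc n) = sym (+-identityˡ (- (suc n × 1#)))
  fromℤ-⊖ (suc m) zero    = sym (trans (+-congˡ -0#≈0#) (+-identityʳ (suc m × 1#)))
  fromℤ-⊖ (suc m) (suc n) = begin
    fromℤ (suc m ℤ.⊖ suc n)      ≡⟨ ≡.cong fromℤ (ℤₚ.[1+m]⊖[1+n]≡m⊖n m n) ⟩
    fromℤ (m ℤ.⊖ n)              ≈⟨ fromℤ-⊖ m n ⟩
    m × 1# - n × 1#              ≈⟨ cancel-1 (m × 1#) (n × 1#) ⟩
    (1# + m × 1#) - (1# + n × 1#) ≈⟨ +-cong (1+× m 1#) (-‿cong (1+× n 1#)) ⟨
    suc m × 1# - suc n × 1#      ∎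

  fromℤ-+ : ∀ i j → fromℤ (i ℤ.+ j) ≈ fromℤ i + fromℤ j
  fromℤ-+ (+ m)    (+ n)    = ×-homo-+ 1# m n
  fromℤ-+ (+ m)    -[1+ n ] = fromℤ-⊖ m (suc n)
  fromℤ-+ -[1+ m ] (+ n)    = trans (fromℤ-⊖ n (suc m)) (+-comm (n × 1#) _)
  fromℤ-+ -[1+ m ] -[1+ n ] = begin
    - (suc (suc (m ℕ.+ n)) × 1#)          ≡⟨ ≡.cong (λ k → - (k × 1#)) (ℕₚ.+-suc (suc m) n) ⟨
    - ((suc m ℕ.+ suc n) × 1#)            ≈⟨ -‿cong (×-homo-+ 1# (suc m) (suc n)) ⟩
    - (suc m × 1# + suc n × 1#)           ≈⟨ -‿+-comm (suc m × 1#) (suc n × 1#) ⟨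
    - (suc m × 1#) - suc n × 1#           ∎

  fromℤ-neg : ∀ i → fromℤ (ℤ.- i) ≈ - fromℤ i
  fromℤ-neg (+ zero)  = sym -0#≈0#
  fromℤ-neg (+ suc n) = refl
  fromℤ-neg -[1+ n ]  = sym (-‿involutive (suc n × 1#))

  private
    fromℤ-*⁺ : ∀ m n → fromℤ (+ m ℤ.* + n) ≈ fromℤ (+ m) * fromℤ (+ n)
    fromℤ-*⁺ m n = trans (reflexive (≡.cong fromℤ (≡.sym (ℤₚ.pos-* m n)))) (×1-homo-* m n)

  fromℤ-* : ∀ i j → fromℤ (i ℤ.* j) ≈ fromℤ i * fromℤ j
  fromℤ-* (+ m)    (+ n)    = fromℤ-*⁺ m n
  fromℤ-* (+ m)    -[1+ n ] = begin
    fromℤ (+ m ℤ.* ℤ.- (+ suc n))     ≡⟨ ≡.cong fromℤ (ℤₚ.neg-distribʳ-* (+ m) (+ suc n)) ⟨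
    fromℤ (ℤ.- (+ m ℤ.* + suc n))     ≈⟨ fromℤ-neg (+ m ℤ.* + suc n) ⟩
    - fromℤ (+ m ℤ.* + suc n)         ≈⟨ -‿cong (fromℤ-*⁺ m (suc n)) ⟩
    - (m × 1# * (suc n × 1#))         ≈⟨ -‿distribʳ-* (m × 1#) (suc n × 1#) ⟩
    m × 1# * - (suc n × 1#)           ∎
  fromℤ-* -[1+ m ] (+ n)    = begin
    fromℤ (ℤ.- (+ suc m) ℤ.* + n)     ≡⟨ ≡.cong fromℤ (ℤₚ.neg-distribˡ-* (+ suc m) (+ n)) ⟨
    fromℤ (ℤ.- (+ suc m ℤ.* + n))     ≈⟨ fromℤ-neg (+ suc m ℤ.* + n) ⟩
    - fromℤ (+ suc m ℤ.* + n)         ≈⟨ -‿cong (fromℤ-*⁺ (suc m) n) ⟩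
    - (suc m × 1# * (n × 1#))         ≈⟨ -‿distribˡ-* (suc m × 1#) (n × 1#) ⟩
    - (suc m × 1#) * (n × 1#)         ∎
  fromℤ-* -[1+ m ] -[1+ n ] = begin
    fromℤ (+ suc m ℤ.* + suc n)               ≈⟨ fromℤ-*⁺ (suc m) (suc n) ⟩
    suc m × 1# * (suc n × 1#)                 ≈⟨ -‿involutive _ ⟨
    - - (suc m × 1# * (suc n × 1#))           ≈⟨ -‿cong (-‿distribˡ-* (suc m × 1#) (suc n × 1#)) ⟩
    - (- (suc m × 1#) * (suc n × 1#))         ≈⟨ -‿distribʳ-* (- (suc m × 1#)) (suc n × 1#) ⟩
    - (suc m × 1#) * - (suc n × 1#)           ∎

  private
    almostCommutativeRing : AlmostCommutativeRing c ℓ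
    almostCommutativeRing = fromCommutativeRing R

    homomorphism : CommutativeRing.rawRing ℤₚ.+-*-commutativeRing -Raw-AlmostCommutative⟶ almostCommutativeRing
    homomorphism = record
      { ⟦_⟧    = fromℤ
      ; +-homo = fromℤ-+
      ; *-homo = fromℤ-*
      ; -‿homo = fromℤ-neg
      ; 0-homo = refl
      ; 1-homo = refl
      }

  -- Integer coefficients have decidable equality, so cancelling terms are recognised although
  -- equality in the ring itself is not assumed decidable.
  open RingSolver (CommutativeRing.rawRing ℤₚ.+-*-commutativeRing) almostCommutativeRing homomorphism
    (λ i j → Maybe.map (λ i≡j → reflexive (≡.cong fromℤ i≡j)) (dec⇒maybe (i ℤ.≟ j)))
    public

open AddSupremum ℤ._≤_ using (_≤⊤⁺) renaming (_≤⁺_ to _≤∞_; [_] to [_]≤)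

-- Valuations, units and inverses in a local field.

module LocalFieldProperties {c ℓ : Level} (K : LocalField c ℓ) where

  open LocalField K
  open Congruences K
  open CommutativeRingSolver commutativeRing

  v-0 : v 0# ≡ ⊤⁺
  v-0 = Equivalence.from (v-∞ 0#) refl

  0∈𝔓^ : ∀ {k} → 0# ∈ 𝔓^ k
  0∈𝔓^ {k} = ≡.subst ([ k ] ≤∞_) (≡.sym v-0) ([ k ] ≤⊤⁺)

  ≈0⇒∈𝔓^ : ∀ {k x} → x ≈ 0# → x ∈ 𝔓^ k
  ≈0⇒∈𝔓^ x≈0 = 𝔓^-cong (sym x≈0) 0∈𝔓^

  v≡⇒∈𝔓^ : ∀ {k x} → v x ≡ [ k ] → x ∈ 𝔓^ k
  v≡⇒∈𝔓^ eq = ≡.subst (_ ≤∞_) (≡.sym eq) [ ℤₚ.≤-refl ]≤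

  v≡⇒∉𝔓^ : ∀ {k l x} → v x ≡ [ k ] → k ℤ.< l → x ∉ 𝔓^ l
  v≡⇒∉𝔓^ {l = l} eq k<l x∈ with ≡.subst ([ l ] ≤∞_) eq x∈
  ... | [ l≤k ]≤ = ℤₚ.<⇒≱ k<l l≤k

  v≡⇒≉0 : ∀ {k x} → v x ≡ [ k ] → ¬ x ≈ 0#
  v≡⇒≉0 eq x≈0 with ≡.trans (≡.sym eq) (Equivalence.from (v-∞ _) x≈0)
  ... | ()

  zero⊎finite : ∀ x → x ≈ 0# ⊎ ∃[ k ] v x ≡ [ k ]
  zero⊎finite x with v x in eq
  ... | ⊤⁺    = inj₁ (Equivalence.to (v-∞ x) eq)
  ... | [ k ] = inj₂ (k , ≡.refl)

  _∈𝔓^?_ : ∀ x k → Dec (x ∈ 𝔓^ k)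
  x ∈𝔓^? k = AddSupremum.≤⁺-dec ℤ._≤_ ℤ._≤?_ [ k ] (v x)

  𝔓^-+ : ∀ {k x y} → x ∈ 𝔓^ k → y ∈ 𝔓^ k → (x + y) ∈ 𝔓^ k
  𝔓^-+ = v-+ _ _

  𝔓^-- : ∀ {k x y} → x ∈ 𝔓^ k → y ∈ 𝔓^ k → (x - y) ∈ 𝔓^ k
  𝔓^-- p q = 𝔓^-+ p (𝔓^-neg q)

  𝔒-*ˡ : ∀ {k x y} → x ∈ 𝔒 → y ∈ 𝔓^ k → (x * y) ∈ 𝔓^ k
  𝔒-*ˡ p q = 𝔓^-weaken (ℤₚ.≤-reflexive (≡.sym (ℤₚ.+-identityˡ _))) (𝔓^-* p q)

  𝔒-*ʳ : ∀ {k x y} → x ∈ 𝔓^ k → y ∈ 𝔒 → (x * y) ∈ 𝔓^ k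
  𝔒-*ʳ p q = 𝔓^-cong (*-comm _ _) (𝔒-*ˡ q p)

  𝔓^-*≤ : ∀ {k l m x y} → m ℤ.≤ k ℤ.+ l → x ∈ 𝔓^ k → y ∈ 𝔓^ l → (x * y) ∈ 𝔓^ m
  𝔓^-*≤ m≤ p q = 𝔓^-weaken m≤ (𝔓^-* p q)

  v-*-finite : ∀ {k l x y} → v x ≡ [ k ] → v y ≡ [ l ] → v (x * y) ≡ [ k ℤ.+ l ]
  v-*-finite p q = ≡.trans (v-* _ _) (≡.cong₂ _+∞_ p q)

  private
    +∞-finiteʳ : ∀ {k l} a → [ k ] +∞ a ≡ [ l ] → a ≡ [ ℤ.- k ℤ.+ l ]
    +∞-finiteʳ {k} [ b ] ≡.refl = ≡.cong [_] (≡.sym (≡.trans (≡.sym (ℤₚ.+-assoc (ℤ.- k) k b))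
      (≡.trans (≡.cong (ℤ._+ b) (ℤₚ.+-inverseˡ k)) (ℤₚ.+-identityˡ b))))

    +∞-cancel-≤ : ∀ {k l} a → [ k ℤ.+ l ] ≤∞ ([ k ] +∞ a) → [ l ] ≤∞ a
    +∞-cancel-≤         ⊤⁺    _       = _ ≤⊤⁺
    +∞-cancel-≤ {k} {l} [ b ] [ p ]≤  = [ ≡.subst₂ ℤ._≤_ (shift l) (shift b) (ℤₚ.+-monoʳ-≤ (ℤ.- k) p) ]≤
      where
      shift : ∀ b → ℤ.- k ℤ.+ (k ℤ.+ b) ≡ b
      shift b = ≡.trans (≡.sym (ℤₚ.+-assoc (ℤ.- k) k b))
        (≡.trans (≡.cong (ℤ._+ b) (ℤₚ.+-inverseˡ k)) (ℤₚ.+-identityˡ b))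

  reciprocal : ∀ {k x} → v x ≡ [ k ] → ∃[ y ] (x * y ≈ 1# ∧ v y ≡ [ ℤ.- k ])
  reciprocal {k} {x} vx with inverse x (v≡⇒≉0 vx)
  ... | y , xy≈1 = y , xy≈1 , ≡.trans (+∞-finiteʳ (v y) eq) (≡.cong [_] (ℤₚ.+-identityʳ (ℤ.- k)))
    where
    eq : [ k ] +∞ v y ≡ [ + 0 ]
    eq = ≡.trans (≡.cong (_+∞ v y) (≡.sym vx)) (≡.trans (≡.sym (v-* x y)) (≡.trans (v-cong xy≈1) v-1))

  𝔓^-cancelˡ : ∀ {k l x y} → v x ≡ [ k ] → (x * y) ∈ 𝔓^ (k ℤ.+ l) → y ∈ 𝔓^ l
  𝔓^-cancelˡ {k} {l} {x} {y} vx p =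
    +∞-cancel-≤ (v y) (≡.subst ([ k ℤ.+ l ] ≤∞_) (≡.trans (v-* x y) (≡.cong (_+∞ v y) vx)) p)

  Unit : Carrier → Set
  Unit x = v x ≡ [ + 0 ]

  unit⇒𝔒 : ∀ {x} → Unit x → x ∈ 𝔒
  unit⇒𝔒 = v≡⇒∈𝔓^

  unit∉𝔓 : ∀ {x} → Unit x → x ∉ 𝔓
  unit∉𝔓 u = v≡⇒∉𝔓^ u (ℤ.+<+ (ℕ.s≤s ℕ.z≤n))

  unit⊎𝔓 : ∀ {x} → x ∈ 𝔒 → Unit x ⊎ x ∈ 𝔓
  unit⊎𝔓 {x} x∈𝔒 with v x
  ... | ⊤⁺                   = inj₂ (_ ≤⊤⁺)
  ... | [ + zero ]           = inj₁ ≡.refl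
  ... | [ + suc n ]          = inj₂ [ ℤ.+≤+ (ℕ.s≤s ℕ.z≤n) ]≤
  unit⊎𝔓 [ () ]≤ | [ -[1+ n ] ]

  unit : ∀ {x} → x ∈ 𝔒 → x ∉ 𝔓 → Unit x
  unit x∈𝔒 x∉𝔓 with unit⊎𝔓 x∈𝔒
  ... | inj₁ u   = u
  ... | inj₂ x∈𝔓 = ⊥-elim (x∉𝔓 x∈𝔓)

  unit-* : ∀ {x y} → Unit x → Unit y → Unit (x * y)
  unit-* = v-*-finite

  unit-cong : ∀ {x y} → x ≈ y → Unit x → Unit y
  unit-cong x≈y = ≡.trans (≡.sym (v-cong x≈y))

  unit-neg : ∀ {x} → Unit x → Unit (- x)
  unit-neg = ≡.trans (v-- _)

  unit-reciprocal : ∀ {x} → Unit x → ∃[ y ] (x * y ≈ 1# ∧ Unit y)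
  unit-reciprocal = reciprocal

  unit-~ : ∀ {x y} → (x - y) ∈ 𝔓 → Unit y → Unit x
  unit-~ {x} {y} x~y u = unit x∈𝔒 λ x∈𝔓 → unit∉𝔓 u
    (𝔓^-cong (solve 2 (λ x y → x :- (x :- y) := y) refl x y) (𝔓^-- x∈𝔓 x~y))
    where
    x∈𝔒 : x ∈ 𝔒
    x∈𝔒 = 𝔓^-~ (ℤ.+≤+ ℕ.z≤n) x~y (unit⇒𝔒 u)

  unit-cancelˡ : ∀ {k x y} → Unit x → (x * y) ∈ 𝔓^ k → y ∈ 𝔓^ k
  unit-cancelˡ u p = 𝔓^-cancelˡ u (𝔓^-weaken (ℤₚ.≤-reflexive (ℤₚ.+-identityˡ _)) p)

  unit-cancelʳ : ∀ {k x y} → Unit y → (x * y) ∈ 𝔓^ k → x ∈ 𝔓^ k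
  unit-cancelʳ u p = unit-cancelˡ u (𝔓^-cong (*-comm _ _) p)

  unit⇒𝔒ˣ : ∀ {x} → Unit x → x ∈ 𝔒ˣ
  unit⇒𝔒ˣ u with unit-reciprocal u
  ... | y , xy≈1 , uy = unit⇒𝔒 u , y , unit⇒𝔒 uy , xy≈1

  zero-product : ∀ {x y} → x * y ≈ 0# → x ≈ 0# ⊎ y ≈ 0#
  zero-product {x} {y} xy≈0 with zero⊎finite x | zero⊎finite y
  ... | inj₁ x≈0      | _             = inj₁ x≈0
  ... | _             | inj₁ y≈0      = inj₂ y≈0
  ... | inj₂ (_ , vx) | inj₂ (_ , vy) = ⊥-elim (v≡⇒≉0 (v-*-finite vx vy) xy≈0)

  *-cancelʳ : ∀ {x y z k} → v z ≡ [ k ] → x * z ≈ y * z → x ≈ y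
  *-cancelʳ {x} {y} {z} vz xz≈yz with zero-product {x - y} {z}
    (trans (solve 3 (λ x y z → (x :- y) :* z := x :* z :- y :* z) refl x y z)
      (trans (+-congʳ xz≈yz) (-‿inverseʳ (y * z))))
  ... | inj₁ x-y≈0 = trans (solve 2 (λ x y → x := (x :- y) :+ y) refl x y) (trans (+-congʳ x-y≈0) (+-identityˡ y))
  ... | inj₂ z≈0   = ⊥-elim (v≡⇒≉0 vz z≈0)

  ∈𝔓^⇒0 : ∀ {x} → (∀ k → x ∈ 𝔓^ k) → x ≈ 0#
  ∈𝔓^⇒0 {x} p with zero⊎finite x
  ... | inj₁ x≈0      = x≈0
  ... | inj₂ (k , vx) = ⊥-elim (v≡⇒∉𝔓^ vx (ℤₚ.≤∧≢⇒< (ℤₚ.i≤suc[i] k) ℤₚ.i≢suc[i]) (p (ℤ.suc k)))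

-- Addition, finite sums and division by integers for extended reals.

open MonoidMult ℚₚ.+-0-monoid using (_×_)
open AbelianGroupProperties ℚₚ.+-0-abelianGroup using (//-rightDividesˡ; //-rightDividesʳ)
open ℝ∞ using (closed; rounded)

≃-refl : ∀ {x} → x ≃ x
≃-refl = (λ p → p) , (λ p → p)

≃-sym : ∀ {x y} → x ≃ y → y ≃ x
≃-sym (p , q) = q , p

≃-trans : ∀ {x y z} → x ≃ y → y ≃ z → x ≃ z
≃-trans (p , q) (p′ , q′) = (λ r → p′ (p r)) , (λ r → q (q′ r))

Nonnegative : ℝ∞ → Set
Nonnegative x = fromℚ 0ℚ ≲ x

private
  split : ∀ p t → p ≡ (p ℚ.- t) ℚ.+ t
  split p t = ≡.sym (//-rightDividesˡ t p)

  p-q<0 : ∀ {p q} → p ℚ.< q → p ℚ.- q ℚ.< 0ℚ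
  p-q<0 {p} {q} p<q = ≡.subst (p ℚ.- q ℚ.<_) (ℚₚ.+-inverseʳ q) (ℚₚ.+-monoˡ-< (ℚ.- q) p<q)

  deficit : ∀ {p q} → p ℚ.< q → ∃[ d ] (d ℚ.< 0ℚ ∧ p ≡ q ℚ.+ d)
  deficit {p} {q} p<q =
    p ℚ.- q , p-q<0 p<q , ≡.trans (split p q) (ℚₚ.+-comm (p ℚ.- q) q)

⊕-mono : ∀ {x x′ y y′} → x ≲ x′ → y ≲ y′ → x ⊕ y ≲ x′ ⊕ y′
⊕-mono f g (s , t , s∈ , t∈ , eq) = s , t , f s∈ , g t∈ , eq

-- Roundedness gives some `q` above `p` still below `x`; the deficit `p - q` is negative, hence
-- below every nonnegative `y`.
⊕-nonneg : ∀ x {y} → Nonnegative y → x ≲ x ⊕ y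
⊕-nonneg x 0≲y p∈ with rounded x p∈
... | q , p<q , q∈ with deficit p<q
... | d , d<0 , eq = q , d , q∈ , 0≲y d<0 , eq

⊕-zero : ∀ x {y} → y ≲ fromℚ 0ℚ → x ⊕ y ≲ x
⊕-zero x y≲0 (s , t , s∈ , t∈ , ≡.refl) =
  closed x (≡.subst (s ℚ.+ t ℚ.<_) (ℚₚ.+-identityʳ s) (ℚₚ.+-monoʳ-< s (y≲0 t∈))) s∈

fromℚ-⊕ : ∀ a b → fromℚ a ⊕ fromℚ b ≃ fromℚ (a ℚ.+ b)
fromℚ-⊕ a b = to , from
  where
  to : fromℚ a ⊕ fromℚ b ≲ fromℚ (a ℚ.+ b)
  to (s , t , s<a , t<b , ≡.refl) = ℚₚ.+-mono-< s<a t<b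

  from : fromℚ (a ℚ.+ b) ≲ fromℚ a ⊕ fromℚ b
  from {p} p<a+b = s , p ℚ.- s , s<a , p-s<b , ≡.trans (split p s) (ℚₚ.+-comm (p ℚ.- s) s)
    where
    p-b<a : p ℚ.- b ℚ.< a
    p-b<a = ≡.subst (p ℚ.- b ℚ.<_) (//-rightDividesʳ b a) (ℚₚ.+-monoˡ-< (ℚ.- b) p<a+b)
    -- Any `s` strictly between `p - b` and `a` leaves a remainder `p - s` less than `b`.
    s = proj₁ (ℚₚ.<-dense p-b<a)
    s<a : s ℚ.< a
    s<a = proj₂ (proj₂ (ℚₚ.<-dense p-b<a))
    p<s+b : p ℚ.< b ℚ.+ s
    p<s+b = ≡.subst₂ ℚ._<_ (//-rightDividesˡ b p) (ℚₚ.+-comm s b) (ℚₚ.+-monoˡ-< b (proj₁ (proj₂ (ℚₚ.<-dense p-b<a))))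
    p-s<b : p ℚ.- s ℚ.< b
    p-s<b = ≡.subst (p ℚ.- s ℚ.<_) (//-rightDividesʳ s b) (ℚₚ.+-monoˡ-< (ℚ.- s) p<s+b)

partialSum-mono : ∀ {f g} n → (∀ i → i ℕ.< n → f i ≲ g i) → partialSum f n ≲ partialSum g n
partialSum-mono zero    f≲g = λ p → p
partialSum-mono {f} {g} (suc n) f≲g =
  ⊕-mono {partialSum f n} {partialSum g n} {f n} {g n}
    (partialSum-mono {f} {g} n (λ i i<n → f≲g i (ℕₚ.m<n⇒m<1+n i<n))) (f≲g n ℕₚ.≤-refl)

partialSum-grow : ∀ {f m n} → (∀ i → Nonnegative (f i)) → m ℕ.≤′ n → partialSum f m ≲ partialSum f n
partialSum-grow {f} 0≲f (ℕ.≤′-reflexive ≡.refl)     p∈ = p∈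
partialSum-grow {f} {n = suc n} 0≲f (ℕ.≤′-step m≤n) p∈ =
  ⊕-nonneg (partialSum f n) {f n} (0≲f n) (partialSum-grow {f} 0≲f m≤n p∈)

partialSum-stop : ∀ {f m n} → (∀ i → m ℕ.≤ i → f i ≲ fromℚ 0ℚ) → m ℕ.≤′ n → partialSum f n ≲ partialSum f m
partialSum-stop {f} f≲0 (ℕ.≤′-reflexive ≡.refl)     p∈ = p∈
partialSum-stop {f} {n = suc n} f≲0 (ℕ.≤′-step m≤n) p∈ =
  partialSum-stop {f} f≲0 m≤n (⊕-zero (partialSum f n) {f n} (f≲0 n (ℕₚ.≤′⇒≤ m≤n)) p∈)

infixr 7 _⊗_

_⊗_ : ℕ → ℝ∞ → ℝ∞
n ⊗ x = partialSum (λ _ → x) n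

-- Nonnegative terms make the partial sums increase up to index `n` and zero terms freeze them
-- afterwards, so the supremum is attained at `n`.
series-finite : ∀ {f x} n → Nonnegative x → (∀ i → i ℕ.< n → f i ≃ x) → (∀ i → n ℕ.≤ i → f i ≃ fromℚ 0ℚ) →
                series f ≃ n ⊗ x
series-finite {f} {x} n 0≲x f≃x f≃0 = to , λ p∈ → n , partialSum-mono {λ _ → x} {f} n (λ i i<n → proj₂ (f≃x i i<n)) p∈
  where
  0≲f : ∀ i → Nonnegative (f i)
  0≲f i p∈ with ℕₚ.<-≤-connex i n
  ... | inj₁ i<n = proj₂ (f≃x i i<n) (0≲x p∈)
  ... | inj₂ n≤i = proj₂ (f≃0 i n≤i) p∈

  to-n : ∀ m {p} → p ∈ Below (partialSum f m) → p ∈ Below (partialSum f n)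
  to-n m with ℕₚ.≤-total m n
  ... | inj₁ m≤n = partialSum-grow {f} 0≲f (ℕₚ.≤⇒≤′ m≤n)
  ... | inj₂ n≤m = partialSum-stop {f} (λ i n≤i → proj₁ (f≃0 i n≤i)) (ℕₚ.≤⇒≤′ n≤m)

  to : series f ≲ n ⊗ x
  to (m , p∈) = partialSum-mono {f} {λ _ → x} n (λ i i<n → proj₁ (f≃x i i<n)) (to-n m p∈)

×-mono-< : ∀ n {p q} → p ℚ.< q → suc n × p ℚ.< suc n × q
×-mono-< zero    {p} {q} p<q = ℚₚ.+-monoˡ-< 0ℚ p<q
×-mono-< (suc n) {p} {q} p<q = ℚₚ.+-mono-< p<q (×-mono-< n p<q)

×-cancel-< : ∀ n {p q} → suc n × p ℚ.< suc n × q → p ℚ.< q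
×-cancel-< n {p} {q} np<nq with ℚₚ.<-cmp p q
... | tri< p<q _ _     = p<q
... | tri≈ _ ≡.refl _  = ⊥-elim (ℚₚ.<-irrefl ≡.refl np<nq)
... | tri> _ _ q<p     = ⊥-elim (ℚₚ.<-asym np<nq (×-mono-< n q<p))

⊗-fromℚ : ∀ n {x r} → x ≃ fromℚ r → n ⊗ x ≃ fromℚ (n × r)
⊗-fromℚ zero    x≃r = ≃-refl {fromℚ 0ℚ}
⊗-fromℚ (suc n) {x} {r} x≃r = ≃-trans {suc n ⊗ x} {fromℚ (n × r) ⊕ fromℚ r} {fromℚ (suc n × r)}
  ( ⊕-mono {n ⊗ x} {fromℚ (n × r)} {x} {fromℚ r} (proj₁ (⊗-fromℚ n {x} x≃r)) (proj₁ x≃r)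
  , ⊕-mono {fromℚ (n × r)} {n ⊗ x} {fromℚ r} {x} (proj₂ (⊗-fromℚ n {x} x≃r)) (proj₂ x≃r))
  (≡.subst (λ s → fromℚ (n × r) ⊕ fromℚ r ≃ fromℚ s) (ℚₚ.+-comm (n × r) r) (fromℚ-⊕ (n × r) r))

-- If n ⊗ x is rational then so is x; the summands of an element of
-- Below (n ⊗ x) that is at least n × p cannot all be less than p.
⊗-cancel : ∀ n {x r} → suc n ⊗ x ≃ fromℚ (suc n × r) → x ≃ fromℚ r
⊗-cancel n {x} {r} (to , from) = to′ , from′
  where
  below : ∀ m {p d} → p ∈ Below x → d ℚ.< 0ℚ → (m × p) ℚ.+ d ∈ Below (m ⊗ x)
  below zero    {p} {d} p∈ d<0 = ≡.subst (ℚ._< 0ℚ) (≡.sym (ℚₚ.+-identityˡ d)) d<0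
  below (suc m) {p} {d} p∈ d<0 = (m × p) ℚ.+ d , p , below m p∈ d<0 , p∈ ,
    ≡.trans (ℚₚ.+-assoc p (m × p) d) (ℚₚ.+-comm p _)

  to′ : x ≲ fromℚ r
  to′ {p} p∈ with rounded x p∈
  ... | q , p<q , q∈ with deficit (×-mono-< n p<q)
  ... | d , d<0 , eq = ×-cancel-< n (≡.subst (ℚ._< suc n × r) (≡.sym eq) (to (below (suc n) q∈ d<0)))

  above : ∀ m {p s} → (m × p) ℚ.≤ s → s ∈ Below (m ⊗ x) → p ∈ Below x
  above zero    0≤s s<0 = ⊥-elim (ℚₚ.<-irrefl ≡.refl (ℚₚ.<-≤-trans s<0 0≤s))
  above (suc m) {p} p+mp≤s (s , t , s∈ , t∈ , ≡.refl) with ℚₚ.<-cmp p t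
  ... | tri< p<t _ _    = closed x p<t t∈
  ... | tri≈ _ ≡.refl _ = t∈
  ... | tri> _ _ t<p    = above m (ℚₚ.≮⇒≥ λ s<mp → ℚₚ.<-irrefl ≡.refl (ℚₚ.<-≤-trans (ℚₚ.+-mono-< s<mp t<p)
                            (≡.subst (ℚ._≤ s ℚ.+ t) (ℚₚ.+-comm p (m × p)) p+mp≤s))) s∈

  from′ : fromℚ r ≲ x
  from′ p<r = above (suc n) ℚₚ.≤-refl (from (×-mono-< n p<r))

-- Disjoint unions of left translates and their volumes.

module CosetDecompositions {g ℓ s t : Level} (G : Group g ℓ)
  (IsOpen : Pred (Pred (Group.Carrier G) s) t)
  (translate-isOpen : ∀ x {A} → IsOpen A → IsOpen (Haar.translate G IsOpen x A))
  (⋃-isOpen : ∀ {I : Set} (A : I → Pred (Group.Carrier G) s) → (∀ i → IsOpen (A i)) → IsOpen (⋃ I A))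
  where

  open Group G using (Carrier)
  open Haar G IsOpen

  -- Stated for sets: additivity and left invariance see only a disjoint union of left translates.
  record _IsTransversal_/_ {I : Set} (x : I → Carrier) (A B : Pred Carrier s) : Set (g ⊔ s) where
    field
      contains : ∀ i → translate (x i) B ⊆ A
      covers   : A ⊆ (λ y → ∃[ i ] y ∈ translate (x i) B)
      disjoint : ∀ {i j y} → y ∈ translate (x i) B → y ∈ translate (x j) B → i ≡ j

  -- The shape of a rank-one Bruhat decomposition: a big cell with representatives `x`, and one
  -- remaining coset with representative `x₀`.
  adjoin-representative : ∀ {I : Set} {x₀ : Carrier} {x : I → Carrier} {A B : Pred Carrier s} →
    translate x₀ B ⊆ A → (∀ i → translate (x i) B ⊆ A) →
    (∀ {y} → y ∈ A → (∃[ i ] y ∈ translate (x i) B) ⊎ y ∈ translate x₀ B) →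
    (∀ i {y} → y ∈ translate (x i) B → y ∉ translate x₀ B) →
    (∀ {i j y} → y ∈ translate (x i) B → y ∈ translate (x j) B → i ≡ j) →
    [ (λ (_ : ⊤) → x₀) , x ]′ IsTransversal A / B
  adjoin-representative {I} {x₀} {x} {A} {B} x₀B⊆A xB⊆A covers separate disjoint = record
    { contains = λ { (inj₁ _) → x₀B⊆A ; (inj₂ i) → xB⊆A i }
    ; covers   = λ y∈A → [ (λ (i , y∈) → inj₂ i , y∈) , (λ y∈ → inj₁ tt , y∈) ]′ (covers y∈A)
    ; disjoint = λ {i} {j} → disjoint′ i j
    }
    where
    representative : ⊤ ⊎ I → Carrier
    representative = [ (λ _ → x₀) , x ]′

    disjoint′ : ∀ i j {y} → y ∈ translate (representative i) B → y ∈ translate (representative j) B → i ≡ j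
    disjoint′ (inj₁ _) (inj₁ _) p q = ≡.refl
    disjoint′ (inj₁ _) (inj₂ j) p q = ⊥-elim (separate j q p)
    disjoint′ (inj₂ i) (inj₁ _) p q = ⊥-elim (separate i p q)
    disjoint′ (inj₂ i) (inj₂ j) p q = ≡.cong inj₂ (disjoint p q)

  module _ (μ : HaarMeasure) where

    open HaarMeasure μ

    vol-transversal : ∀ {I : Set} {N} (I↔N : I ↔ Fin N) {x : I → Carrier} {A B} →
      x IsTransversal A / B → (a : IsOpen A) (b : IsOpen B) →
      vol A (isOpen a) ≃ N ⊗ vol B (isOpen b)
    vol-transversal {I} {N} I↔N {x} {A} {B} transversal a b =
      ≃-trans {vol A (isOpen a)} {vol (⋃ ℕ piece) (union pieceᴮ)} {N ⊗ vol B (isOpen b)}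
        (vol-cong (isOpen a) (union pieceᴮ) (A⊆ , ⊆A))
        (≃-trans {vol (⋃ ℕ piece) (union pieceᴮ)} {series (λ n → vol (piece n) (pieceᴮ n))} {N ⊗ vol B (isOpen b)}
          (countably-additive pieceᴮ disjoint-pieces)
          (series-finite {λ n → vol (piece n) (pieceᴮ n)} {vol B (isOpen b)} N (nonnegative (isOpen b)) vol-piece vol-rest))
      where
      open _IsTransversal_/_ transversal
      open Inverse I↔N using (to; from; strictlyInverseˡ; strictlyInverseʳ)

      index : I → ℕ
      index i = Fin.toℕ (to i)

      index-injective : ∀ {i j} → index i ≡ index j → i ≡ j
      index-injective {i} {j} eq = ≡.trans (≡.sym (strictlyInverseʳ i))
        (≡.trans (≡.cong from (Finₚ.toℕ-injective eq)) (strictlyInverseʳ j))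

      -- `countably-additive` wants a family indexed by ℕ. Taking the union over all `i` with
      -- `index i ≡ n` gives one translate for `n` below `N` and the empty set beyond, without
      -- deciding which case holds.
      piece : ℕ → Pred Carrier s
      piece n = ⋃ (Σ[ i ∈ I ] index i ≡ n) (λ (i , _) → translate (x i) B)

      pieceᴮ : ∀ n → Borel (piece n)
      pieceᴮ n = isOpen (⋃-isOpen _ λ (i , _) → translate-isOpen (x i) b)

      A⊆ : A ⊆ ⋃ ℕ piece
      A⊆ y∈A with covers y∈A
      ... | i , y∈ = index i , (i , ≡.refl) , y∈

      ⊆A : ⋃ ℕ piece ⊆ A
      ⊆A (_ , (i , _) , y∈) = contains i y∈

      disjoint-pieces : ∀ {m n} → m ≢ n → piece m ⊥ᵖ piece n
      disjoint-pieces m≢n (((i , ≡.refl) , y∈) , ((j , ≡.refl) , y∈′)) = m≢n (≡.cong index (disjoint y∈ y∈′))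

      vol-piece : ∀ n → n ℕ.< N → vol (piece n) (pieceᴮ n) ≃ vol B (isOpen b)
      vol-piece n n<N = ≃-trans {vol (piece n) (pieceᴮ n)} {vol (translate (x i) B) iB} {vol B (isOpen b)}
        (vol-cong (pieceᴮ n) iB (piece⊆ , λ y∈ → (i , index-i) , y∈))
        (left-invariant (x i) (isOpen b) iB)
        where
        i : I
        i = from (Fin.fromℕ< n<N)

        iB : Borel (translate (x i) B)
        iB = isOpen (translate-isOpen (x i) b)

        index-i : index i ≡ n
        index-i = ≡.trans (≡.cong Fin.toℕ (strictlyInverseˡ (Fin.fromℕ< n<N))) (Finₚ.toℕ-fromℕ< n<N)

        piece⊆ : piece n ⊆ translate (x i) B
        piece⊆ {y} ((j , index-j) , y∈) = ≡.subst (λ k → y ∈ translate (x k) B)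
          (index-injective (≡.trans index-j (≡.sym index-i))) y∈

      vol-rest : ∀ n → N ℕ.≤ n → vol (piece n) (pieceᴮ n) ≃ fromℚ 0ℚ
      vol-rest n N≤n = vol-∅ (pieceᴮ n) λ { _ ((i , ≡.refl) , _) → ℕₚ.<⇒≱ (Finₚ.toℕ<n (to i)) N≤n }

-- A missed value could be punched out, injecting `Fin (suc n)` into `Fin n`. It is applied to
-- squaring on a residue field of characteristic 2.
injective⇒surjective : ∀ {n} {f : Fin n → Fin n} → Injective _≡_ _≡_ f → ∀ y → ∃[ x ] f x ≡ y
injective⇒surjective {suc n} {f} f-injective y with Finₚ.any? (λ x → f x Finₚ.≟ y)
... | yes found = found
... | no  none  = ⊥-elim (ℕₚ.1+n≰n (Finₚ.injective⇒≤ {f = f-avoiding-y} λ {i} {j} eq →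
                    f-injective (Finₚ.punchOut-injective (y≢f i) (y≢f j) eq)))
  where
  y≢f : ∀ x → y ≢ f x
  y≢f x y≡fx = none (x , ≡.sym y≡fx)

  f-avoiding-y : Fin (suc n) → Fin n
  f-avoiding-y x = Fin.punchOut (y≢f x)

-- Digits: representatives of the quotients of successive powers of the maximal ideal.

module ResidueDigits {c ℓ : Level} (K : LocalField c ℓ) where

  open LocalField K
  open Congruences K
  open LocalFieldProperties K
  open CommutativeRingSolver commutativeRing

  digit : Fin q → Carrier
  digit i = proj₁ (proj₁ (proj₂ residue-bijective i))

  digit∈𝔒 : ∀ i → digit i ∈ 𝔒
  digit∈𝔒 i = proj₂ (proj₁ (proj₂ residue-bijective i))

  private
    residue-digit : ∀ i → residue (digit i , digit∈𝔒 i) ≡ i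
    residue-digit i = proj₂ (proj₂ residue-bijective i) (~-refl (digit i))

  digit-of : ∀ {x} → x ∈ 𝔒 → ∃[ i ] (x - digit i) ∈ 𝔓
  digit-of {x} x∈𝔒 = i , proj₁ residue-bijective {x , x∈𝔒} {digit i , digit∈𝔒 i} (≡.sym (residue-digit i))
    where i = residue (x , x∈𝔒)

  digit-unique : ∀ {i j} → (digit i - digit j) ∈ 𝔓 → i ≡ j
  digit-unique {i} {j} p = ≡.trans (≡.sym (residue-digit i))
    (≡.trans (residue-cong {digit i , digit∈𝔒 i} {digit j , digit∈𝔒 j} p) (residue-digit j))

  -- Chosen separately for each `k`, so these are not powers of one uniformiser; only the valuation
  -- matters.
  uniformiser^ : ℤ → Carrier
  uniformiser^ k = proj₁ (v-normalised k)

  v-uniformiser^ : ∀ k → v (uniformiser^ k) ≡ [ k ]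
  v-uniformiser^ k = proj₂ (v-normalised k)

  module _ {k x} (vx : v x ≡ [ k ]) where

    private
      k+1 : ∀ {y} → y ∈ 𝔓^ (k ℤ.+ + 1) → y ∈ 𝔓^ (ℤ.suc k)
      k+1 = ≡.subst (λ l → _ ∈ 𝔓^ l) (ℤₚ.+-comm k (+ 1))

    leading-coefficient : ∀ {y} → y ∈ 𝔓^ k → ∃[ z ] (z ∈ 𝔒 ∧ y ≈ x * z)
    leading-coefficient {y} y∈ with reciprocal vx
    ... | x′ , xx′≈1 , vx′ = x′ * y ,
      𝔓^-weaken (ℤₚ.≤-reflexive (≡.sym (ℤₚ.+-inverseˡ k))) (𝔓^-* (v≡⇒∈𝔓^ vx′) y∈) ,
      trans (sym (*-identityˡ y)) (trans (*-congʳ (sym xx′≈1)) (*-assoc x x′ y))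

    scale-𝔓 : ∀ {y} → y ∈ 𝔓 → (x * y) ∈ 𝔓^ (ℤ.suc k)
    scale-𝔓 y∈ = k+1 (𝔓^-* (v≡⇒∈𝔓^ vx) y∈)

    unscale-𝔓 : ∀ {y} → (x * y) ∈ 𝔓^ (ℤ.suc k) → y ∈ 𝔓
    unscale-𝔓 xy∈ = 𝔓^-cancelˡ vx (≡.subst (λ l → _ ∈ 𝔓^ l) (ℤₚ.+-comm (+ 1) k) xy∈)

    scaled-digit-of : ∀ {y} → y ∈ 𝔓^ k → ∃[ i ] (y - x * digit i) ∈ 𝔓^ (ℤ.suc k)
    scaled-digit-of {y} y∈ with leading-coefficient y∈
    ... | z , z∈ , y≈xz with digit-of z∈
    ... | i , z~ = i , 𝔓^-cong
      (trans (solve 3 (λ x z d → x :* (z :- d) := x :* z :- x :* d) refl x z (digit i)) (+-congʳ (sym y≈xz)))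
      (scale-𝔓 z~)

    scaled-digit-unique : ∀ {i j} → (x * digit i - x * digit j) ∈ 𝔓^ (ℤ.suc k) → i ≡ j
    scaled-digit-unique {i} {j} p = digit-unique (unscale-𝔓
      (𝔓^-cong (solve 3 (λ x d d′ → x :* d :- x :* d′ := x :* (d :- d′)) refl x (digit i) (digit j)) p))

-- Nontriviality of the residue field extension.

module ExtensionProperties {c₁ ℓ₁ c ℓ : Level} {F : LocalField c₁ ℓ₁} {E : LocalField c ℓ}
  (E/F : UnramifiedQuadraticExtension F E) where

  module F where
    open LocalField F public
    open Congruences F public
    open LocalFieldProperties F public
    open ResidueDigits F public

  open LocalField E
  open Congruences E
  open LocalFieldProperties E
  open CommutativeRingSolver commutativeRing
  open UnramifiedQuadraticExtension E/F
  open RingMorphisms.IsRingHomomorphism ι-isHomomorphism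
    public using () renaming (⟦⟧-cong to ι-cong; +-homo to ι-+; *-homo to ι-*; 0#-homo to ι-0; 1#-homo to ι-1; -‿homo to ι-neg)
  open RingMorphisms.IsRingIsomorphism σ-isAutomorphism
    public using () renaming (⟦⟧-cong to σ-cong; +-homo to σ-+; *-homo to σ-*; 0#-homo to σ-0; 1#-homo to σ-1; -‿homo to σ-neg)
  private module E = ResidueDigits E
  open E using (leading-coefficient; scale-𝔓)
  open ≈-Reasoning setoid

  ι-- : ∀ a b → ι (a F.- b) ≈ ι a - ι b
  ι-- a b = trans (ι-+ a (F.- b)) (+-congˡ (ι-neg b))

  σ-- : ∀ x y → σ (x - y) ≈ σ x - σ y
  σ-- x y = trans (σ-+ x (- y)) (+-congˡ (σ-neg y))

  v-ι : ∀ {k a} → F.v a ≡ [ k ] → v (ι a) ≡ [ k ]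
  v-ι = ≡.trans (unramified _)

  ι∈𝔓^ : ∀ {k a} → a ∈ F.𝔓^ k → ι a ∈ 𝔓^ k
  ι∈𝔓^ {k} = ≡.subst ([ k ] ≤∞_) (≡.sym (unramified _))

  ι⁻¹∈𝔓^ : ∀ {k a} → ι a ∈ 𝔓^ k → a ∈ F.𝔓^ k
  ι⁻¹∈𝔓^ {k} = ≡.subst ([ k ] ≤∞_) (unramified _)

  -- If 𝔒 were ι F.𝔒 + 𝔓, successive approximation would give E = ι F.
  module _ (approximate : ∀ {x} → x ∈ 𝔒 → ∃[ a ] (a ∈ F.𝔒 ∧ (x - ι a) ∈ 𝔓)) where

    private
      -- Ramification index 1 enters here: an element of `F` of valuation `k` has valuation `k` in
      -- `E` too, so `x` can be scaled into `𝔒`, approximated there, and scaled back within `F`.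
      approximate^ : ∀ {k x} → x ∈ 𝔓^ k → ∃[ a ] (x - ι a) ∈ 𝔓^ (ℤ.suc k)
      approximate^ {k} {x} x∈ with leading-coefficient (v-ι (F.v-uniformiser^ k)) x∈
      ... | z , z∈ , x≈pz with approximate z∈
      ... | a , _ , z~a = p F.* a , 𝔓^-cong
        (trans (solve 3 (λ p z a → p :* (z :- a) := p :* z :- p :* a) refl (ι p) z (ι a))
          (+-cong (sym x≈pz) (-‿cong (sym (ι-* p a)))))
        (scale-𝔓 (v-ι (F.v-uniformiser^ k)) z~a)
        where p = F.uniformiser^ k

      refine : ∀ {k x} → ∃[ a ] (x - ι a) ∈ 𝔓^ k → ∃[ a ] (x - ι a) ∈ 𝔓^ (ℤ.suc k)
      refine {k} {x} (a , x~a) = a F.+ proj₁ b , 𝔓^-cong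
          (trans (solve 3 (λ x a b → (x :- a) :- b := x :- (a :+ b)) refl x (ι a) (ι (proj₁ b)))
                 (+-congˡ (-‿cong (sym (ι-+ a (proj₁ b))))))
          (proj₂ b)
        where
        b : ∃[ b ] ((x - ι a) - ι b) ∈ 𝔓^ (ℤ.suc k)
        b = approximate^ x~a

      bounded-below : ∀ x → ∃[ k ] x ∈ 𝔓^ k
      bounded-below x with zero⊎finite x
      ... | inj₁ x≈0      = + 0 , ≈0⇒∈𝔓^ x≈0
      ... | inj₂ (k , vx) = k , v≡⇒∈𝔓^ vx

      module Limit (x : Carrier) (k : ℤ) (x∈ : x ∈ 𝔓^ k) where

        approximation : ∀ n → ∃[ a ] (x - ι a) ∈ 𝔓^ (+ n ℤ.+ k)
        approximation zero    = F.0# , 𝔓^-cong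
          (trans (solve 1 (λ x → x := x :- con (+ 0)) refl x) (+-congˡ (-‿cong (sym ι-0))))
          (𝔓^-weaken (ℤₚ.≤-reflexive (ℤₚ.+-identityˡ k)) x∈)
        approximation (suc n) = ≡.subst (λ l → ∃[ a ] (x - ι a) ∈ 𝔓^ l) (≡.sym (ℤₚ.+-assoc (+ 1) (+ n) k))
          (refine (approximation n))

        s : ℕ → F.Carrier
        s n = proj₁ (approximation n)

        x~s : ∀ {l} n → ℤ.∣ l ℤ.- k ∣ ℕ.≤ n → (x - ι (s n)) ∈ 𝔓^ l
        x~s {l} n N≤n = 𝔓^-weaken l≤n+k (proj₂ (approximation n))
          where
          i≤∣i∣ : ∀ i → i ℤ.≤ + ℤ.∣ i ∣
          i≤∣i∣ (+ n)    = ℤₚ.≤-refl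
          i≤∣i∣ -[1+ n ] = ℤ.-≤+

          eq : ∀ l k → l ≡ (l ℤ.- k) ℤ.+ k
          eq = ℤ-RingSolver.solve-∀

          l≤n+k : l ℤ.≤ + n ℤ.+ k
          l≤n+k = ℤₚ.≤-trans (ℤₚ.≤-reflexive (eq l k))
            (ℤₚ.+-monoˡ-≤ k (ℤₚ.≤-trans (i≤∣i∣ (l ℤ.- k)) (ℤ.+≤+ N≤n)))

        cauchy : F.Cauchy s
        cauchy l = ℤ.∣ l ℤ.- k ∣ , λ m n N≤m N≤n → ι⁻¹∈𝔓^ (𝔓^-cong
          (trans (solve 3 (λ x a b → (x :- b) :- (x :- a) := a :- b) refl x (ι (s m)) (ι (s n))) (sym (ι-- (s m) (s n))))
          (𝔓^-- (x~s n N≤n) (x~s m N≤m)))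

        a : F.Carrier
        a = proj₁ (F.complete s cauchy)

        x~a : ∀ l → (x - ι a) ∈ 𝔓^ l
        x~a l = 𝔓^-cong
            (trans (+-congˡ (ι-- (s n) a)) (solve 3 (λ x a b → (x :- b) :+ (b :- a) := x :- a) refl x (ι a) (ι (s n))))
            (𝔓^-+ (x~s n (ℕₚ.m≤m⊔n _ N)) (ι∈𝔓^ (proj₂ (proj₂ (F.complete s cauchy) l) n (ℕₚ.m≤n⊔m _ N))))
          where
          N n : ℕ
          N = proj₁ (proj₂ (F.complete s cauchy) l)
          n = ℤ.∣ l ℤ.- k ∣ ℕ.⊔ N

        x≈a : x ≈ ι a
        x≈a = trans (solve 2 (λ x a → x := (x :- a) :+ a) refl x (ι a))
          (trans (+-congʳ (∈𝔓^⇒0 x~a)) (+-identityˡ (ι a)))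

      ι-surjective : ∀ x → ∃[ a ] x ≈ ι a
      ι-surjective x = Limit.a x k x∈ , Limit.x≈a x k x∈
        where
        k = proj₁ (bounded-below x)
        x∈ = proj₂ (bounded-below x)

      -- The relation b e₁ - a e₂ = 0 between the basis vectors forces a = 0, hence e₁ = 0, and then
      -- 1 e₁ + 0 e₂ = 0 contradicts independence.
      not-both-in-F : ∀ {a b} → e₁ ≈ ι a → e₂ ≈ ι b → ⊥
      not-both-in-F {a} {b} e₁≈a e₂≈b = F.1≉0 (proj₁ (independent F.1# F.0# 1e₁+0e₂≈0))
        where
        be₁-ae₂≈0 : ι b * e₁ + ι (F.- a) * e₂ ≈ 0#
        be₁-ae₂≈0 = begin
          ι b * e₁ + ι (F.- a) * e₂    ≈⟨ +-cong (*-congˡ e₁≈a) (*-cong (ι-neg a) e₂≈b) ⟩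
          ι b * ι a + - ι a * ι b      ≈⟨ solve 2 (λ a b → b :* a :+ (:- a) :* b := con (+ 0)) refl (ι a) (ι b) ⟩
          0#                           ∎

        a≈0 : ι a ≈ 0#
        a≈0 = begin
          ι a              ≈⟨ solve 1 (λ a → a := :- (:- a)) refl (ι a) ⟩
          - (- ι a)        ≈⟨ -‿cong (ι-neg a) ⟨
          - ι (F.- a)      ≈⟨ -‿cong (ι-cong (proj₂ (independent b (F.- a) be₁-ae₂≈0))) ⟩
          - ι F.0#         ≈⟨ -‿cong ι-0 ⟩
          - 0#             ≈⟨ solve 0 (:- con (+ 0) := con (+ 0)) refl ⟩
          0#               ∎

        1e₁+0e₂≈0 : ι F.1# * e₁ + ι F.0# * e₂ ≈ 0#
        1e₁+0e₂≈0 = begin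
          ι F.1# * e₁ + ι F.0# * e₂    ≈⟨ +-cong (*-congˡ (trans e₁≈a a≈0)) (*-congʳ ι-0) ⟩
          ι F.1# * 0# + 0# * e₂        ≈⟨ solve 2 (λ x y → x :* con (+ 0) :+ con (+ 0) :* y := con (+ 0)) refl (ι F.1#) e₂ ⟩
          0#                           ∎

    residue-extension-nontrivial : ⊥
    residue-extension-nontrivial = not-both-in-F (proj₂ (ι-surjective e₁)) (proj₂ (ι-surjective e₂))

-- Coordinates on `E` with respect to `1` and `θ`.

module QuadraticExtension {c₁ ℓ₁ c ℓ : Level} {F : LocalField c₁ ℓ₁} {E : LocalField c ℓ}
  (E/F : UnramifiedQuadraticExtension F E) where

  open LocalField E
  open Congruences E
  open LocalFieldProperties E
  open CommutativeRingSolver commutativeRing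
  open UnramifiedQuadraticExtension E/F
  open ExtensionProperties E/F
  private module E = ResidueDigits E
  open ≈-Reasoning setoid

  private
    -- A finite search through the residue classes of `E`: if every class met `F`, the residue
    -- extension would be trivial. Comparing with digits of `F` suffices, since each integer of `F`
    -- is congruent to one.
    generator : ∃[ θ ] (θ ∈ 𝔒 ∧ (∀ a → a ∈ F.𝔒 → (θ - ι a) ∉ 𝔓))
    generator = search (Finₚ.all? (λ j → Finₚ.any? (λ i → (E.digit j - ι (F.digit i)) ∈𝔓^? (+ 1))))
      where
      Rational : Fin q → Set
      Rational j = ∃[ i ] (E.digit j - ι (F.digit i)) ∈ 𝔓

      search : Dec (∀ j → Rational j) → ∃[ θ ] (θ ∈ 𝔒 ∧ (∀ a → a ∈ F.𝔒 → (θ - ι a) ∉ 𝔓))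
      search (yes rational) = ⊥-elim (residue-extension-nontrivial λ x∈ →
        let j , x~ = E.digit-of x∈
            i , ~i = rational j
        in F.digit i , F.digit∈𝔒 i ,
           𝔓^-cong (solve 3 (λ x d e → (x :- d) :+ (d :- e) := x :- e) refl _ _ _) (𝔓^-+ x~ ~i))
      search (no ¬rational) = E.digit j , E.digit∈𝔒 j , λ a a∈ θ~a →
        let i , a~ = F.digit-of a∈
        in ¬j (i , 𝔓^-cong
             (trans (+-congˡ (ι-- a (F.digit i))) (solve 3 (λ x d e → (x :- d) :+ (d :- e) := x :- e) refl _ _ _))
             (𝔓^-+ θ~a (ι∈𝔓^ a~)))
        where
        irrational : ∃[ j ] ¬ Rational j
        irrational = Finₚ.¬∀⟶∃¬ q Rational (λ j → Finₚ.any? (λ i → (E.digit j - ι (F.digit i)) ∈𝔓^? (+ 1))) ¬rational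
        j : Fin q
        j = proj₁ irrational

        ¬j : ¬ Rational j
        ¬j = proj₂ irrational

  abstract
    θ : Carrier
    θ = proj₁ generator

    θ∈𝔒 : θ ∈ 𝔒
    θ∈𝔒 = proj₁ (proj₂ generator)

    θ-irrational : ∀ a → a ∈ F.𝔒 → (θ - ι a) ∉ 𝔓
    θ-irrational = proj₂ (proj₂ generator)

  private
    -- If `ι a + ι b * θ` had larger valuation than `b`, dividing by `b` would make `θ` congruent to
    -- `- a / b`, an integer of `F`.
    irrational-bound : ∀ {l} a b → F.v b ≡ [ l ] → (ι a + ι b * θ) ∉ 𝔓^ (ℤ.suc l)
    irrational-bound {l} a b vb s∈ = θ-irrational (F.- (b′ F.* a)) (F.𝔓^-neg b′a∈) (𝔓^-cong eq b′s∈)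
      where
      b′ : F.Carrier
      b′ = proj₁ (F.reciprocal vb)

      bb′≈1 : ι b * ι b′ ≈ 1#
      bb′≈1 = trans (sym (ι-* b b′)) (trans (ι-cong (proj₁ (proj₂ (F.reciprocal vb)))) ι-1)

      vb′ : F.v b′ ≡ [ ℤ.- l ]
      vb′ = proj₂ (proj₂ (F.reciprocal vb))

      a∈ : a ∈ F.𝔓^ l
      a∈ = ι⁻¹∈𝔓^ (𝔓^-cong (solve 2 (λ a bθ → (a :+ bθ) :- bθ := a) refl (ι a) (ι b * θ))
        (𝔓^-- (𝔓^-weaken (ℤₚ.i≤suc[i] l) s∈) (𝔒-*ʳ (v≡⇒∈𝔓^ (v-ι vb)) θ∈𝔒)))

      b′a∈ : (b′ F.* a) ∈ F.𝔒
      b′a∈ = F.𝔓^-weaken (ℤₚ.≤-reflexive (≡.sym (ℤₚ.+-inverseˡ l))) (F.𝔓^-* (F.v≡⇒∈𝔓^ vb′) a∈)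

      b′s∈ : (ι b′ * (ι a + ι b * θ)) ∈ 𝔓
      b′s∈ = 𝔓^-weaken (ℤₚ.≤-reflexive (-l+suc[l]≡1 l)) (𝔓^-* (v≡⇒∈𝔓^ (v-ι vb′)) s∈)
        where
        -l+suc[l]≡1 : ∀ l → + 1 ≡ ℤ.- l ℤ.+ (+ 1 ℤ.+ l)
        -l+suc[l]≡1 = ℤ-RingSolver.solve-∀

      eq : ι b′ * (ι a + ι b * θ) ≈ θ - ι (F.- (b′ F.* a))
      eq = begin
        ι b′ * (ι a + ι b * θ)           ≈⟨ solve 4 (λ b′ a b θ → b′ :* (a :+ b :* θ) := (b :* b′) :* θ :- (:- (b′ :* a))) refl (ι b′) (ι a) (ι b) θ ⟩
        ι b * ι b′ * θ - - (ι b′ * ι a)  ≈⟨ +-cong (trans (*-congʳ bb′≈1) (*-identityˡ θ)) (-‿cong (trans (-‿cong (sym (ι-* b′ a))) (sym (ι-neg (b′ F.* a))))) ⟩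
        θ - ι (F.- (b′ F.* a))           ∎

  -- With `coordinate₁∈` this says that no cancellation occurs in `ι a + ι b * θ`: its valuation is
  -- the minimum of those of `a` and `b`. Every later statement about `𝔓^ k` in coordinates rests on
  -- this.
  coordinate₂∈ : ∀ {k} a b → (ι a + ι b * θ) ∈ 𝔓^ k → b ∈ F.𝔓^ k
  coordinate₂∈ {k} a b s∈ = bound (F.zero⊎finite b)
    where
    bound : b F.≈ F.0# ⊎ ∃[ l ] F.v b ≡ [ l ] → b ∈ F.𝔓^ k
    bound (inj₁ b≈0)      = F.≈0⇒∈𝔓^ b≈0
    bound (inj₂ (l , vb)) with k ℤ.≤? l
    ... | yes k≤l = F.𝔓^-weaken k≤l (F.v≡⇒∈𝔓^ vb)
    ... | no  k≰l = ⊥-elim (irrational-bound a b vb (𝔓^-weaken (ℤₚ.i<j⇒suc[i]≤j (ℤₚ.≰⇒> k≰l)) s∈))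

  coordinate₁∈ : ∀ {k} a b → (ι a + ι b * θ) ∈ 𝔓^ k → a ∈ F.𝔓^ k
  coordinate₁∈ a b s∈ = ι⁻¹∈𝔓^ (𝔓^-cong (solve 2 (λ a bθ → (a :+ bθ) :- bθ := a) refl (ι a) (ι b * θ))
    (𝔓^-- s∈ (𝔒-*ʳ (ι∈𝔓^ (coordinate₂∈ a b s∈)) θ∈𝔒)))

  θ-independent : ∀ a b → ι a + ι b * θ ≈ 0# → a F.≈ F.0# ∧ b F.≈ F.0#
  θ-independent a b s≈0 =
    F.∈𝔓^⇒0 (λ k → coordinate₁∈ {k} a b (≈0⇒∈𝔓^ s≈0)) , F.∈𝔓^⇒0 (λ k → coordinate₂∈ {k} a b (≈0⇒∈𝔓^ s≈0))

  private
    module Coordinates {a b c d} (1≈ : 1# ≈ ι a * e₁ + ι b * e₂) (θ≈ : θ ≈ ι c * e₁ + ι d * e₂) where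

      -- The determinant of `1` and `θ` in the basis `e₁`, `e₂`; `Δe₁` and `Δe₂` are Cramer's rule
      -- for inverting this change of basis.
      Δ : F.Carrier
      Δ = a F.* d F.- b F.* c

      ι-Δ : ι Δ ≈ ι a * ι d - ι b * ι c
      ι-Δ = trans (ι-- (a F.* d) (b F.* c)) (+-cong (ι-* a d) (-‿cong (ι-* b c)))

      Δe₁ : ι Δ * e₁ ≈ ι d - ι b * θ
      Δe₁ = begin
        ι Δ * e₁                                   ≈⟨ *-congʳ ι-Δ ⟩
        (ι a * ι d - ι b * ι c) * e₁               ≈⟨ solve 6 (λ a b c d e f → (a :* d :- b :* c) :* e := d :* (a :* e :+ b :* f) :- b :* (c :* e :+ d :* f)) refl (ι a) (ι b) (ι c) (ι d) e₁ e₂ ⟩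
        ι d * (ι a * e₁ + ι b * e₂) - ι b * (ι c * e₁ + ι d * e₂)  ≈⟨ +-cong (*-congˡ (sym 1≈)) (-‿cong (*-congˡ (sym θ≈))) ⟩
        ι d * 1# - ι b * θ                         ≈⟨ +-congʳ (*-identityʳ (ι d)) ⟩
        ι d - ι b * θ                              ∎

      Δe₂ : ι Δ * e₂ ≈ ι a * θ - ι c
      Δe₂ = begin
        ι Δ * e₂                                   ≈⟨ *-congʳ ι-Δ ⟩
        (ι a * ι d - ι b * ι c) * e₂               ≈⟨ solve 6 (λ a b c d e f → (a :* d :- b :* c) :* f := a :* (c :* e :+ d :* f) :- c :* (a :* e :+ b :* f)) refl (ι a) (ι b) (ι c) (ι d) e₁ e₂ ⟩
        ι a * (ι c * e₁ + ι d * e₂) - ι c * (ι a * e₁ + ι b * e₂)  ≈⟨ +-cong (*-congˡ (sym θ≈)) (-‿cong (*-congˡ (sym 1≈))) ⟩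
        ι a * θ - ι c * 1#                         ≈⟨ +-congˡ (-‿cong (*-identityʳ (ι c))) ⟩
        ι a * θ - ι c                              ∎

      -- If `Δ` vanished, Cramer's rule would give d - b θ = 0 and a θ - c = 0. Independence of `1`
      -- and `θ` then gives a = b = 0, which makes `1#` zero.
      Δ≉0 : ¬ Δ F.≈ F.0#
      Δ≉0 Δ≈0 = 1≉0 (begin
        1#                        ≈⟨ 1≈ ⟩
        ι a * e₁ + ι b * e₂       ≈⟨ +-cong (*-congʳ ιa≈0) (*-congʳ ιb≈0) ⟩
        0# * e₁ + 0# * e₂         ≈⟨ solve 2 (λ x y → con (+ 0) :* x :+ con (+ 0) :* y := con (+ 0)) refl e₁ e₂ ⟩
        0#                        ∎)
        where
        ιΔ≈0 : ι Δ ≈ 0#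
        ιΔ≈0 = trans (ι-cong Δ≈0) ι-0

        ιb≈0 : ι b ≈ 0#
        ιb≈0 = begin
          ι b                 ≈⟨ solve 1 (λ b → b := :- (:- b)) refl (ι b) ⟩
          - - ι b             ≈⟨ -‿cong (ι-neg b) ⟨
          - ι (F.- b)         ≈⟨ -‿cong (ι-cong (proj₂ (θ-independent d (F.- b) (begin
            ι d + ι (F.- b) * θ    ≈⟨ +-congˡ (*-congʳ (ι-neg b)) ⟩
            ι d + - ι b * θ        ≈⟨ solve 3 (λ d b θ → d :+ (:- b) :* θ := d :- b :* θ) refl (ι d) (ι b) θ ⟩
            ι d - ι b * θ          ≈⟨ Δe₁ ⟨
            ι Δ * e₁               ≈⟨ *-congʳ ιΔ≈0 ⟩
            0# * e₁                ≈⟨ zeroˡ e₁ ⟩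
            0#                     ∎)))) ⟩
          - ι F.0#            ≈⟨ -‿cong ι-0 ⟩
          - 0#                ≈⟨ solve 0 (:- con (+ 0) := con (+ 0)) refl ⟩
          0#                  ∎

        ιa≈0 : ι a ≈ 0#
        ιa≈0 = trans (ι-cong (proj₂ (θ-independent (F.- c) a (begin
            ι (F.- c) + ι a * θ    ≈⟨ +-congʳ (ι-neg c) ⟩
            - ι c + ι a * θ        ≈⟨ +-comm (- ι c) (ι a * θ) ⟩
            ι a * θ - ι c          ≈⟨ Δe₂ ⟨
            ι Δ * e₂               ≈⟨ *-congʳ ιΔ≈0 ⟩
            0# * e₂                ≈⟨ zeroˡ e₂ ⟩
            0#                     ∎)))) ι-0

      coordinates-of : ∀ {x} s t → x ≈ ι s * e₁ + ι t * e₂ → ∃₂ λ m n → x ≈ ι m + ι n * θ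
      coordinates-of {x} s t x≈ = m , n , (begin
        x                                                         ≈⟨ x≈ ⟩
        ι s * e₁ + ι t * e₂                                       ≈⟨ *-identityˡ _ ⟨
        1# * (ι s * e₁ + ι t * e₂)                                ≈⟨ *-congʳ Δ′Δ≈1 ⟨
        (ι Δ′ * ι Δ) * (ι s * e₁ + ι t * e₂)                      ≈⟨ solve 6 (λ p q s t e f → (p :* q) :* (s :* e :+ t :* f) := p :* (s :* (q :* e) :+ t :* (q :* f))) refl (ι Δ′) (ι Δ) (ι s) (ι t) e₁ e₂ ⟩
        ι Δ′ * (ι s * (ι Δ * e₁) + ι t * (ι Δ * e₂))              ≈⟨ *-congˡ (+-cong (*-congˡ Δe₁) (*-congˡ Δe₂)) ⟩
        ι Δ′ * (ι s * (ι d - ι b * θ) + ι t * (ι a * θ - ι c))    ≈⟨ solve 8 (λ p s t a b c d θ → p :* (s :* (d :- b :* θ) :+ t :* (a :* θ :- c)) := p :* (s :* d :- t :* c) :+ (p :* (t :* a :- s :* b)) :* θ) refl (ι Δ′) (ι s) (ι t) (ι a) (ι b) (ι c) (ι d) θ ⟩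
        ι Δ′ * (ι s * ι d - ι t * ι c) + ι Δ′ * (ι t * ι a - ι s * ι b) * θ  ≈⟨ +-cong (ι-Δ′* s d t c) (*-congʳ (ι-Δ′* t a s b)) ⟨
        ι m + ι n * θ                                             ∎)
        where
        Δ′ : F.Carrier
        Δ′ = proj₁ (F.inverse Δ Δ≉0)

        Δ′Δ≈1 : ι Δ′ * ι Δ ≈ 1#
        Δ′Δ≈1 = trans (*-comm (ι Δ′) (ι Δ)) (trans (sym (ι-* Δ Δ′)) (trans (ι-cong (proj₂ (F.inverse Δ Δ≉0))) ι-1))

        m n : F.Carrier
        m = Δ′ F.* (s F.* d F.- t F.* c)
        n = Δ′ F.* (t F.* a F.- s F.* b)

        ι-Δ′* : ∀ x y z w → ι (Δ′ F.* (x F.* y F.- z F.* w)) ≈ ι Δ′ * (ι x * ι y - ι z * ι w)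
        ι-Δ′* x y z w = trans (ι-* Δ′ _) (*-congˡ (trans (ι-- (x F.* y) (z F.* w)) (+-cong (ι-* x y) (-‿cong (ι-* z w)))))

  coordinates : ∀ x → ∃₂ λ a b → x ≈ ι a + ι b * θ
  coordinates x = Coordinates.coordinates-of (proj₂ (proj₂ (spanning 1#))) (proj₂ (proj₂ (spanning θ)))
    (proj₁ (spanning x)) (proj₁ (proj₂ (spanning x))) (proj₂ (proj₂ (spanning x)))

-- Conjugation, the unit `δ` and elements of trace zero.

module Conjugation {c₁ ℓ₁ c ℓ : Level} {F : LocalField c₁ ℓ₁} {E : LocalField c ℓ}
  (E/F : UnramifiedQuadraticExtension F E) where

  open LocalField E
  open Congruences E
  open LocalFieldProperties E
  open CommutativeRingSolver commutativeRing
  open UnramifiedQuadraticExtension E/F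
  open ExtensionProperties E/F
  open QuadraticExtension E/F
  open ≈-Reasoning setoid

  private
    abstract
      -- `θ` is a root of X² - t X - ν, so `t` is its trace and `- ν` its norm, as `σθ+θ` confirms.
      ν t : F.Carrier
      ν = proj₁ (coordinates (θ * θ))
      t = proj₁ (proj₂ (coordinates (θ * θ)))

      θ² : θ * θ ≈ ι ν + ι t * θ
      θ² = proj₂ (proj₂ (coordinates (θ * θ)))

    θ²∈𝔒 : (ι ν + ι t * θ) ∈ 𝔒
    θ²∈𝔒 = 𝔓^-cong θ² (𝔒-*ˡ θ∈𝔒 θ∈𝔒)

    ν∈𝔒 : ν ∈ F.𝔒
    ν∈𝔒 = coordinate₁∈ ν t θ²∈𝔒

    t∈𝔒 : t ∈ F.𝔒
    t∈𝔒 = coordinate₂∈ ν t θ²∈𝔒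

  σ-coordinates : ∀ {x} a b → x ≈ ι a + ι b * θ → σ x ≈ ι a + ι b * σ θ
  σ-coordinates {x} a b x≈ = begin
    σ x                          ≈⟨ σ-cong x≈ ⟩
    σ (ι a + ι b * θ)            ≈⟨ σ-+ (ι a) (ι b * θ) ⟩
    σ (ι a) + σ (ι b * θ)        ≈⟨ +-cong (σ-fixes a) (trans (σ-* (ι b) θ) (*-congʳ (σ-fixes b))) ⟩
    ι a + ι b * σ θ              ∎

  private
    σθ² : σ θ * σ θ ≈ ι ν + ι t * σ θ
    σθ² = trans (sym (σ-* θ θ)) (σ-coordinates ν t θ²)

  -- `σ θ` is a root of the same quadratic, so it is `θ` or `t - θ`. The first would make `σ` the
  -- identity, since `1` and `θ` span `E` over `F`.
  σθ+θ : σ θ + θ ≈ ι t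
  σθ+θ = conclude (zero-product product≈0)
    where
    product≈0 : (σ θ - θ) * (σ θ - (ι t - θ)) ≈ 0#
    product≈0 = begin
      (σ θ - θ) * (σ θ - (ι t - θ))              ≈⟨ solve 3 (λ s θ t → (s :- θ) :* (s :- (t :- θ)) := (s :* s :- t :* s) :- (θ :* θ :- t :* θ)) refl (σ θ) θ (ι t) ⟩
      (σ θ * σ θ - ι t * σ θ) - (θ * θ - ι t * θ)  ≈⟨ +-cong (+-congʳ σθ²) (-‿cong (+-congʳ θ²)) ⟩
      ((ι ν + ι t * σ θ) - ι t * σ θ) - ((ι ν + ι t * θ) - ι t * θ)
                                                 ≈⟨ solve 3 (λ n x y → ((n :+ x) :- x) :- ((n :+ y) :- y) := con (+ 0)) refl (ι ν) (ι t * σ θ) (ι t * θ) ⟩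
      0#                                         ∎

    conclude : σ θ - θ ≈ 0# ⊎ σ θ - (ι t - θ) ≈ 0# → σ θ + θ ≈ ι t
    conclude (inj₁ σθ-θ≈0) = ⊥-elim (σ-nontrivial λ x →
      let a , b , x≈ = coordinates x
      in begin
        σ x                  ≈⟨ σ-coordinates a b x≈ ⟩
        ι a + ι b * σ θ      ≈⟨ +-congˡ (*-congˡ (solve 2 (λ s θ → s := (s :- θ) :+ θ) refl (σ θ) θ)) ⟩
        ι a + ι b * (σ θ - θ + θ)  ≈⟨ +-congˡ (*-congˡ (trans (+-congʳ σθ-θ≈0) (+-identityˡ θ))) ⟩
        ι a + ι b * θ        ≈⟨ x≈ ⟨
        x                    ∎)
    conclude (inj₂ σθ-[t-θ]≈0) = begin
      σ θ + θ                      ≈⟨ solve 3 (λ s θ t → s :+ θ := (s :- (t :- θ)) :+ t) refl (σ θ) θ (ι t) ⟩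
      (σ θ - (ι t - θ)) + ι t      ≈⟨ +-congʳ σθ-[t-θ]≈0 ⟩
      0# + ι t                     ≈⟨ +-identityˡ (ι t) ⟩
      ι t                          ∎

  private
    σθ≈t-θ : σ θ ≈ ι t - θ
    σθ≈t-θ = trans (solve 2 (λ s θ → s := (s :+ θ) :- θ) refl (σ θ) θ) (+-congʳ σθ+θ)

  σ-involutive : ∀ x → σ (σ x) ≈ x
  σ-involutive x = begin
    σ (σ x)                          ≈⟨ σ-cong (σ-coordinates a b x≈) ⟩
    σ (ι a + ι b * σ θ)              ≈⟨ σ-+ (ι a) (ι b * σ θ) ⟩
    σ (ι a) + σ (ι b * σ θ)          ≈⟨ +-cong (σ-fixes a) (trans (σ-* (ι b) (σ θ)) (*-cong (σ-fixes b) σσθ)) ⟩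
    ι a + ι b * θ                    ≈⟨ x≈ ⟨
    x                                ∎
    where
    a b : F.Carrier
    a = proj₁ (coordinates x)
    b = proj₁ (proj₂ (coordinates x))

    x≈ : x ≈ ι a + ι b * θ
    x≈ = proj₂ (proj₂ (coordinates x))

    σσθ : σ (σ θ) ≈ θ
    σσθ = begin
      σ (σ θ)            ≈⟨ σ-cong σθ≈t-θ ⟩
      σ (ι t - θ)        ≈⟨ σ-- (ι t) θ ⟩
      σ (ι t) - σ θ      ≈⟨ +-cong (σ-fixes t) (-‿cong σθ≈t-θ) ⟩
      ι t - (ι t - θ)    ≈⟨ solve 2 (λ t θ → t :- (t :- θ) := θ) refl (ι t) θ ⟩
      θ                  ∎

  σθ∈𝔒 : σ θ ∈ 𝔒
  σθ∈𝔒 = 𝔓^-cong (sym σθ≈t-θ) (𝔓^-- (ι∈𝔓^ t∈𝔒) θ∈𝔒)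

  -- `σ` fixes the coordinates of `x`, whose valuations are at least `k`, and moves only `θ`, to the
  -- integral element `σ θ`.
  σ∈𝔓^ : ∀ {k x} → x ∈ 𝔓^ k → σ x ∈ 𝔓^ k
  σ∈𝔓^ {k} {x} x∈ = 𝔓^-cong (sym (σ-coordinates a b x≈))
    (𝔓^-+ (ι∈𝔓^ (coordinate₁∈ a b x∈′)) (𝔒-*ʳ (ι∈𝔓^ (coordinate₂∈ a b x∈′)) σθ∈𝔒))
    where
    a b : F.Carrier
    a = proj₁ (coordinates x)
    b = proj₁ (proj₂ (coordinates x))

    x≈ : x ≈ ι a + ι b * θ
    x≈ = proj₂ (proj₂ (coordinates x))

    x∈′ : (ι a + ι b * θ) ∈ 𝔓^ k
    x∈′ = 𝔓^-cong x≈ x∈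

  σ⁻¹∈𝔓^ : ∀ {k x} → σ x ∈ 𝔓^ k → x ∈ 𝔓^ k
  σ⁻¹∈𝔓^ {k} {x} σx∈ = 𝔓^-cong (σ-involutive x) (σ∈𝔓^ σx∈)

  σ-unit : ∀ {x} → Unit x → Unit (σ x)
  σ-unit u = unit (σ∈𝔓^ (unit⇒𝔒 u)) λ σx∈𝔓 → unit∉𝔓 u (σ⁻¹∈𝔓^ σx∈𝔓)

  -- A square root of the discriminant of the minimal polynomial of `θ`. That it is a unit expresses
  -- separability of the residue extension.
  δ : Carrier
  δ = θ - σ θ

  σδ : σ δ ≈ - δ
  σδ = begin
    σ (θ - σ θ)        ≈⟨ σ-- θ (σ θ) ⟩
    σ θ - σ (σ θ)      ≈⟨ +-congˡ (-‿cong (σ-involutive θ)) ⟩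
    σ θ - θ            ≈⟨ solve 2 (λ s θ → s :- θ := :- (θ :- s)) refl (σ θ) θ ⟩
    - δ                ∎

  square∈𝔓 : ∀ {x} → x ∈ 𝔒 → (x * x) ∈ 𝔓 → x ∈ 𝔓
  square∈𝔓 x∈ x²∈ with unit⊎𝔓 x∈
  ... | inj₁ u   = unit-cancelˡ u x²∈
  ... | inj₂ x∈𝔓 = x∈𝔓

  -- If δ were in 𝔓, the residue of θ would be a double root of a
  -- quadratic polynomial over the residue field of F; in residue
  -- characteristic 2 this uses that squaring is surjective on that field.
  private
    2ᴱ : Carrier
    2ᴱ = 1# + 1#

    2∈𝔒 : 2ᴱ ∈ 𝔒
    2∈𝔒 = 𝔓^-+ 1∈𝔒 1∈𝔒

    δ∉𝔓-odd : Unit 2ᴱ → δ ∉ 𝔓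
    δ∉𝔓-odd u δ∈ = θ-irrational (h F.* t) (F.𝔒-*ˡ h∈ t∈𝔒) (unit-cancelˡ u (𝔓^-cong eq δ∈))
      where
      2ᶠ : F.Carrier
      2ᶠ = F.1# F.+ F.1#

      ι2 : ι 2ᶠ ≈ 2ᴱ
      ι2 = trans (ι-+ F.1# F.1#) (+-cong ι-1 ι-1)

      v2 : F.v 2ᶠ ≡ [ + 0 ]
      v2 = ≡.trans (≡.sym (unramified 2ᶠ)) (unit-cong (sym ι2) u)

      h : F.Carrier
      h = proj₁ (F.reciprocal v2)

      h∈ : h ∈ F.𝔒
      h∈ = F.v≡⇒∈𝔓^ (proj₂ (proj₂ (F.reciprocal v2)))

      2h≈1 : 2ᴱ * ι h ≈ 1#
      2h≈1 = trans (*-congʳ (sym ι2)) (trans (sym (ι-* 2ᶠ h)) (trans (ι-cong (proj₁ (proj₂ (F.reciprocal v2)))) ι-1))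

      eq : δ ≈ 2ᴱ * (θ - ι (h F.* t))
      eq = begin
        θ - σ θ                                  ≈⟨ solve 2 (λ s θ → θ :- s := (con (+ 1) :+ con (+ 1)) :* θ :- (s :+ θ)) refl (σ θ) θ ⟩
        2ᴱ * θ - (σ θ + θ)                       ≈⟨ +-congˡ (-‿cong (trans σθ+θ (trans (sym (*-identityˡ (ι t))) (*-congʳ (sym 2h≈1))))) ⟩
        2ᴱ * θ - (2ᴱ * ι h) * ι t                ≈⟨ solve 4 (λ z θ h t → z :* θ :- (z :* h) :* t := z :* (θ :- h :* t)) refl 2ᴱ θ (ι h) (ι t) ⟩
        2ᴱ * (θ - ι h * ι t)                     ≈⟨ *-congˡ (+-congˡ (-‿cong (sym (ι-* h t)))) ⟩
        2ᴱ * (θ - ι (h F.* t))                   ∎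

    module _ (2∈𝔓 : 2ᴱ ∈ 𝔓) where

      -- Modulo 2 the square of x - y is x² - y², so squaring is injective on residue classes.
      difference∈𝔓 : ∀ {x y} → x ∈ 𝔒 → y ∈ 𝔒 → (x * x - y * y) ∈ 𝔓 → (x - y) ∈ 𝔓
      difference∈𝔓 {x} {y} x∈ y∈ p = square∈𝔓 (𝔓^-- x∈ y∈) (𝔓^-cong
        (solve 2 (λ x y → (x :* x :- y :* y) :- (con (+ 1) :+ con (+ 1)) :* (y :* (x :- y)) := (x :- y) :* (x :- y)) refl x y)
        (𝔓^-- p (𝔒-*ʳ 2∈𝔓 (𝔒-*ˡ y∈ (𝔓^-- x∈ y∈)))))

      ιd : Fin F.q → Carrier
      ιd i = ι (F.digit i)

      ιd∈ : ∀ i → ιd i ∈ 𝔒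
      ιd∈ i = ι∈𝔓^ (F.digit∈𝔒 i)

      ι-square-- : ∀ a b → ι (a F.* a F.- b) ≈ ι a * ι a - ι b
      ι-square-- a b = trans (ι-- (a F.* a) b) (+-congʳ (ι-* a a))

      square : Fin F.q → Fin F.q
      square i = proj₁ (F.digit-of (F.𝔒-*ˡ (F.digit∈𝔒 i) (F.digit∈𝔒 i)))

      square~ : ∀ i → (ιd i * ιd i - ιd (square i)) ∈ 𝔓
      square~ i = 𝔓^-cong (ι-square-- (F.digit i) (F.digit (square i)))
        (ι∈𝔓^ (proj₂ (F.digit-of (F.𝔒-*ˡ (F.digit∈𝔒 i) (F.digit∈𝔒 i)))))

      square-injective : Injective _≡_ _≡_ square
      square-injective {i} {j} eq = F.digit-unique (ι⁻¹∈𝔓^ (𝔓^-cong (sym (ι-- _ _)) (difference∈𝔓 (ιd∈ i) (ιd∈ j)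
        (𝔓^-cong (solve 3 (λ x y z → (x :- z) :- (y :- z) := x :- y) refl (ιd i * ιd i) (ιd j * ιd j) (ιd (square i)))
          (𝔓^-- (square~ i) (≡.subst (λ k → (ιd j * ιd j - ιd k) ∈ 𝔓) (≡.sym eq) (square~ j)))))))

      ν-digit : ∃[ k ] (ν F.- F.digit k) ∈ F.𝔓
      ν-digit = F.digit-of ν∈𝔒

      root : ∃[ i ] square i ≡ proj₁ ν-digit
      root = injective⇒surjective square-injective (proj₁ ν-digit)

      ρ : Fin F.q
      ρ = proj₁ root

      ρ²~ν : (ιd ρ * ιd ρ - ι ν) ∈ 𝔓
      ρ²~ν = 𝔓^-cong (solve 3 (λ x y z → (x :- z) :- (y :- z) := x :- y) refl (ιd ρ * ιd ρ) (ι ν) (ιd (square ρ)))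
        (𝔓^-- (square~ ρ) (≡.subst (λ k → (ι ν - ιd k) ∈ 𝔓) (≡.sym (proj₂ root))
          (𝔓^-cong (ι-- _ _) (ι∈𝔓^ (proj₂ ν-digit)))))

      -- If 2 and `δ` are in `𝔓`, so is t = 2 θ - δ. Then θ² is congruent to `ν`, hence to the
      -- square of the digit `ρ`, and injectivity of squaring makes `θ` congruent to an element of
      -- `F`.
      δ∉𝔓-even : δ ∉ 𝔓
      δ∉𝔓-even δ∈ = θ-irrational (F.digit ρ) (F.digit∈𝔒 ρ) (difference∈𝔓 θ∈𝔒 (ιd∈ ρ) (𝔓^-cong eq
          (𝔓^-- (𝔒-*ʳ t∈𝔓 θ∈𝔒) ρ²~ν)))
        where
        t∈𝔓 : ι t ∈ 𝔓
        t∈𝔓 = 𝔓^-cong (trans (solve 2 (λ s θ → (con (+ 1) :+ con (+ 1)) :* θ :- (θ :- s) := s :+ θ) refl (σ θ) θ) σθ+θ)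
          (𝔓^-- (𝔒-*ʳ 2∈𝔓 θ∈𝔒) δ∈)

        eq : ι t * θ - (ιd ρ * ιd ρ - ι ν) ≈ θ * θ - ιd ρ * ιd ρ
        eq = trans (solve 3 (λ x y z → x :- (y :- z) := (z :+ x) :- y) refl (ι t * θ) (ιd ρ * ιd ρ) (ι ν)) (+-congʳ (sym θ²))

  δ-unit : Unit δ
  δ-unit = unit (𝔓^-- θ∈𝔒 σθ∈𝔒) ([ δ∉𝔓-odd , δ∉𝔓-even ]′ (unit⊎𝔓 2∈𝔒))

  δ∈𝔒 : δ ∈ 𝔒
  δ∈𝔒 = unit⇒𝔒 δ-unit

  private
    abstract
      δ⁻¹ : Carrier
      δ⁻¹ = proj₁ (unit-reciprocal δ-unit)

      δδ⁻¹≈1 : δ * δ⁻¹ ≈ 1#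
      δδ⁻¹≈1 = proj₁ (proj₂ (unit-reciprocal δ-unit))

      δ⁻¹-unit : Unit δ⁻¹
      δ⁻¹-unit = proj₂ (proj₂ (unit-reciprocal δ-unit))

    σδ⁻¹ : σ δ⁻¹ ≈ - δ⁻¹
    σδ⁻¹ = *-cancelʳ δ-unit (begin
      σ δ⁻¹ * δ          ≈⟨ solve 2 (λ a d → a :* d := :- ((:- d) :* a)) refl (σ δ⁻¹) δ ⟩
      - (- δ * σ δ⁻¹)    ≈⟨ -‿cong (*-congʳ σδ) ⟨
      - (σ δ * σ δ⁻¹)    ≈⟨ -‿cong (σ-* δ δ⁻¹) ⟨
      - σ (δ * δ⁻¹)      ≈⟨ -‿cong (trans (σ-cong δδ⁻¹≈1) σ-1) ⟩
      - 1#               ≈⟨ -‿cong δδ⁻¹≈1 ⟨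
      - (δ * δ⁻¹)        ≈⟨ solve 2 (λ d a → :- (d :* a) := (:- a) :* d) refl δ δ⁻¹ ⟩
      - δ⁻¹ * δ          ∎)

  τ : Carrier
  τ = θ * δ⁻¹

  τ∈𝔒 : τ ∈ 𝔒
  τ∈𝔒 = 𝔒-*ˡ θ∈𝔒 (unit⇒𝔒 δ⁻¹-unit)

  τ+στ : τ + σ τ ≈ 1#
  τ+στ = begin
    θ * δ⁻¹ + σ (θ * δ⁻¹)        ≈⟨ +-congˡ (trans (σ-* θ δ⁻¹) (*-congˡ σδ⁻¹)) ⟩
    θ * δ⁻¹ + σ θ * - δ⁻¹        ≈⟨ solve 3 (λ θ s d → θ :* d :+ s :* (:- d) := (θ :- s) :* d) refl θ (σ θ) δ⁻¹ ⟩
    δ * δ⁻¹                      ≈⟨ δδ⁻¹≈1 ⟩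
    1#                           ∎

  σ-fixed : ∀ {x} → σ x ≈ x → ∃[ a ] x ≈ ι a
  σ-fixed {x} σx≈x = a , (begin
    x                  ≈⟨ x≈ ⟩
    ι a + ι b * θ      ≈⟨ +-congˡ (*-congʳ ιb≈0) ⟩
    ι a + 0# * θ       ≈⟨ solve 2 (λ a θ → a :+ con (+ 0) :* θ := a) refl (ι a) θ ⟩
    ι a                ∎)
    where
    a b : F.Carrier
    a = proj₁ (coordinates x)
    b = proj₁ (proj₂ (coordinates x))

    x≈ : x ≈ ι a + ι b * θ
    x≈ = proj₂ (proj₂ (coordinates x))

    bδ≈0 : ι b * δ ≈ 0#
    bδ≈0 = begin
      ι b * (θ - σ θ)                              ≈⟨ solve 4 (λ a b θ s → b :* (θ :- s) := (a :+ b :* θ) :- (a :+ b :* s)) refl (ι a) (ι b) θ (σ θ) ⟩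
      (ι a + ι b * θ) - (ι a + ι b * σ θ)          ≈⟨ +-cong (sym x≈) (-‿cong (sym (σ-coordinates a b x≈))) ⟩
      x - σ x                                      ≈⟨ +-congˡ (-‿cong σx≈x) ⟩
      x - x                                        ≈⟨ -‿inverseʳ x ⟩
      0#                                           ∎

    ιb≈0 : ι b ≈ 0#
    ιb≈0 = [ (λ p → p) , (λ δ≈0 → ⊥-elim (v≡⇒≉0 δ-unit δ≈0)) ]′ (zero-product bδ≈0)

  -- Conjugation negates both `x` and the inverse of `δ`, so their product is fixed and lies in `F`.
  traceless : ∀ {x} → x + σ x ≈ 0# → ∃[ a ] x ≈ ι a * δ
  traceless {x} x+σx≈0 = proj₁ fixed , (begin
    x                      ≈⟨ *-identityʳ x ⟨
    x * 1#                 ≈⟨ *-congˡ δδ⁻¹≈1 ⟨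
    x * (δ * δ⁻¹)          ≈⟨ solve 3 (λ x d e → x :* (d :* e) := (x :* e) :* d) refl x δ δ⁻¹ ⟩
    (x * δ⁻¹) * δ          ≈⟨ *-congʳ (proj₂ fixed) ⟩
    ι (proj₁ fixed) * δ    ∎)
    where
    fixed : ∃[ a ] x * δ⁻¹ ≈ ι a
    fixed = σ-fixed (begin
      σ (x * δ⁻¹)                        ≈⟨ trans (σ-* x δ⁻¹) (*-congˡ σδ⁻¹) ⟩
      σ x * - δ⁻¹                        ≈⟨ solve 3 (λ x s d → s :* (:- d) := x :* d :- (x :+ s) :* d) refl x (σ x) δ⁻¹ ⟩
      x * δ⁻¹ - (x + σ x) * δ⁻¹          ≈⟨ +-congˡ (-‿cong (trans (*-congʳ x+σx≈0) (zeroˡ δ⁻¹))) ⟩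
      x * δ⁻¹ - 0#                       ≈⟨ solve 1 (λ x → x :- con (+ 0) := x) refl (x * δ⁻¹) ⟩
      x * δ⁻¹                            ∎)

-- Digits for `E`, for trace-zero elements and for norm-one elements.

module NormOneDigits {c₁ ℓ₁ c ℓ : Level} {F : LocalField c₁ ℓ₁} {E : LocalField c ℓ}
  (E/F : UnramifiedQuadraticExtension F E) where

  open LocalField E
  open Congruences E
  open LocalFieldProperties E
  open CommutativeRingSolver commutativeRing
  open UnramifiedQuadraticExtension E/F
  open ExtensionProperties E/F
  open QuadraticExtension E/F
  open Conjugation E/F
  open ≈-Reasoning setoid

  r : Fin F.q → Carrier
  r i = ι (F.digit i)

  r∈𝔒 : ∀ i → r i ∈ 𝔒
  r∈𝔒 i = ι∈𝔓^ (F.digit∈𝔒 i)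

  π^ : ℤ → Carrier
  π^ k = ι (F.uniformiser^ k)

  v-π^ : ∀ k → v (π^ k) ≡ [ k ]
  v-π^ k = v-ι (F.v-uniformiser^ k)

  σπ^ : ∀ k → σ (π^ k) ≈ π^ k
  σπ^ k = σ-fixes (F.uniformiser^ k)

  σr : ∀ i → σ (r i) ≈ r i
  σr i = σ-fixes (F.digit i)

  F-digit : ℤ → Fin F.q → Carrier
  F-digit k i = π^ k * r i

  F-digit∈ : ∀ {k} i → F-digit k i ∈ 𝔓^ k
  F-digit∈ {k} i = 𝔒-*ʳ (v≡⇒∈𝔓^ (v-π^ k)) (r∈𝔒 i)

  σF-digit : ∀ {k} i → σ (F-digit k i) ≈ F-digit k i
  σF-digit {k} i = trans (σ-* (π^ k) (r i)) (*-cong (σπ^ k) (σr i))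

  F-digit-of : ∀ {k} a → ι a ∈ 𝔓^ k → ∃[ i ] (ι a - F-digit k i) ∈ 𝔓^ (ℤ.suc k)
  F-digit-of {k} a a∈ = proj₁ i , 𝔓^-cong
    (trans (ι-- a (p F.* F.digit (proj₁ i))) (+-congˡ (-‿cong (ι-* p (F.digit (proj₁ i))))))
    (ι∈𝔓^ (proj₂ i))
    where
    p : F.Carrier
    p = F.uniformiser^ k

    i : ∃[ i ] (a F.- p F.* F.digit i) ∈ F.𝔓^ (ℤ.suc k)
    i = F.scaled-digit-of (F.v-uniformiser^ k) (ι⁻¹∈𝔓^ a∈)

  F-digit-unique : ∀ {k i j} → (F-digit k i - F-digit k j) ∈ 𝔓^ (ℤ.suc k) → i ≡ j
  F-digit-unique {k} {i} {j} p = F.scaled-digit-unique (F.v-uniformiser^ k) (ι⁻¹∈𝔓^ (𝔓^-cong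
    (sym (trans (ι-- _ _) (+-cong (ι-* _ _) (-‿cong (ι-* _ _))))) p))

  -- Subtracting `(x + σ x) * τ` makes the trace exactly zero and does not change the class of `x`
  -- modulo `𝔓^ (suc k)`. The result is `ι a * δ`, and the digit is that of `a`.
  traceless-digit-of : ∀ {k x} → x ∈ 𝔓^ k → (x + σ x) ∈ 𝔓^ (ℤ.suc k) →
                       ∃[ i ] (x - F-digit k i * δ) ∈ 𝔓^ (ℤ.suc k)
  traceless-digit-of {k} {x} x∈ tr∈ = proj₁ i , 𝔓^-cong eq
    (𝔓^-+ (𝔒-*ʳ (proj₂ i) δ∈𝔒) (𝔒-*ʳ tr∈ τ∈𝔒))
    where
    y : Carrier
    y = x - (x + σ x) * τ

    y+σy≈0 : y + σ y ≈ 0#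
    y+σy≈0 = begin
      y + σ y                                                      ≈⟨ +-congˡ (trans (σ-- x ((x + σ x) * τ)) (+-congˡ (-‿cong (trans (σ-* (x + σ x) τ) (*-congʳ (trans (σ-+ x (σ x)) (+-congˡ (σ-involutive x)))))))) ⟩
      (x - (x + σ x) * τ) + (σ x - (σ x + x) * σ τ)                ≈⟨ solve 4 (λ x s t u → (x :- (x :+ s) :* t) :+ (s :- (s :+ x) :* u) := (x :+ s) :- (x :+ s) :* (t :+ u)) refl x (σ x) τ (σ τ) ⟩
      (x + σ x) - (x + σ x) * (τ + σ τ)                            ≈⟨ +-congˡ (-‿cong (*-congˡ τ+στ)) ⟩
      (x + σ x) - (x + σ x) * 1#                                   ≈⟨ solve 1 (λ x → x :- x :* con (+ 1) := con (+ 0)) refl (x + σ x) ⟩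
      0#                                                           ∎

    a : F.Carrier
    a = proj₁ (traceless y+σy≈0)

    y≈aδ : y ≈ ι a * δ
    y≈aδ = proj₂ (traceless y+σy≈0)

    y∈ : y ∈ 𝔓^ k
    y∈ = 𝔓^-- x∈ (𝔒-*ʳ (𝔓^-weaken (ℤₚ.i≤suc[i] k) tr∈) τ∈𝔒)

    i : ∃[ i ] (ι a - F-digit k i) ∈ 𝔓^ (ℤ.suc k)
    i = F-digit-of a (unit-cancelʳ δ-unit (𝔓^-cong y≈aδ y∈))

    eq : (ι a - F-digit k (proj₁ i)) * δ + (x + σ x) * τ ≈ x - F-digit k (proj₁ i) * δ
    eq = begin
      (ι a - F-digit k (proj₁ i)) * δ + (x + σ x) * τ    ≈⟨ solve 4 (λ a d e t → (a :- d) :* e :+ t := (a :* e :+ t) :- d :* e) refl (ι a) (F-digit k (proj₁ i)) δ ((x + σ x) * τ) ⟩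
      (ι a * δ + (x + σ x) * τ) - F-digit k (proj₁ i) * δ  ≈⟨ +-congʳ (+-congʳ (sym y≈aδ)) ⟩
      (y + (x + σ x) * τ) - F-digit k (proj₁ i) * δ      ≈⟨ +-congʳ (solve 2 (λ x t → (x :- t) :+ t := x) refl x ((x + σ x) * τ)) ⟩
      x - F-digit k (proj₁ i) * δ                        ∎

  traceless-digit-unique : ∀ {k i j} → (F-digit k i * δ - F-digit k j * δ) ∈ 𝔓^ (ℤ.suc k) → i ≡ j
  traceless-digit-unique p = F-digit-unique (unit-cancelʳ δ-unit
    (𝔓^-cong (solve 3 (λ a b d → a :* d :- b :* d := (a :- b) :* d) refl _ _ δ) p))

  -- Pairs of digits of `F` in place of digits of `E`, so that the q² classes are counted by the
  -- residue field of `F`.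
  E-digit : ℤ → Fin F.q → Fin F.q → Carrier
  E-digit k i j = F-digit k i + F-digit k j * θ

  E-digit∈ : ∀ {k} i j → E-digit k i j ∈ 𝔓^ k
  E-digit∈ i j = 𝔓^-+ (F-digit∈ i) (𝔒-*ʳ (F-digit∈ j) θ∈𝔒)

  E-digit-of : ∀ {k x} → x ∈ 𝔓^ k → ∃₂ λ i j → (x - E-digit k i j) ∈ 𝔓^ (ℤ.suc k)
  E-digit-of {k} {x} x∈ = proj₁ i , proj₁ j , 𝔓^-cong
      (trans (solve 5 (λ a b d e θ → (a :- d) :+ (b :- e) :* θ := (a :+ b :* θ) :- (d :+ e :* θ)) refl (ι a) (ι b) (F-digit k (proj₁ i)) (F-digit k (proj₁ j)) θ)
        (+-congʳ (sym x≈)))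
      (𝔓^-+ (proj₂ i) (𝔒-*ʳ (proj₂ j) θ∈𝔒))
    where
    a b : F.Carrier
    a = proj₁ (coordinates x)
    b = proj₁ (proj₂ (coordinates x))

    x≈ : x ≈ ι a + ι b * θ
    x≈ = proj₂ (proj₂ (coordinates x))

    i : ∃[ i ] (ι a - F-digit k i) ∈ 𝔓^ (ℤ.suc k)
    i = F-digit-of a (ι∈𝔓^ (coordinate₁∈ a b (𝔓^-cong x≈ x∈)))

    j : ∃[ j ] (ι b - F-digit k j) ∈ 𝔓^ (ℤ.suc k)
    j = F-digit-of b (ι∈𝔓^ (coordinate₂∈ a b (𝔓^-cong x≈ x∈)))

  E-digit-unique : ∀ {k i j i′ j′} → (E-digit k i j - E-digit k i′ j′) ∈ 𝔓^ (ℤ.suc k) → i ≡ i′ ∧ j ≡ j′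
  E-digit-unique {k} {i} {j} {i′} {j′} p =
    F-digit-unique (𝔓^-cong (difference-ι i i′) (ι∈𝔓^ (coordinate₁∈ a b p′))) ,
    F-digit-unique (𝔓^-cong (difference-ι j j′) (ι∈𝔓^ (coordinate₂∈ a b p′)))
    where
    difference : Fin F.q → Fin F.q → F.Carrier
    difference i i′ = F.uniformiser^ k F.* F.digit i F.- F.uniformiser^ k F.* F.digit i′

    difference-ι : ∀ i i′ → ι (difference i i′) ≈ F-digit k i - F-digit k i′
    difference-ι i i′ = trans (ι-- _ _) (+-cong (ι-* _ _) (-‿cong (ι-* _ _)))

    a b : F.Carrier
    a = difference i i′
    b = difference j j′

    p′ : (ι a + ι b * θ) ∈ 𝔓^ (ℤ.suc k)
    p′ = 𝔓^-cong (trans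
      (solve 5 (λ a b d e θ → (a :+ b :* θ) :- (d :+ e :* θ) := (a :- d) :+ (b :- e) :* θ) refl (F-digit k i) (F-digit k j) (F-digit k i′) (F-digit k j′) θ)
      (sym (+-cong (difference-ι i i′) (*-congʳ (difference-ι j j′))))) p

  -- By Hilbert 90 the norm-one elements are the quotients α / σ α; here the α i / σ (α i)
  -- represent mod 𝔓^ (suc m) those that are 1 mod 𝔓^ m.
  record NormOneSystem (m : ℕ) (I : Set) : Set c where
    field
      α        : I → Carrier
      α-unit   : ∀ i → Unit (α i)
      α~σα     : ∀ i → (α i - σ (α i)) ∈ 𝔓^ (+ m)
      α-covers : ∀ {w} → (w - 1#) ∈ 𝔓^ (+ m) → (w * σ w - 1#) ∈ 𝔓^ (+ suc m) →
                 ∃[ i ] (w * σ (α i) - α i) ∈ 𝔓^ (+ suc m)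
      α-unique : ∀ {i j} → (α i * σ (α j) - σ (α i) * α j) ∈ 𝔓^ (+ suc m) → i ≡ j

  -- At a level M ≥ 1, products of two elements of `𝔓^ M` vanish modulo `𝔓^ (M + 1)`. To first
  -- order, 1 + e has norm one exactly when e has trace zero, and α = 1 + ρ θ has quotient α / σ α =
  -- 1 + ρ δ. So the norm-one classes are the trace-zero digits. At level 0 this linearisation
  -- fails.
  normOneSystem₊ : ∀ m → NormOneSystem (suc m) (Fin F.q)
  normOneSystem₊ n = record
    { α        = α
    ; α-unit   = λ i → unit-~ (𝔓^-cong (solve 2 (λ x θ → x :* θ := (con (+ 1) :+ x :* θ) :- con (+ 1)) refl (ρ i) θ)
                   (𝔓^-weaken (ℤ.+≤+ (ℕ.s≤s ℕ.z≤n)) (𝔒-*ʳ (ρ∈ i) θ∈𝔒))) v-1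
    ; α~σα     = λ i → 𝔓^-cong (trans (solve 3 (λ x θ s → x :* (θ :- s) := (con (+ 1) :+ x :* θ) :- (con (+ 1) :+ x :* s)) refl (ρ i) θ (σ θ))
                   (+-congˡ (-‿cong (sym (σα i))))) (𝔒-*ʳ (ρ∈ i) δ∈𝔒)
    ; α-covers = covers
    ; α-unique = λ {i} {j} p → traceless-digit-unique (𝔓^-cong (trans (+-cong (*-congˡ (σα j)) (-‿cong (*-congʳ (σα i))))
        (solve 4 (λ x y θ s → (con (+ 1) :+ x :* θ) :* (con (+ 1) :+ y :* s) :- (con (+ 1) :+ x :* s) :* (con (+ 1) :+ y :* θ)
           := x :* (θ :- s) :- y :* (θ :- s)) refl (ρ i) (ρ j) θ (σ θ))) p)
    }
    where
    m : ℕ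
    m = suc n

    ρ α : Fin F.q → Carrier
    ρ = F-digit (+ m)
    α i = 1# + ρ i * θ

    ρ∈ : ∀ i → ρ i ∈ 𝔓^ (+ m)
    ρ∈ = F-digit∈

    σα : ∀ i → σ (α i) ≈ 1# + ρ i * σ θ
    σα i = trans (σ-+ 1# (ρ i * θ)) (+-cong σ-1 (trans (σ-* (ρ i) θ) (*-congʳ (σF-digit i))))

    1+m≤m+m : + suc m ℤ.≤ + m ℤ.+ + m
    1+m≤m+m = ℤ.+≤+ (ℕₚ.+-monoˡ-≤ m (ℕ.s≤s ℕ.z≤n))

    covers : ∀ {w} → (w - 1#) ∈ 𝔓^ (+ m) → (w * σ w - 1#) ∈ 𝔓^ (+ suc m) →
             ∃[ i ] (w * σ (α i) - α i) ∈ 𝔓^ (+ suc m)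
    covers {w} e∈ Nw~1 = proj₁ i , 𝔓^-cong
        (trans (solve 4 (λ w x θ s → ((w :- con (+ 1)) :- x :* (θ :- s)) :+ (w :- con (+ 1)) :* (x :* s)
            := w :* (con (+ 1) :+ x :* s) :- (con (+ 1) :+ x :* θ)) refl w (ρ (proj₁ i)) θ (σ θ))
          (+-congʳ (*-congˡ (sym (σα (proj₁ i))))))
        (𝔓^-+ (proj₂ i) (𝔓^-*≤ 1+m≤m+m e∈ (𝔒-*ʳ (ρ∈ (proj₁ i)) σθ∈𝔒)))
      where
      e : Carrier
      e = w - 1#

      σe : σ e ≈ σ w - 1#
      σe = trans (σ-- w 1#) (+-congˡ (-‿cong σ-1))

      i : ∃[ i ] (e - ρ i * δ) ∈ 𝔓^ (+ suc m)
      i = traceless-digit-of e∈ (𝔓^-cong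
        (trans (+-congˡ (-‿cong (*-congˡ σe))) (trans
          (solve 2 (λ w s → (w :* s :- con (+ 1)) :- (w :- con (+ 1)) :* (s :- con (+ 1)) := (w :- con (+ 1)) :+ (s :- con (+ 1))) refl w (σ w))
          (+-congˡ (sym σe))))
        (𝔓^-- Nw~1 (𝔓^-*≤ 1+m≤m+m e∈ (σ∈𝔓^ e∈))))

  -- P¹ of the residue field of F, as the norm-one classes α / σ α with α = 1 or α = θ + r.
  normOneSystem₀ : NormOneSystem 0 (⊤ ⊎ Fin F.q)
  normOneSystem₀ = record
    { α        = α
    ; α-unit   = α-unit
    ; α~σα     = λ i → 𝔓^-- (unit⇒𝔒 (α-unit i)) (unit⇒𝔒 (σ-unit (α-unit i)))
    ; α-covers = covers
    ; α-unique = λ {i} {j} → unique i j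
    }
    where
    α : ⊤ ⊎ Fin F.q → Carrier
    α (inj₁ tt) = 1#
    α (inj₂ i)  = θ + r i

    α-unit : ∀ i → Unit (α i)
    α-unit (inj₁ tt) = v-1
    α-unit (inj₂ i)  = unit (𝔓^-+ θ∈𝔒 (r∈𝔒 i)) λ p → θ-irrational (F.- F.digit i) (F.𝔓^-neg (F.digit∈𝔒 i))
      (𝔓^-cong (trans (solve 2 (λ x y → x :+ y := x :- (:- y)) refl θ (r i)) (+-congˡ (-‿cong (sym (ι-neg _))))) p)

    σα₂ : ∀ i → σ (θ + r i) ≈ σ θ + r i
    σα₂ i = trans (σ-+ θ (r i)) (+-congˡ (σr i))

    -- For α = s + t θ and α′ = s′ + t′ θ one has α σ α′ - σ α α′ = (t s′ - s t′) δ, a unit times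
    -- the determinant of the two points of P¹. The four cases evaluate this determinant.
    unique : ∀ i j → (α i * σ (α j) - σ (α i) * α j) ∈ 𝔓 → i ≡ j
    unique (inj₁ tt) (inj₁ tt) _ = ≡.refl
    unique (inj₁ tt) (inj₂ j)  p = ⊥-elim (unit∉𝔓 (unit-neg δ-unit) (𝔓^-cong
      (trans (+-cong (*-congˡ (σα₂ j)) (-‿cong (*-congʳ σ-1)))
        (solve 3 (λ r θ s → con (+ 1) :* (s :+ r) :- con (+ 1) :* (θ :+ r) := :- (θ :- s)) refl (r j) θ (σ θ))) p))
    unique (inj₂ i)  (inj₁ tt) p = ⊥-elim (unit∉𝔓 δ-unit (𝔓^-cong
      (trans (+-cong (*-congˡ σ-1) (-‿cong (*-congʳ (σα₂ i))))
        (solve 3 (λ r θ s → (θ :+ r) :* con (+ 1) :- (s :+ r) :* con (+ 1) := θ :- s) refl (r i) θ (σ θ))) p))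
    unique (inj₂ i)  (inj₂ j)  p = ≡.cong inj₂ (≡.sym (F.digit-unique (ι⁻¹∈𝔓^ (𝔓^-cong (sym (ι-- _ _)) (unit-cancelʳ δ-unit
      (𝔓^-cong (trans (+-cong (*-congˡ (σα₂ j)) (-‿cong (*-congʳ (σα₂ i))))
        (solve 4 (λ r u θ s → (θ :+ r) :* (s :+ u) :- (s :+ r) :* (θ :+ u) := (u :- r) :* (θ :- s)) refl (r i) (r j) θ (σ θ))) p))))))

    covers : ∀ {w} → (w - 1#) ∈ 𝔒 → (w * σ w - 1#) ∈ 𝔓 → ∃[ i ] (w * σ (α i) - α i) ∈ 𝔓
    -- Hilbert 90 modulo `𝔓`: since w σ w is congruent to 1, `1 + w` is congruent to w σ (1 + w). If
    -- `1 + w` is not a unit, then w is congruent to -1 = δ / σ δ, and `δ` takes its place.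
    covers {w} e∈ Nw~1 = [ from-1+w , from-δ ]′ (unit⊎𝔓 (𝔓^-+ 1∈𝔒 w∈𝔒))
      where
      w∈𝔒 : w ∈ 𝔒
      w∈𝔒 = 𝔓^-cong (solve 1 (λ w → (w :- con (+ 1)) :+ con (+ 1) := w) refl w) (𝔓^-+ e∈ 1∈𝔒)

      module _ {a₀ : Carrier} (a₀-unit : Unit a₀) (p : (w * σ a₀ - a₀) ∈ 𝔓) where

        s t : F.Carrier
        s = proj₁ (coordinates a₀)
        t = proj₁ (proj₂ (coordinates a₀))

        a₀≈ : a₀ ≈ ι s + ι t * θ
        a₀≈ = proj₂ (proj₂ (coordinates a₀))

        a₀∈𝔒 : (ι s + ι t * θ) ∈ 𝔒
        a₀∈𝔒 = 𝔓^-cong a₀≈ (unit⇒𝔒 a₀-unit)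

        p′ : (w * (ι s + ι t * σ θ) - (ι s + ι t * θ)) ∈ 𝔓
        p′ = 𝔓^-cong (+-cong (*-congˡ (σ-coordinates s t a₀≈)) (-‿cong a₀≈)) p

        wσθ-θ∈𝔒 : (w * σ θ - θ) ∈ 𝔒
        wσθ-θ∈𝔒 = 𝔓^-- (𝔒-*ˡ w∈𝔒 σθ∈𝔒) θ∈𝔒

        -- Scaling `a₀` = s + t θ by a unit of `F` does not change a₀ / σ a₀, so only the point (s :
        -- t) counts. If t is in `𝔓` this is the class of 1; otherwise dividing by t gives θ + s /
        -- t.
        normalise-α : Unit (ι t) ⊎ ι t ∈ 𝔓 → ∃[ i ] (w * σ (α i) - α i) ∈ 𝔓
        normalise-α (inj₂ t∈𝔓) = inj₁ tt , 𝔓^-cong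
            (trans (solve 1 (λ w → w :- con (+ 1) := w :* con (+ 1) :- con (+ 1)) refl w) (+-congʳ (*-congˡ (sym σ-1))))
            (unit-cancelˡ s-unit (𝔓^-cong
              (solve 5 (λ w s t θ n → (w :* (s :+ t :* n) :- (s :+ t :* θ)) :- t :* (w :* n :- θ) := s :* (w :- con (+ 1))) refl w (ι s) (ι t) θ (σ θ))
              (𝔓^-- p′ (𝔒-*ʳ t∈𝔓 wσθ-θ∈𝔒))))
          where
          s-unit : Unit (ι s)
          s-unit = unit-~ (𝔓^-cong (trans (solve 2 (λ s x → :- x := s :- (s :+ x)) refl (ι s) (ι t * θ)) (+-congˡ (-‿cong (sym a₀≈))))
            (𝔓^-neg (𝔒-*ʳ t∈𝔓 θ∈𝔒))) a₀-unit
        normalise-α (inj₁ t-unit) = inj₂ (proj₁ i) , 𝔓^-cong eq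
            (𝔓^-- (𝔒-*ˡ (ι∈𝔓^ t′∈) p′) (𝔒-*ˡ e∈ (𝔓^-cong (ι-- _ _) (ι∈𝔓^ (proj₂ i)))))
          where
          vt : F.v t ≡ [ + 0 ]
          vt = ≡.trans (≡.sym (unramified t)) t-unit

          t′ : F.Carrier
          t′ = proj₁ (F.reciprocal vt)

          t′∈ : t′ ∈ F.𝔒
          t′∈ = F.v≡⇒∈𝔓^ (proj₂ (proj₂ (F.reciprocal vt)))

          t′t≈1 : ι t′ * ι t ≈ 1#
          t′t≈1 = trans (*-comm (ι t′) (ι t)) (trans (sym (ι-* t t′)) (trans (ι-cong (proj₁ (proj₂ (F.reciprocal vt)))) ι-1))

          i : ∃[ i ] (t′ F.* s F.- F.digit i) ∈ F.𝔓
          i = F.digit-of (F.𝔒-*ˡ t′∈ (coordinate₁∈ s t a₀∈𝔒))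

          rᵢ : Carrier
          rᵢ = r (proj₁ i)

          eq : ι t′ * (w * (ι s + ι t * σ θ) - (ι s + ι t * θ)) - (w - 1#) * (ι (t′ F.* s) - rᵢ) ≈ w * σ (θ + rᵢ) - (θ + rᵢ)
          eq = begin
            ι t′ * (w * (ι s + ι t * σ θ) - (ι s + ι t * θ)) - (w - 1#) * (ι (t′ F.* s) - rᵢ)
              ≈⟨ +-congˡ (-‿cong (*-congˡ (+-congʳ (ι-* t′ s)))) ⟩
            ι t′ * (w * (ι s + ι t * σ θ) - (ι s + ι t * θ)) - (w - 1#) * (ι t′ * ι s - rᵢ)
              ≈⟨ solve 7 (λ u w s t θ n r → u :* (w :* (s :+ t :* n) :- (s :+ t :* θ)) :- (w :- con (+ 1)) :* (u :* s :- r)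
                   := w :* ((u :* t) :* n :+ r) :- ((u :* t) :* θ :+ r)) refl (ι t′) w (ι s) (ι t) θ (σ θ) rᵢ ⟩
            w * (ι t′ * ι t * σ θ + rᵢ) - (ι t′ * ι t * θ + rᵢ)
              ≈⟨ +-cong (*-congˡ (+-congʳ (t′t* (σ θ)))) (-‿cong (+-congʳ (t′t* θ))) ⟩
            w * (σ θ + rᵢ) - (θ + rᵢ)
              ≈⟨ +-congʳ (*-congˡ (σα₂ (proj₁ i))) ⟨
            w * σ (θ + rᵢ) - (θ + rᵢ) ∎
            where
            t′t* : ∀ x → ι t′ * ι t * x ≈ x
            t′t* x = trans (*-congʳ t′t≈1) (*-identityˡ x)

        from-a₀ : ∃[ i ] (w * σ (α i) - α i) ∈ 𝔓
        from-a₀ = normalise-α (unit⊎𝔓 (ι∈𝔓^ (coordinate₂∈ s t a₀∈𝔒)))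

      from-1+w : Unit (1# + w) → ∃[ i ] (w * σ (α i) - α i) ∈ 𝔓
      from-1+w u = from-a₀ u (𝔓^-cong
        (trans (solve 2 (λ w s → w :* s :- con (+ 1) := w :* (con (+ 1) :+ s) :- (con (+ 1) :+ w)) refl w (σ w))
          (+-congʳ (*-congˡ (sym (trans (σ-+ 1# w) (+-congʳ σ-1)))))) Nw~1)

      from-δ : (1# + w) ∈ 𝔓 → ∃[ i ] (w * σ (α i) - α i) ∈ 𝔓
      from-δ 1+w∈𝔓 = from-a₀ δ-unit (𝔓^-cong
        (trans (solve 2 (λ w d → (:- ((con (+ 1) :+ w) :* d)) := w :* (:- d) :- d) refl w δ) (+-congʳ (*-congˡ (sym σδ))))
        (𝔓^-neg (𝔒-*ʳ 1+w∈𝔓 δ∈𝔒)))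

-- Determinants of 3 × 3 matrices.

module MatrixDeterminants {c ℓ : Level} (R : CommutativeRing c ℓ) where

  open CommutativeRing R
  open CommutativeRingSolver R
  open Matrix R

  matrix₃ : ∀ {a} {A : Set a} → (a b c d e f g h i : A) → Fin 3 → Fin 3 → A
  matrix₃ a b c d e f g h i 0F 0F = a
  matrix₃ a b c d e f g h i 0F 1F = b
  matrix₃ a b c d e f g h i 0F 2F = c
  matrix₃ a b c d e f g h i 1F 0F = d
  matrix₃ a b c d e f g h i 1F 1F = e
  matrix₃ a b c d e f g h i 1F 2F = f
  matrix₃ a b c d e f g h i 2F 0F = g
  matrix₃ a b c d e f g h i 2F 1F = h
  matrix₃ a b c d e f g h i 2F 2F = i

  :0 :1 : ∀ {n} → Polynomial n
  :0 = con (+ 0)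
  :1 = con (+ 1)

  -- Formal counterparts of det and _·_, computing to them under evaluation.
  :det : ∀ {n} → (Fin 3 → Fin 3 → Polynomial n) → Polynomial n
  :det A =
       A 0F 0F :* A 1F 1F :* A 2F 2F
    :+ A 0F 1F :* A 1F 2F :* A 2F 0F
    :+ A 0F 2F :* A 1F 0F :* A 2F 1F
    :- A 0F 2F :* A 1F 1F :* A 2F 0F
    :- A 0F 1F :* A 1F 0F :* A 2F 2F
    :- A 0F 0F :* A 1F 2F :* A 2F 1F

  infixl 8 _:·_

  _:·_ : ∀ {n} (A B : Fin 3 → Fin 3 → Polynomial n) → Fin 3 → Fin 3 → Polynomial n
  (A :· B) i j = A i 0F :* B 0F j :+ (A i 1F :* B 1F j :+ (A i 2F :* B 2F j :+ :0))

  det-cong : ∀ {A B} → A ≋ B → det A ≈ det B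
  det-cong {A} {B} p = +-cong (+-cong (+-cong (+-cong (+-cong
      (term 0F 0F 1F 1F 2F 2F) (term 0F 1F 1F 2F 2F 0F)) (term 0F 2F 1F 0F 2F 1F))
      (-‿cong (term 0F 2F 1F 1F 2F 0F))) (-‿cong (term 0F 1F 1F 0F 2F 2F))) (-‿cong (term 0F 0F 1F 2F 2F 1F))
    where
    term : ∀ i j i′ j′ i″ j″ → A i j * A i′ j′ * A i″ j″ ≈ B i j * B i′ j′ * B i″ j″
    term i j i′ j′ i″ j″ = *-cong (*-cong (p i j) (p i′ j′)) (p i″ j″)

  det-ᵗ : ∀ A → det (A ᵗ) ≈ det A
  det-ᵗ A = solve 9 (λ a b c d e f g h i → :det (matrix₃ a d g b e h c f i) := :det (matrix₃ a b c d e f g h i)) refl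
    (A 0F 0F) (A 0F 1F) (A 0F 2F) (A 1F 0F) (A 1F 1F) (A 1F 2F) (A 2F 0F) (A 2F 1F) (A 2F 2F)

  det-· : ∀ A B → det (A · B) ≈ det A * det B
  det-· A B = solve 18 (λ a b c d e f g h i a′ b′ c′ d′ e′ f′ g′ h′ i′ →
      :det (matrix₃ a b c d e f g h i :· matrix₃ a′ b′ c′ d′ e′ f′ g′ h′ i′)
        := :det (matrix₃ a b c d e f g h i) :* :det (matrix₃ a′ b′ c′ d′ e′ f′ g′ h′ i′)) refl
    (A 0F 0F) (A 0F 1F) (A 0F 2F) (A 1F 0F) (A 1F 1F) (A 1F 2F) (A 2F 0F) (A 2F 1F) (A 2F 2F)
    (B 0F 0F) (B 0F 1F) (B 0F 2F) (B 1F 0F) (B 1F 1F) (B 1F 2F) (B 2F 0F) (B 2F 1F) (B 2F 2F)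

  det-J : det J ≈ - 1#
  det-J = solve 0 (:det (matrix₃ :0 :0 :1 :0 :1 :0 :1 :0 :0) := :- :1) refl

-- Explicit unitary matrices and integrality of the determinant.

module UnitaryElements {c₁ ℓ₁ c ℓ : Level} {F : LocalField c₁ ℓ₁} {E : LocalField c ℓ}
  (E/F : UnramifiedQuadraticExtension F E) where

  open LocalField E
  open Congruences E
  open LocalFieldProperties E
  open CommutativeRingSolver commutativeRing
  open UnramifiedQuadraticExtension E/F
  open ExtensionProperties E/F
  open Conjugation E/F
  open UnitaryGroup E/F
  open Unitary
  open MatrixDeterminants commutativeRing
  open ≈-Reasoning setoid

  -- The product `C ᵗ · J · A` with the zeros of `J` removed: `J` pairs row 0 with row 2 and row 1
  -- with itself. For `C` the conjugate of `A`, the entry (i, j) is the Hermitian product of columns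
  -- i and j.
  form : M₃ → M₃ → M₃
  form C A i j = C 0F i * A 2F j + (C 1F i * A 1F j + C 2F i * A 0F j)

  form-· : ∀ C A → C ᵗ · J · A ≋ form C A
  form-· C A i j = solve 6 (λ c d e f g h →
      ((c :* :0 :+ (d :* :0 :+ (e :* :1 :+ :0))) :* f
        :+ ((c :* :0 :+ (d :* :1 :+ (e :* :0 :+ :0))) :* g :+ ((c :* :1 :+ (d :* :0 :+ (e :* :0 :+ :0))) :* h :+ :0)))
      := c :* h :+ (d :* g :+ e :* f)) refl
    (C 0F i) (C 1F i) (C 2F i) (A 0F j) (A 1F j) (A 2F j)

  unitary-relation : ∀ (g : Unitary) i j → form (conj (matrix g)) (matrix g) i j ≈ J i j
  unitary-relation g i j = trans (sym (form-· (conj (matrix g)) (matrix g) i j)) (unitary g i j)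

  -- If `x` has valuation k then its inverse `σ x` has valuation -k, but `σ` preserves every `𝔓^ k`
  -- in both directions; so k = 0.
  norm-one⇒unit : ∀ {x} → σ x * x ≈ 1# → Unit x
  norm-one⇒unit {x} σxx≈1 = [ (λ x≈0 → ⊥-elim (1≉0 (trans (sym σxx≈1) (trans (*-congˡ x≈0) (zeroʳ (σ x)))))) , finite ]′ (zero⊎finite x)
    where
    finite : ∃[ k ] v x ≡ [ k ] → Unit x
    finite (k , vx) = by-sign k vx v-σx
      where
      x⁻¹ : Carrier
      x⁻¹ = proj₁ (reciprocal vx)

      x⁻¹≈σx : x⁻¹ ≈ σ x
      x⁻¹≈σx = *-cancelʳ vx (trans (*-comm x⁻¹ x) (trans (proj₁ (proj₂ (reciprocal vx))) (sym σxx≈1)))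

      v-σx : v (σ x) ≡ [ ℤ.- k ]
      v-σx = ≡.trans (v-cong (sym x⁻¹≈σx)) (proj₂ (proj₂ (reciprocal vx)))

      by-sign : ∀ k → v x ≡ [ k ] → v (σ x) ≡ [ ℤ.- k ] → Unit x
      by-sign (+ zero)   vx _   = vx
      by-sign (+ suc n)  vx vσx = ⊥-elim (v≡⇒∉𝔓^ vσx ℤ.-<+ (σ∈𝔓^ (v≡⇒∈𝔓^ vx)))
      by-sign (-[1+ n ]) vx vσx = ⊥-elim (v≡⇒∉𝔓^ vx ℤ.-<+ (σ⁻¹∈𝔓^ (v≡⇒∈𝔓^ vσx)))

  det-conj : ∀ A → det (conj A) ≈ σ (det A)
  det-conj A = sym (trans (σ-- _ _) (+-cong (trans (σ-- _ _) (+-cong (trans (σ-- _ _) (+-cong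
      (trans (σ-+ _ _) (+-cong (trans (σ-+ _ _) (+-cong
      (term 0F 0F 1F 1F 2F 2F) (term 0F 1F 1F 2F 2F 0F))) (term 0F 2F 1F 0F 2F 1F)))
      (-‿cong (term 0F 2F 1F 1F 2F 0F)))) (-‿cong (term 0F 1F 1F 0F 2F 2F)))) (-‿cong (term 0F 0F 1F 2F 2F 1F))))
    where
    term : ∀ i j i′ j′ i″ j″ → σ (A i j * A i′ j′ * A i″ j″) ≈ σ (A i j) * σ (A i′ j′) * σ (A i″ j″)
    term i j i′ j′ i″ j″ = trans (σ-* _ _) (*-congʳ (σ-* _ _))

  -- Taking determinants in the unitary relation shows that `det` has norm one. This supplies the
  -- determinant condition of `Γ` for matrices known only by their entries.
  det-unit : ∀ (g : Unitary) → det (matrix g) ∈ 𝔒ˣ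
  det-unit g = unit⇒𝔒ˣ (norm-one⇒unit (begin
    σ d * d                                ≈⟨ solve 2 (λ s d → s :* d := :- (s :* (:- :1) :* d)) refl (σ d) d ⟩
    - (σ d * - 1# * d)                     ≈⟨ -‿cong det-form ⟩
    - (- 1#)                               ≈⟨ solve 0 (:- (:- :1) := :1) refl ⟩
    1#                                     ∎))
    where
    A : M₃
    A = matrix g

    d : Carrier
    d = det A

    det-form : σ d * - 1# * d ≈ - 1#
    det-form = begin
      σ d * - 1# * d                       ≈⟨ *-congʳ (*-cong (sym (trans (det-ᵗ (conj A)) (det-conj A))) (sym det-J)) ⟩
      det (conj A ᵗ) * det J * d           ≈⟨ *-congʳ (det-· (conj A ᵗ) J) ⟨
      det (conj A ᵗ · J) * d               ≈⟨ det-· (conj A ᵗ · J) A ⟨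
      det (conj A ᵗ · J · A)               ≈⟨ det-cong (unitary g) ⟩
      det J                                ≈⟨ det-J ⟩
      - 1#                                 ∎

  private
    -- C is the conjugate of A, written without σ in its constant entries.
    mkUnitary : ∀ A A⁻¹ C → C ≋ conj A → A · A⁻¹ ≋ 1ᴹ → A⁻¹ · A ≋ 1ᴹ → form C A ≋ J → Unitary
    mkUnitary A A⁻¹ C C≋ p q f = record
      { matrix   = A
      ; inv      = A⁻¹
      ; inverseʳ = p
      ; inverseˡ = q
      ; unitary  = ≋-trans (·-cong {B = A} (·-cong {B = J} (λ i j → sym (C≋ j i)) ≋-refl) ≋-refl) (≋-trans (form-· C A) f)
      }

    :form : ∀ {n} (C A : Fin 3 → Fin 3 → Polynomial n) → Fin 3 → Fin 3 → Polynomial n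
    :form C A i j = C 0F i :* A 2F j :+ (C 1F i :* A 1F j :+ C 2F i :* A 0F j)

  -- `y̅` stands for `σ y` but is an independent argument, so that products and inverses become
  -- polynomial identities free of `σ`.
  lower : Carrier → Carrier → Carrier → M₃
  lower y y̅ z = matrix₃ 1# 0# 0# y 1# 0# z (- y̅) 1#

  private
    lower-· : ∀ y y̅ z y′ y̅′ z′ → lower y y̅ z · lower y′ y̅′ z′ ≋ lower (y + y′) (y̅ + y̅′) (z + z′ - y̅ * y′)
    lower-· y y̅ z y′ y̅′ z′ = λ where
        0F 0F → entry 0F 0F refl y y̅ z y′ y̅′ z′
        0F 1F → entry 0F 1F refl y y̅ z y′ y̅′ z′
        0F 2F → entry 0F 2F refl y y̅ z y′ y̅′ z′
        1F 0F → entry 1F 0F refl y y̅ z y′ y̅′ z′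
        1F 1F → entry 1F 1F refl y y̅ z y′ y̅′ z′
        1F 2F → entry 1F 2F refl y y̅ z y′ y̅′ z′
        2F 0F → entry 2F 0F refl y y̅ z y′ y̅′ z′
        2F 1F → entry 2F 1F refl y y̅ z y′ y̅′ z′
        2F 2F → entry 2F 2F refl y y̅ z y′ y̅′ z′
      where
      entry = λ i j → solve 6 (λ y y̅ z y′ y̅′ z′ →
        (matrix₃ :1 :0 :0 y :1 :0 z (:- y̅) :1 :· matrix₃ :1 :0 :0 y′ :1 :0 z′ (:- y̅′) :1) i j
          := matrix₃ :1 :0 :0 (y :+ y′) :1 :0 (z :+ z′ :- y̅ :* y′) (:- (y̅ :+ y̅′)) :1 i j)

    lower-1 : ∀ {y y̅ z} → y ≈ 0# → y̅ ≈ 0# → z ≈ 0# → lower y y̅ z ≋ 1ᴹ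
    lower-1 y≈0 y̅≈0 z≈0 = λ where
        0F 0F → refl
        0F 1F → refl
        0F 2F → refl
        1F 0F → y≈0
        1F 1F → refl
        1F 2F → refl
        2F 0F → z≈0
        2F 1F → trans (-‿cong y̅≈0) (solve 0 (:- :0 := :0) refl)
        2F 2F → refl

    conj-lower : ∀ y z → lower (σ y) y (σ z) ≋ conj (lower y (σ y) z)
    conj-lower y z = λ where
        0F 0F → sym σ-1
        0F 1F → sym σ-0
        0F 2F → sym σ-0
        1F 0F → refl
        1F 1F → sym σ-1
        1F 2F → sym σ-0
        2F 0F → refl
        2F 1F → sym (trans (σ-neg (σ y)) (-‿cong (σ-involutive y)))
        2F 2F → sym σ-1

    form-lower : ∀ y y̅ z z̅ → z + z̅ + y * y̅ ≈ 0# → form (lower y̅ y z̅) (lower y y̅ z) ≋ J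
    form-lower y y̅ z z̅ relation = λ where
        0F 0F → trans (entry 0F 0F refl y y̅ z z̅) relation
        0F 1F → entry 0F 1F refl y y̅ z z̅
        0F 2F → entry 0F 2F refl y y̅ z z̅
        1F 0F → entry 1F 0F refl y y̅ z z̅
        1F 1F → entry 1F 1F refl y y̅ z z̅
        1F 2F → entry 1F 2F refl y y̅ z z̅
        2F 0F → entry 2F 0F refl y y̅ z z̅
        2F 1F → entry 2F 1F refl y y̅ z z̅
        2F 2F → entry 2F 2F refl y y̅ z z̅
      where
      entry = λ i j → solve 4 (λ y y̅ z z̅ →
        :form (matrix₃ :1 :0 :0 y̅ :1 :0 z̅ (:- y) :1) (matrix₃ :1 :0 :0 y :1 :0 z (:- y̅) :1) i j
          := matrix₃ (z :+ z̅ :+ y :* y̅) :0 :1 :0 :1 :0 :1 :0 :0 i j)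

  abstract
    -- The relation is isotropy of the first column; the remaining entries of the Hermitian form
    -- agree with `J` identically. The inverse has corner `σ z` because - z - y σ y = σ z.
    L : ∀ y z → z + σ z + y * σ y ≈ 0# → Unitary
    L y z relation = mkUnitary (lower y (σ y) z) (lower (- y) (- σ y) (σ z)) (lower (σ y) y (σ z)) (conj-lower y z)
      (≋-trans (lower-· y (σ y) z (- y) (- σ y) (σ z)) (lower-1 (-‿inverseʳ y) (-‿inverseʳ (σ y))
        (trans (solve 4 (λ y y̅ z z̅ → z :+ z̅ :- y̅ :* (:- y) := z :+ z̅ :+ y :* y̅) refl y (σ y) z (σ z)) relation)))
      (≋-trans (lower-· (- y) (- σ y) (σ z) y (σ y) z) (lower-1 (-‿inverseˡ y) (-‿inverseˡ (σ y))
        (trans (solve 4 (λ y y̅ z z̅ → z̅ :+ z :- (:- y̅) :* y := z :+ z̅ :+ y :* y̅) refl y (σ y) z (σ z)) relation)))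
      (form-lower y (σ y) z (σ z) relation)

    matrix-L : ∀ y z relation → matrix (L y z relation) ≋ lower y (σ y) z
    matrix-L y z relation = ≋-refl

    inv-L : ∀ y z relation → inv (L y z relation) ≋ lower (- y) (- σ y) (σ z)
    inv-L y z relation = ≋-refl

  -- The centre of the upper unipotent group: the upper steps relax the bound on the (0,2) entry
  -- alone.
  upper : Carrier → M₃
  upper w = matrix₃ 1# 0# w 0# 1# 0# 0# 0# 1#

  private
    upper-· : ∀ {w w′} → w + w′ ≈ 0# → upper w · upper w′ ≋ 1ᴹ
    upper-· {w} {w′} w+w′≈0 = λ where
        0F 0F → entry 0F 0F refl w w′
        0F 1F → entry 0F 1F refl w w′
        0F 2F → trans (entry 0F 2F refl w w′) w+w′≈0
        1F 0F → entry 1F 0F refl w w′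
        1F 1F → entry 1F 1F refl w w′
        1F 2F → entry 1F 2F refl w w′
        2F 0F → entry 2F 0F refl w w′
        2F 1F → entry 2F 1F refl w w′
        2F 2F → entry 2F 2F refl w w′
      where
      entry = λ i j → solve 2 (λ w w′ → (matrix₃ :1 :0 w :0 :1 :0 :0 :0 :1 :· matrix₃ :1 :0 w′ :0 :1 :0 :0 :0 :1) i j
        := matrix₃ :1 :0 (w :+ w′) :0 :1 :0 :0 :0 :1 i j)

    conj-upper : ∀ w → upper (σ w) ≋ conj (upper w)
    conj-upper w = λ where
        0F 0F → sym σ-1
        0F 1F → sym σ-0
        0F 2F → refl
        1F 0F → sym σ-0
        1F 1F → sym σ-1
        1F 2F → sym σ-0
        2F 0F → sym σ-0
        2F 1F → sym σ-0
        2F 2F → sym σ-1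

    form-upper : ∀ w w̅ → w + w̅ ≈ 0# → form (upper w̅) (upper w) ≋ J
    form-upper w w̅ relation = λ where
        0F 0F → entry 0F 0F refl w w̅
        0F 1F → entry 0F 1F refl w w̅
        0F 2F → entry 0F 2F refl w w̅
        1F 0F → entry 1F 0F refl w w̅
        1F 1F → entry 1F 1F refl w w̅
        1F 2F → entry 1F 2F refl w w̅
        2F 0F → entry 2F 0F refl w w̅
        2F 1F → entry 2F 1F refl w w̅
        2F 2F → trans (entry 2F 2F refl w w̅) relation
      where
      entry = λ i j → solve 2 (λ w w̅ → :form (matrix₃ :1 :0 w̅ :0 :1 :0 :0 :0 :1) (matrix₃ :1 :0 w :0 :1 :0 :0 :0 :1) i j
        := matrix₃ :0 :0 :1 :0 :1 :0 :1 :0 (w :+ w̅) i j)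

  abstract
    X : ∀ w → w + σ w ≈ 0# → Unitary
    X w relation = mkUnitary (upper w) (upper (- w)) (upper (σ w)) (conj-upper w)
      (upper-· (-‿inverseʳ w)) (upper-· (-‿inverseˡ w)) (form-upper w (σ w) relation)

    matrix-X : ∀ w relation → matrix (X w relation) ≋ upper w
    matrix-X w relation = ≋-refl

    inv-X : ∀ w relation → inv (X w relation) ≋ upper (- w)
    inv-X w relation = ≋-refl

  diagonal : Carrier → M₃
  diagonal u = matrix₃ 1# 0# 0# 0# u 0# 0# 0# 1#

  private
    diagonal-· : ∀ {u u′} → u * u′ ≈ 1# → diagonal u · diagonal u′ ≋ 1ᴹ
    diagonal-· {u} {u′} uu′≈1 = λ where
        0F 0F → entry 0F 0F refl u u′
        0F 1F → entry 0F 1F refl u u′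
        0F 2F → entry 0F 2F refl u u′
        1F 0F → entry 1F 0F refl u u′
        1F 1F → trans (entry 1F 1F refl u u′) uu′≈1
        1F 2F → entry 1F 2F refl u u′
        2F 0F → entry 2F 0F refl u u′
        2F 1F → entry 2F 1F refl u u′
        2F 2F → entry 2F 2F refl u u′
      where
      entry = λ i j → solve 2 (λ u u′ → (matrix₃ :1 :0 :0 :0 u :0 :0 :0 :1 :· matrix₃ :1 :0 :0 :0 u′ :0 :0 :0 :1) i j
        := matrix₃ :1 :0 :0 :0 (u :* u′) :0 :0 :0 :1 i j)

    conj-diagonal : ∀ {u u̅} → σ u ≈ u̅ → diagonal u̅ ≋ conj (diagonal u)
    conj-diagonal σu≈u̅ = λ where
        0F 0F → sym σ-1
        0F 1F → sym σ-0
        0F 2F → sym σ-0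
        1F 0F → sym σ-0
        1F 1F → sym σu≈u̅
        1F 2F → sym σ-0
        2F 0F → sym σ-0
        2F 1F → sym σ-0
        2F 2F → sym σ-1

    form-diagonal : ∀ u u̅ → u * u̅ ≈ 1# → form (diagonal u̅) (diagonal u) ≋ J
    form-diagonal u u̅ relation = λ where
        0F 0F → entry 0F 0F refl u u̅
        0F 1F → entry 0F 1F refl u u̅
        0F 2F → entry 0F 2F refl u u̅
        1F 0F → entry 1F 0F refl u u̅
        1F 1F → trans (entry 1F 1F refl u u̅) relation
        1F 2F → entry 1F 2F refl u u̅
        2F 0F → entry 2F 0F refl u u̅
        2F 1F → entry 2F 1F refl u u̅
        2F 2F → entry 2F 2F refl u u̅
      where
      entry = λ i j → solve 2 (λ u u̅ → :form (matrix₃ :1 :0 :0 :0 u̅ :0 :0 :0 :1) (matrix₃ :1 :0 :0 :0 u :0 :0 :0 :1) i j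
        := matrix₃ :0 :0 :1 :0 (u :* u̅) :0 :1 :0 :0 i j)

  abstract
    D : ∀ u u̅ → σ u ≈ u̅ → u * u̅ ≈ 1# → Unitary
    D u u̅ σu≈u̅ uu̅≈1 = mkUnitary (diagonal u) (diagonal u̅) (diagonal u̅) (conj-diagonal σu≈u̅)
      (diagonal-· uu̅≈1) (diagonal-· (trans (*-comm u̅ u) uu̅≈1)) (form-diagonal u u̅ uu̅≈1)

    matrix-D : ∀ u u̅ p q → matrix (D u u̅ p q) ≋ diagonal u
    matrix-D u u̅ p q = ≋-refl

    inv-D : ∀ u u̅ p q → inv (D u u̅ p q) ≋ diagonal u̅
    inv-D u u̅ p q = ≋-refl

  -- A representative of the nontrivial Weyl element. With `p` in `F` of valuation -n it exchanges
  -- the first and last rows compatibly with the bounds of `K n n n`.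
  antidiagonal : Carrier → Carrier → M₃
  antidiagonal p p⁻¹ = matrix₃ 0# 0# p 0# 1# 0# p⁻¹ 0# 0#

  private
    antidiagonal-· : ∀ {p p⁻¹} → p * p⁻¹ ≈ 1# → antidiagonal p p⁻¹ · antidiagonal p p⁻¹ ≋ 1ᴹ
    antidiagonal-· {p} {p⁻¹} pp⁻¹≈1 = λ where
        0F 0F → trans (entry 0F 0F refl p p⁻¹) pp⁻¹≈1
        0F 1F → entry 0F 1F refl p p⁻¹
        0F 2F → entry 0F 2F refl p p⁻¹
        1F 0F → entry 1F 0F refl p p⁻¹
        1F 1F → entry 1F 1F refl p p⁻¹
        1F 2F → entry 1F 2F refl p p⁻¹
        2F 0F → entry 2F 0F refl p p⁻¹
        2F 1F → entry 2F 1F refl p p⁻¹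
        2F 2F → trans (entry 2F 2F refl p p⁻¹) pp⁻¹≈1
      where
      entry = λ i j → solve 2 (λ p p⁻¹ → (matrix₃ :0 :0 p :0 :1 :0 p⁻¹ :0 :0 :· matrix₃ :0 :0 p :0 :1 :0 p⁻¹ :0 :0) i j
        := matrix₃ (p :* p⁻¹) :0 :0 :0 :1 :0 :0 :0 (p :* p⁻¹) i j)

    conj-antidiagonal : ∀ {p p⁻¹} → σ p ≈ p → σ p⁻¹ ≈ p⁻¹ → antidiagonal p p⁻¹ ≋ conj (antidiagonal p p⁻¹)
    conj-antidiagonal σp≈p σp⁻¹≈p⁻¹ = λ where
        0F 0F → sym σ-0
        0F 1F → sym σ-0
        0F 2F → sym σp≈p
        1F 0F → sym σ-0
        1F 1F → sym σ-1
        1F 2F → sym σ-0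
        2F 0F → sym σp⁻¹≈p⁻¹
        2F 1F → sym σ-0
        2F 2F → sym σ-0

    form-antidiagonal : ∀ p p⁻¹ → p * p⁻¹ ≈ 1# → form (antidiagonal p p⁻¹) (antidiagonal p p⁻¹) ≋ J
    form-antidiagonal p p⁻¹ relation = λ where
        0F 0F → entry 0F 0F refl p p⁻¹
        0F 1F → entry 0F 1F refl p p⁻¹
        0F 2F → trans (entry 0F 2F refl p p⁻¹) relation
        1F 0F → entry 1F 0F refl p p⁻¹
        1F 1F → entry 1F 1F refl p p⁻¹
        1F 2F → entry 1F 2F refl p p⁻¹
        2F 0F → trans (entry 2F 0F refl p p⁻¹) relation
        2F 1F → entry 2F 1F refl p p⁻¹
        2F 2F → entry 2F 2F refl p p⁻¹
      where
      entry = λ i j → solve 2 (λ p p⁻¹ → :form (matrix₃ :0 :0 p :0 :1 :0 p⁻¹ :0 :0) (matrix₃ :0 :0 p :0 :1 :0 p⁻¹ :0 :0) i j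
        := matrix₃ :0 :0 (p :* p⁻¹) :0 :1 :0 (p :* p⁻¹) :0 :0 i j)

  abstract
    T : ∀ p p⁻¹ → σ p ≈ p → σ p⁻¹ ≈ p⁻¹ → p * p⁻¹ ≈ 1# → Unitary
    T p p⁻¹ σp≈p σp⁻¹≈p⁻¹ pp⁻¹≈1 = mkUnitary (antidiagonal p p⁻¹) (antidiagonal p p⁻¹) (antidiagonal p p⁻¹)
      (conj-antidiagonal σp≈p σp⁻¹≈p⁻¹) (antidiagonal-· pp⁻¹≈1) (antidiagonal-· pp⁻¹≈1) (form-antidiagonal p p⁻¹ pp⁻¹≈1)

    matrix-T : ∀ p p⁻¹ q r s → matrix (T p p⁻¹ q r s) ≋ antidiagonal p p⁻¹
    matrix-T p p⁻¹ q r s = ≋-refl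

    inv-T : ∀ p p⁻¹ q r s → inv (T p p⁻¹ q r s) ≋ antidiagonal p p⁻¹
    inv-T p p⁻¹ q r s = ≋-refl

  module _ (A : M₃) (j : Fin 3) where

    private
      a b c′ : Carrier
      a = A 0F j
      b = A 1F j
      c′ = A 2F j

    lower-row₀ : ∀ y y̅ z → (lower y y̅ z · A) 0F j ≈ a
    lower-row₀ y y̅ z = solve 3 (λ a b c → :1 :* a :+ (:0 :* b :+ (:0 :* c :+ :0)) := a) refl a b c′

    lower-row₁ : ∀ y y̅ z → (lower y y̅ z · A) 1F j ≈ y * a + b
    lower-row₁ y y̅ z = solve 4 (λ y a b c → y :* a :+ (:1 :* b :+ (:0 :* c :+ :0)) := y :* a :+ b) refl y a b c′

    lower-row₂ : ∀ y y̅ z → (lower y y̅ z · A) 2F j ≈ z * a - y̅ * b + c′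
    lower-row₂ y y̅ z = solve 5 (λ y̅ z a b c → z :* a :+ ((:- y̅) :* b :+ (:1 :* c :+ :0)) := z :* a :- y̅ :* b :+ c) refl y̅ z a b c′

    upper-row₀ : ∀ w → (upper w · A) 0F j ≈ a + w * c′
    upper-row₀ w = solve 4 (λ w a b c → :1 :* a :+ (:0 :* b :+ (w :* c :+ :0)) := a :+ w :* c) refl w a b c′

    upper-row₁ : ∀ w → (upper w · A) 1F j ≈ b
    upper-row₁ w = solve 3 (λ a b c → :0 :* a :+ (:1 :* b :+ (:0 :* c :+ :0)) := b) refl a b c′

    upper-row₂ : ∀ w → (upper w · A) 2F j ≈ c′
    upper-row₂ w = solve 3 (λ a b c → :0 :* a :+ (:0 :* b :+ (:1 :* c :+ :0)) := c) refl a b c′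

    diagonal-row₀ : ∀ u → (diagonal u · A) 0F j ≈ a
    diagonal-row₀ u = solve 3 (λ a b c → :1 :* a :+ (:0 :* b :+ (:0 :* c :+ :0)) := a) refl a b c′

    diagonal-row₁ : ∀ u → (diagonal u · A) 1F j ≈ u * b
    diagonal-row₁ u = solve 4 (λ u a b c → :0 :* a :+ (u :* b :+ (:0 :* c :+ :0)) := u :* b) refl u a b c′

    diagonal-row₂ : ∀ u → (diagonal u · A) 2F j ≈ c′
    diagonal-row₂ u = solve 3 (λ a b c → :0 :* a :+ (:0 :* b :+ (:1 :* c :+ :0)) := c) refl a b c′

    antidiagonal-row₀ : ∀ p p⁻¹ → (antidiagonal p p⁻¹ · A) 0F j ≈ p * c′
    antidiagonal-row₀ p p⁻¹ = solve 4 (λ p a b c → :0 :* a :+ (:0 :* b :+ (p :* c :+ :0)) := p :* c) refl p a b c′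

    antidiagonal-row₁ : ∀ p p⁻¹ → (antidiagonal p p⁻¹ · A) 1F j ≈ b
    antidiagonal-row₁ p p⁻¹ = solve 3 (λ a b c → :0 :* a :+ (:1 :* b :+ (:0 :* c :+ :0)) := b) refl a b c′

    antidiagonal-row₂ : ∀ p p⁻¹ → (antidiagonal p p⁻¹ · A) 2F j ≈ p⁻¹ * a
    antidiagonal-row₂ p p⁻¹ = solve 4 (λ p a b c → p :* a :+ (:0 :* b :+ (:0 :* c :+ :0)) := p :* a) refl p⁻¹ a b c′

-- The sets `K r s m`: openness, refinement and stability under left multiplication.

module Subgroups {c₁ ℓ₁ c ℓ : Level} {F : LocalField c₁ ℓ₁} {E : LocalField c ℓ}
  (E/F : UnramifiedQuadraticExtension F E) where

  open LocalField E hiding (zero)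
  open Congruences E
  open LocalFieldProperties E
  open CommutativeRingSolver commutativeRing
  open UnramifiedQuadraticExtension E/F
  open ExtensionProperties E/F
  open Conjugation E/F
  open UnitaryElements E/F
  open UnitaryGroup E/F
  open Unitary
  open MatrixDeterminants commutativeRing
  open ≈-Reasoning setoid

  open Haar U IsOpen public
  private module U = Group U

  entries-bounded : ∀ {n} (f : Fin n → Carrier) → ∃[ N ] ∀ i → f i ∈ 𝔓^ N
  entries-bounded {zero}  f = + 0 , λ ()
  entries-bounded {suc n} f = bound (zero⊎finite (f zero)) (entries-bounded (λ i → f (suc i)))
    where
    bound : f zero ≈ 0# ⊎ (∃[ k ] v (f zero) ≡ [ k ]) → (∃[ N ] ∀ i → f (suc i) ∈ 𝔓^ N) → ∃[ N ] ∀ i → f i ∈ 𝔓^ N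
    bound (inj₁ f₀≈0)     (N , p) = N , λ { zero → ≈0⇒∈𝔓^ f₀≈0 ; (suc i) → p i }
    bound (inj₂ (k , vf)) (N , p) = k ℤ.⊓ N , λ
      { zero    → 𝔓^-weaken (ℤₚ.i⊓j≤i k N) (v≡⇒∈𝔓^ vf)
      ; (suc i) → 𝔓^-weaken (ℤₚ.i⊓j≤j k N) (p i)
      }

  matrix-bounded : ∀ (A : M₃) → ∃[ N ] ∀ i j → A i j ∈ 𝔓^ N
  matrix-bounded A = proj₁ all-rows , λ i j → 𝔓^-weaken (ℤ-bound i) (proj₂ (row i) j)
    where
    row : ∀ i → ∃[ N ] ∀ j → A i j ∈ 𝔓^ N
    row i = entries-bounded (A i)

    minimum : ∀ {n} (f : Fin n → ℤ) → ∃[ N ] ∀ i → N ℤ.≤ f i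
    minimum {zero}  f = + 0 , λ ()
    minimum {suc n} f = f zero ℤ.⊓ proj₁ rest , λ
      { zero    → ℤₚ.i⊓j≤i (f zero) (proj₁ rest)
      ; (suc i) → ℤₚ.≤-trans (ℤₚ.i⊓j≤j (f zero) (proj₁ rest)) (proj₂ rest i)
      }
      where
      rest : ∃[ N ] ∀ i → N ℤ.≤ f (suc i)
      rest = minimum (λ i → f (suc i))

    all-rows : ∃[ N ] ∀ i → N ℤ.≤ proj₁ (row i)
    all-rows = minimum (λ i → proj₁ (row i))

    ℤ-bound : ∀ i → proj₁ all-rows ℤ.≤ proj₁ (row i)
    ℤ-bound = proj₂ all-rows

  -- With all entries of `inv x` in `𝔓^ M`, multiplication by it lowers congruences by at most M, so
  -- the radius `N - M` at `y` suffices for the radius `N` at the product.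
  translate-isOpen : ∀ x {A} → IsOpen A → IsOpen (translate x A)
  translate-isOpen x {A} A-open y y∈ = N ℤ.- M , λ h h~y → proj₂ neighbourhood (x U.⁻¹ U.∙ h) (close h h~y)
    where
    neighbourhood : ∃[ N ] (∀ h → (∀ i j → (matrix h i j - matrix (x U.⁻¹ U.∙ y) i j) ∈ 𝔓^ N) → h ∈ A)
    neighbourhood = A-open (x U.⁻¹ U.∙ y) y∈

    N M : ℤ
    N = proj₁ neighbourhood
    M = proj₁ (matrix-bounded (inv x))

    inv∈ : ∀ i j → inv x i j ∈ 𝔓^ M
    inv∈ = proj₂ (matrix-bounded (inv x))

    N≤M+N-M : ∀ M N → N ≡ M ℤ.+ (N ℤ.- M)
    N≤M+N-M = ℤ-RingSolver.solve-∀

    close : ∀ h → (∀ i j → (matrix h i j - matrix y i j) ∈ 𝔓^ (N ℤ.- M)) →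
            ∀ i j → (matrix (x U.⁻¹ U.∙ h) i j - matrix (x U.⁻¹ U.∙ y) i j) ∈ 𝔓^ N
    close h h~y i j = 𝔓^-cong
      (solve 9 (λ a b c d e f d′ e′ f′ → a :* (d :- d′) :+ (b :* (e :- e′) :+ c :* (f :- f′))
          := (a :* d :+ (b :* e :+ (c :* f :+ :0))) :- (a :* d′ :+ (b :* e′ :+ (c :* f′ :+ :0)))) refl
        (inv x i 0F) (inv x i 1F) (inv x i 2F) (matrix h 0F j) (matrix h 1F j) (matrix h 2F j)
        (matrix y 0F j) (matrix y 1F j) (matrix y 2F j))
      (𝔓^-+ (term 0F) (𝔓^-+ (term 1F) (term 2F)))
      where
      term : ∀ k → (inv x i k * (matrix h k j - matrix y k j)) ∈ 𝔓^ N
      term k = 𝔓^-*≤ (ℤₚ.≤-reflexive (N≤M+N-M M N)) (inv∈ i k) (h~y k j)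

  ⋃-isOpen : ∀ {I : Set} (A : I → Pred Unitary (c ⊔ ℓ)) → (∀ i → IsOpen (A i)) → IsOpen (⋃ I A)
  ⋃-isOpen A A-open g (i , g∈) = proj₁ (A-open i g g∈) , λ h h~g → i , proj₂ (A-open i g g∈) h h~g

  open CosetDecompositions U IsOpen translate-isOpen ⋃-isOpen public

  K-entry : ℕ → ℕ → ℕ → Fin 3 → Fin 3 → Pred Carrier _
  K-entry r s m 0F 0F = 𝔒
  K-entry r s m 0F 1F = 𝔒
  K-entry r s m 0F 2F = 𝔓^ (ℤ.- (+ r))
  K-entry r s m 1F 0F = 𝔓^ (+ s)
  K-entry r s m 1F 1F = λ x → (x - 1#) ∈ 𝔓^ (+ m)
  K-entry r s m 1F 2F = 𝔒
  K-entry r s m 2F 0F = 𝔓^ (+ s)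
  K-entry r s m 2F 1F = 𝔓^ (+ s)
  K-entry r s m 2F 2F = 𝔒

  record K (r s m : ℕ) (g : Unitary) : Set (c ⊔ ℓ) where
    constructor K-intro
    field entry : ∀ i j → matrix g i j ∈ K-entry r s m i j

  open K public

  private
    0≤_ : ∀ n → + 0 ℤ.≤ + n
    0≤ n = ℤ.+≤+ ℕ.z≤n

    ≤-⇒0≤ : ∀ {r s} → r ℕ.≤ s → + 0 ℤ.≤ + s ℤ.+ ℤ.- (+ r)
    ≤-⇒0≤ r≤s = ℤₚ.i≤j⇒0≤j-i (ℤ.+≤+ r≤s)

    1~⇒𝔒 : ∀ {m x} → (x - 1#) ∈ 𝔓^ (+ m) → x ∈ 𝔒
    1~⇒𝔒 {m} {x} p = 𝔓^-cong (solve 1 (λ x → (x :- :1) :+ :1 := x) refl x) (𝔓^-+ (𝔓^-weaken (0≤ m) p) 1∈𝔒)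

    K-entry-cong : ∀ {r s m} i j {x y} → x ≈ y → x ∈ K-entry r s m i j → y ∈ K-entry r s m i j
    K-entry-cong 0F 0F = 𝔓^-cong
    K-entry-cong 0F 1F = 𝔓^-cong
    K-entry-cong 0F 2F = 𝔓^-cong
    K-entry-cong 1F 0F = 𝔓^-cong
    K-entry-cong 1F 1F = λ x≈y → 𝔓^-cong (+-congʳ x≈y)
    K-entry-cong 1F 2F = 𝔓^-cong
    K-entry-cong 2F 0F = 𝔓^-cong
    K-entry-cong 2F 1F = 𝔓^-cong
    K-entry-cong 2F 2F = 𝔓^-cong

    K-entry-weaken : ∀ {r s m r′ s′ m′} → r ℕ.≤ r′ → s′ ℕ.≤ s → m′ ℕ.≤ m →
                     ∀ i j {x} → x ∈ K-entry r s m i j → x ∈ K-entry r′ s′ m′ i j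
    K-entry-weaken r≤ s≤ m≤ 0F 0F = λ p → p
    K-entry-weaken r≤ s≤ m≤ 0F 1F = λ p → p
    K-entry-weaken r≤ s≤ m≤ 0F 2F = 𝔓^-weaken (ℤₚ.neg-mono-≤ (ℤ.+≤+ r≤))
    K-entry-weaken r≤ s≤ m≤ 1F 0F = 𝔓^-weaken (ℤ.+≤+ s≤)
    K-entry-weaken r≤ s≤ m≤ 1F 1F = 𝔓^-weaken (ℤ.+≤+ m≤)
    K-entry-weaken r≤ s≤ m≤ 1F 2F = λ p → p
    K-entry-weaken r≤ s≤ m≤ 2F 0F = 𝔓^-weaken (ℤ.+≤+ s≤)
    K-entry-weaken r≤ s≤ m≤ 2F 1F = 𝔓^-weaken (ℤ.+≤+ s≤)
    K-entry-weaken r≤ s≤ m≤ 2F 2F = λ p → p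

  infixr 7 _⧵_

  -- x⁻¹ g, kept abstract because unfolding it makes Agda compare elements of
  -- Unitary by η-expansion, proofs included.
  abstract
    _⧵_ : Unitary → Unitary → Unitary
    x ⧵ g = x U.⁻¹ U.∙ g

    matrix-⧵ : ∀ x g → matrix (x ⧵ g) ≋ inv x · matrix g
    matrix-⧵ x g = ≋-refl

  matrix-uncancel : ∀ x g → matrix g ≋ matrix x · matrix (x ⧵ g)
  matrix-uncancel x g = ≋-trans (≋-sym (·-identityˡ (matrix g)))
    (≋-trans (·-cong {B = matrix g} (≋-sym (inverseʳ x)) ≋-refl)
    (≋-trans (·-assoc (matrix x) (inv x) (matrix g)) (·-cong {matrix x} ≋-refl (≋-sym (matrix-⧵ x g)))))

  to-translate : ∀ {r s m} x g → K r s m (x ⧵ g) → g ∈ translate x (K r s m)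
  to-translate {r} {s} {m} x g (K-intro p) = K-intro λ i j → K-entry-cong {r} {s} {m} i j (matrix-⧵ x g i j) (p i j)

  from-translate : ∀ {r s m} x g → g ∈ translate x (K r s m) → K r s m (x ⧵ g)
  from-translate {r} {s} {m} x g (K-intro p) = K-intro λ i j → K-entry-cong {r} {s} {m} i j (sym (matrix-⧵ x g i j)) (p i j)

  K-weaken : ∀ {r s m r′ s′ m′} → r ℕ.≤ r′ → s′ ℕ.≤ s → m′ ℕ.≤ m → K r s m ⊆ K r′ s′ m′
  K-weaken r≤ s≤ m≤ (K-intro p) = K-intro λ i j → K-entry-weaken r≤ s≤ m≤ i j (p i j)

  K-isOpen : ∀ r s m → IsOpen (K r s m)
  K-isOpen r s m g (K-intro g∈) = + (s ℕ.+ m) , λ h h~g → K-intro λ i j → close i j (h~g i j) (g∈ i j)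
    where
    N : ℤ
    N = + (s ℕ.+ m)

    s≤N : + s ℤ.≤ N
    s≤N = ℤ.+≤+ (ℕₚ.m≤m+n s m)

    -r≤N : ℤ.- (+ r) ℤ.≤ N
    -r≤N = ℤₚ.≤-trans (ℤₚ.neg-mono-≤ (0≤ r)) (0≤ (s ℕ.+ m))

    close : ∀ i j {x y} → x ~ y [ N ] → y ∈ K-entry r s m i j → x ∈ K-entry r s m i j
    close 0F 0F = 𝔓^-~ (0≤ (s ℕ.+ m))
    close 0F 1F = 𝔓^-~ (0≤ (s ℕ.+ m))
    close 0F 2F = 𝔓^-~ -r≤N
    close 1F 0F = 𝔓^-~ s≤N
    close 1F 1F = λ x~y → 𝔓^-~ (ℤ.+≤+ (ℕₚ.m≤n+m m s)) (~-+ x~y (~-refl (- 1#)))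
    close 1F 2F = 𝔓^-~ (0≤ (s ℕ.+ m))
    close 2F 0F = 𝔓^-~ s≤N
    close 2F 1F = 𝔓^-~ s≤N
    close 2F 2F = 𝔓^-~ (0≤ (s ℕ.+ m))

  -- Columns 0 and 2 have Hermitian product 1, and the hypotheses put every term except σ h₀₀ h₂₂
  -- into `𝔓`. The exponent `suc r` compensates for h₀₂, which is only known to lie in `𝔓^ (- r)`.
  corner-units : ∀ {r s m h} → h ∈ K r s m → matrix h 1F 0F ∈ 𝔓 → matrix h 2F 0F ∈ 𝔓^ (+ suc r) →
                 Unit (matrix h 0F 0F) ∧ Unit (matrix h 2F 2F)
  corner-units {r} {h = h} (K-intro h∈) h₁₀∈ h₂₀∈ =
    unit (h∈ 0F 0F) (λ p → unit∉𝔓 product-unit (𝔒-*ʳ (σ∈𝔓^ p) (h∈ 2F 2F))) ,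
    unit (h∈ 2F 2F) (λ p → unit∉𝔓 product-unit (𝔒-*ˡ (σ∈𝔓^ (h∈ 0F 0F)) p))
    where
    A : M₃
    A = matrix h

    1≤1+r-r : ∀ r → + 1 ≡ (+ 1 ℤ.+ r) ℤ.+ ℤ.- r
    1≤1+r-r = ℤ-RingSolver.solve-∀

    product-unit : Unit (σ (A 0F 0F) * A 2F 2F)
    product-unit = unit-~ (𝔓^-cong
      (trans (solve 2 (λ x y → :- y := x :- (x :+ y)) refl (σ (A 0F 0F) * A 2F 2F) _)
        (+-congˡ (-‿cong (unitary-relation h 0F 2F))))
      (𝔓^-neg (𝔓^-+ (𝔒-*ʳ (σ∈𝔓^ h₁₀∈) (h∈ 1F 2F))
                    (𝔓^-*≤ (ℤₚ.≤-reflexive (1≤1+r-r (+ r))) (σ∈𝔓^ h₂₀∈) (h∈ 0F 2F))))) v-1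

  K-refine-upper : ∀ {r r′ s m h} → h ∈ K r s m → matrix h 0F 2F ∈ 𝔓^ (ℤ.- (+ r′)) → h ∈ K r′ s m
  K-refine-upper {r} {r′} {s} {m} {h} (K-intro h∈) h₀₂∈ = K-intro refined
    where
    refined : ∀ i j → matrix h i j ∈ K-entry r′ s m i j
    refined 0F 0F = h∈ 0F 0F
    refined 0F 1F = h∈ 0F 1F
    refined 0F 2F = h₀₂∈
    refined 1F 0F = h∈ 1F 0F
    refined 1F 1F = h∈ 1F 1F
    refined 1F 2F = h∈ 1F 2F
    refined 2F 0F = h∈ 2F 0F
    refined 2F 1F = h∈ 2F 1F
    refined 2F 2F = h∈ 2F 2F

  -- The (2,1) entry is controlled by orthogonality of the first two columns.
  K-refine-lower : ∀ {r s m h} → r ℕ.≤ s → h ∈ K r s m →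
                   matrix h 1F 0F ∈ 𝔓^ (+ suc s) → matrix h 2F 0F ∈ 𝔓^ (+ suc s) → h ∈ K r (suc s) m
  K-refine-lower {r} {s} {m} {h} r≤s h∈K@(K-intro h∈) h₁₀∈ h₂₀∈ = K-intro refined
    where
    A : M₃
    A = matrix h

    h₀₀-unit : Unit (A 0F 0F)
    h₀₀-unit = proj₁ (corner-units h∈K (𝔓^-weaken (ℤ.+≤+ (ℕ.s≤s ℕ.z≤n)) h₁₀∈) (𝔓^-weaken (ℤ.+≤+ (ℕ.s≤s r≤s)) h₂₀∈))

    h₂₁∈ : A 2F 1F ∈ 𝔓^ (+ suc s)
    h₂₁∈ = unit-cancelˡ (σ-unit h₀₀-unit) (𝔓^-cong
      (solve 2 (λ x y → (x :+ y) :- y := x) refl (σ (A 0F 0F) * A 2F 1F) _)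
      (𝔓^-- (≈0⇒∈𝔓^ (unitary-relation h 0F 1F))
            (𝔓^-+ (𝔒-*ʳ (σ∈𝔓^ h₁₀∈) (1~⇒𝔒 {m} (h∈ 1F 1F))) (𝔒-*ʳ (σ∈𝔓^ h₂₀∈) (h∈ 0F 1F)))))

    refined : ∀ i j → A i j ∈ K-entry r (suc s) m i j
    refined 0F 0F = h∈ 0F 0F
    refined 0F 1F = h∈ 0F 1F
    refined 0F 2F = h∈ 0F 2F
    refined 1F 0F = h₁₀∈
    refined 1F 1F = h∈ 1F 1F
    refined 1F 2F = h∈ 1F 2F
    refined 2F 0F = h₂₀∈
    refined 2F 1F = h₂₁∈
    refined 2F 2F = h∈ 2F 2F

  -- Since g = x (x⁻¹ g), containment reduces to stability of the larger set under left
  -- multiplication by `x`.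
  translate⊆ : ∀ {r s m r′ s′ m′} x → r ℕ.≤ r′ → s′ ℕ.≤ s → m′ ℕ.≤ m →
    (∀ g h → matrix h ≋ matrix x · matrix g → g ∈ K r′ s′ m′ → h ∈ K r′ s′ m′) →
    translate x (K r s m) ⊆ K r′ s′ m′
  translate⊆ {r} {s} {m} x r≤ s≤ m≤ stable {g} p =
    stable (x ⧵ g) g (matrix-uncancel x g) (K-weaken r≤ s≤ m≤ {x ⧵ g} (from-translate {r} {s} {m} x g p))

  -- The bound `r ≤ s` keeps products of `𝔓^ s` with the corner integral; `m ≤ s` keeps the change y
  -- g₀₁ of the central entry within `𝔓^ m`.
  lower-stable : ∀ {r s m y y̅ z g h} → r ℕ.≤ s → m ℕ.≤ s → y ∈ 𝔓^ (+ s) → y̅ ∈ 𝔓^ (+ s) → z ∈ 𝔓^ (+ s) →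
                 matrix h ≋ lower y y̅ z · matrix g → g ∈ K r s m → h ∈ K r s m
  lower-stable {r} {s} {m} {y} {y̅} {z} {g} {h} r≤s m≤s y∈ y̅∈ z∈ h≋ (K-intro g∈) = K-intro λ i j →
    K-entry-cong i j (sym (h≋ i j)) (product i j)
    where
    A : M₃
    A = matrix g

    0≤s : + 0 ℤ.≤ + s
    0≤s = 0≤ s

    scaled-02 : ∀ {x} → x ∈ 𝔓^ (+ s) → (x * A 0F 2F) ∈ 𝔒
    scaled-02 x∈ = 𝔓^-*≤ (≤-⇒0≤ r≤s) x∈ (g∈ 0F 2F)

    row₁ : ∀ {j} → (y * A 0F j + A 1F j) ∈ K-entry r s m 1F j → (lower y y̅ z · A) 1F j ∈ K-entry r s m 1F j
    row₁ {j} = K-entry-cong 1F j (sym (lower-row₁ A j y y̅ z))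

    row₂ : ∀ {j} → (z * A 0F j - y̅ * A 1F j + A 2F j) ∈ K-entry r s m 2F j → (lower y y̅ z · A) 2F j ∈ K-entry r s m 2F j
    row₂ {j} = K-entry-cong 2F j (sym (lower-row₂ A j y y̅ z))

    product : ∀ i j → (lower y y̅ z · A) i j ∈ K-entry r s m i j
    product 0F j  = K-entry-cong 0F j (sym (lower-row₀ A j y y̅ z)) (g∈ 0F j)
    product 1F 0F = row₁ {0F} (𝔓^-+ (𝔒-*ʳ y∈ (g∈ 0F 0F)) (g∈ 1F 0F))
    product 1F 1F = row₁ {1F} (𝔓^-cong (sym (+-assoc _ _ _)) (𝔓^-+ (𝔒-*ʳ (𝔓^-weaken (ℤ.+≤+ m≤s) y∈) (g∈ 0F 1F)) (g∈ 1F 1F)))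
    product 1F 2F = row₁ {2F} (𝔓^-+ (scaled-02 y∈) (g∈ 1F 2F))
    product 2F 0F = row₂ {0F} (𝔓^-+ (𝔓^-- (𝔒-*ʳ z∈ (g∈ 0F 0F)) (𝔒-*ˡ (𝔓^-weaken 0≤s y̅∈) (g∈ 1F 0F))) (g∈ 2F 0F))
    product 2F 1F = row₂ {1F} (𝔓^-+ (𝔓^-- (𝔒-*ʳ z∈ (g∈ 0F 1F)) (𝔒-*ʳ y̅∈ (1~⇒𝔒 {m} (g∈ 1F 1F)))) (g∈ 2F 1F))
    product 2F 2F = row₂ {2F} (𝔓^-+ (𝔓^-- (scaled-02 z∈) (𝔒-*ˡ (𝔓^-weaken 0≤s y̅∈) (g∈ 1F 2F))) (g∈ 2F 2F))

  upper-stable : ∀ {r s m w g h} → r ℕ.≤ s → w ∈ 𝔓^ (ℤ.- (+ r)) →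
                 matrix h ≋ upper w · matrix g → g ∈ K r s m → h ∈ K r s m
  upper-stable {r} {s} {m} {w} {g} {h} r≤s w∈ h≋ (K-intro g∈) = K-intro λ i j →
    K-entry-cong i j (sym (h≋ i j)) (product i j)
    where
    A : M₃
    A = matrix g

    0≤-r+s : + 0 ℤ.≤ ℤ.- (+ r) ℤ.+ + s
    0≤-r+s = ≡.subst (+ 0 ℤ.≤_) (ℤₚ.+-comm (+ s) (ℤ.- (+ r))) (≤-⇒0≤ r≤s)

    row₀ : ∀ {j} → (A 0F j + w * A 2F j) ∈ K-entry r s m 0F j → (upper w · A) 0F j ∈ K-entry r s m 0F j
    row₀ {j} = K-entry-cong 0F j (sym (upper-row₀ A j w))

    product : ∀ i j → (upper w · A) i j ∈ K-entry r s m i j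
    product 0F 0F = row₀ {0F} (𝔓^-+ (g∈ 0F 0F) (𝔓^-*≤ 0≤-r+s w∈ (g∈ 2F 0F)))
    product 0F 1F = row₀ {1F} (𝔓^-+ (g∈ 0F 1F) (𝔓^-*≤ 0≤-r+s w∈ (g∈ 2F 1F)))
    product 0F 2F = row₀ {2F} (𝔓^-+ (g∈ 0F 2F) (𝔒-*ʳ w∈ (g∈ 2F 2F)))
    product 1F j  = K-entry-cong 1F j (sym (upper-row₁ A j w)) (g∈ 1F j)
    product 2F j  = K-entry-cong 2F j (sym (upper-row₂ A j w)) (g∈ 2F j)

  diagonal-stable : ∀ {r s m u g h} → u ∈ 𝔒 → (u - 1#) ∈ 𝔓^ (+ m) →
                    matrix h ≋ diagonal u · matrix g → g ∈ K r s m → h ∈ K r s m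
  diagonal-stable {r} {s} {m} {u} {g} {h} u∈ u~1 h≋ (K-intro g∈) = K-intro λ i j →
    K-entry-cong i j (sym (h≋ i j)) (product i j)
    where
    A : M₃
    A = matrix g

    row₁ : ∀ {j} → (u * A 1F j) ∈ K-entry r s m 1F j → (diagonal u · A) 1F j ∈ K-entry r s m 1F j
    row₁ {j} = K-entry-cong 1F j (sym (diagonal-row₁ A j u))

    product : ∀ i j → (diagonal u · A) i j ∈ K-entry r s m i j
    product 0F j  = K-entry-cong 0F j (sym (diagonal-row₀ A j u)) (g∈ 0F j)
    product 1F 0F = row₁ {0F} (𝔒-*ˡ u∈ (g∈ 1F 0F))
    product 1F 1F = row₁ {1F} (𝔓^-cong (solve 2 (λ u x → u :* (x :- :1) :+ (u :- :1) := u :* x :- :1) refl u (A 1F 1F))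
                      (𝔓^-+ (𝔒-*ˡ u∈ (g∈ 1F 1F)) u~1))
    product 1F 2F = row₁ {2F} (𝔒-*ˡ u∈ (g∈ 1F 2F))
    product 2F j  = K-entry-cong 2F j (sym (diagonal-row₂ A j u)) (g∈ 2F j)

  antidiagonal-stable : ∀ {n p p⁻¹ g h} → p ∈ 𝔓^ (ℤ.- (+ n)) → p⁻¹ ∈ 𝔓^ (+ n) →
                        matrix h ≋ antidiagonal p p⁻¹ · matrix g → g ∈ K n n n → h ∈ K n n n
  antidiagonal-stable {n} {p} {p⁻¹} {g} {h} p∈ p⁻¹∈ h≋ (K-intro g∈) = K-intro λ i j →
    K-entry-cong i j (sym (h≋ i j)) (product i j)
    where
    A : M₃
    A = matrix g

    0≤-n+n : + 0 ℤ.≤ ℤ.- (+ n) ℤ.+ + n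
    0≤-n+n = ℤₚ.≤-reflexive (≡.sym (ℤₚ.+-inverseˡ (+ n)))

    0≤n-n : + 0 ℤ.≤ + n ℤ.+ ℤ.- (+ n)
    0≤n-n = ℤₚ.≤-reflexive (≡.sym (ℤₚ.+-inverseʳ (+ n)))

    row₀ : ∀ {j} → (p * A 2F j) ∈ K-entry n n n 0F j → (antidiagonal p p⁻¹ · A) 0F j ∈ K-entry n n n 0F j
    row₀ {j} = K-entry-cong 0F j (sym (antidiagonal-row₀ A j p p⁻¹))

    row₂ : ∀ {j} → (p⁻¹ * A 0F j) ∈ K-entry n n n 2F j → (antidiagonal p p⁻¹ · A) 2F j ∈ K-entry n n n 2F j
    row₂ {j} = K-entry-cong 2F j (sym (antidiagonal-row₂ A j p p⁻¹))

    product : ∀ i j → (antidiagonal p p⁻¹ · A) i j ∈ K-entry n n n i j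
    product 0F 0F = row₀ {0F} (𝔓^-*≤ 0≤-n+n p∈ (g∈ 2F 0F))
    product 0F 1F = row₀ {1F} (𝔓^-*≤ 0≤-n+n p∈ (g∈ 2F 1F))
    product 0F 2F = row₀ {2F} (𝔒-*ʳ p∈ (g∈ 2F 2F))
    product 1F j  = K-entry-cong 1F j (sym (antidiagonal-row₁ A j p p⁻¹)) (g∈ 1F j)
    product 2F 0F = row₂ {0F} (𝔒-*ʳ p⁻¹∈ (g∈ 0F 0F))
    product 2F 1F = row₂ {1F} (𝔒-*ʳ p⁻¹∈ (g∈ 0F 1F))
    product 2F 2F = row₂ {2F} (𝔓^-*≤ 0≤n-n p⁻¹∈ (g∈ 0F 2F))

-- Coset representatives for each step of the chain.

module Transversals {c₁ ℓ₁ c ℓ : Level} {F : LocalField c₁ ℓ₁} {E : LocalField c ℓ}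
  (E/F : UnramifiedQuadraticExtension F E) where

  open LocalField E hiding (zero)
  open Congruences E
  open LocalFieldProperties E
  open CommutativeRingSolver commutativeRing
  open UnramifiedQuadraticExtension E/F
  open ExtensionProperties E/F
  open Conjugation E/F
  open NormOneDigits E/F
  open UnitaryElements E/F
  open Subgroups E/F
  open UnitaryGroup E/F
  open Unitary
  open MatrixDeterminants commutativeRing
  open ≈-Reasoning setoid

  private
    -- Isotropy survives scaling by `a`. Scaling the leading entry to 1 turns it into the relation
    -- that parametrises lower unipotent elements.
    isotropic-normalised : ∀ {g₀ g₁ g₂ a} → g₀ * a ≈ 1# → σ g₀ * g₂ + (σ g₁ * g₁ + σ g₂ * g₀) ≈ 0# →
      g₂ * a + σ (g₂ * a) + g₁ * a * σ (g₁ * a) ≈ 0#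
    isotropic-normalised {g₀} {g₁} {g₂} {a} g₀a≈1 isotropic = begin
      g₂ * a + σ (g₂ * a) + g₁ * a * σ (g₁ * a)
        ≈⟨ +-cong (+-congˡ (σ-* g₂ a)) (*-congˡ (σ-* g₁ a)) ⟩
      g₂ * a + σ g₂ * σ a + g₁ * a * (σ g₁ * σ a)
        ≈⟨ +-congʳ (+-cong (trans (sym (*-identityˡ _)) (*-congʳ (sym σ[g₀a]≈1)))
                           (trans (sym (*-identityʳ _)) (*-congˡ (sym g₀a≈1)))) ⟩
      σ g₀ * σ a * (g₂ * a) + σ g₂ * σ a * (g₀ * a) + g₁ * a * (σ g₁ * σ a)
        ≈⟨ solve 8 (λ a a̅ g₀ g₁ g₂ g̅₀ g̅₁ g̅₂ → g̅₀ :* a̅ :* (g₂ :* a) :+ g̅₂ :* a̅ :* (g₀ :* a) :+ g₁ :* a :* (g̅₁ :* a̅)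
             := (g̅₀ :* g₂ :+ (g̅₁ :* g₁ :+ g̅₂ :* g₀)) :* (a :* a̅)) refl a (σ a) g₀ g₁ g₂ (σ g₀) (σ g₁) (σ g₂) ⟩
      (σ g₀ * g₂ + (σ g₁ * g₁ + σ g₂ * g₀)) * (a * σ a)
        ≈⟨ *-congʳ isotropic ⟩
      0# * (a * σ a)
        ≈⟨ zeroˡ _ ⟩
      0# ∎
      where
      σ[g₀a]≈1 : σ g₀ * σ a ≈ 1#
      σ[g₀a]≈1 = trans (sym (σ-* g₀ a)) (trans (σ-cong g₀a≈1) σ-1)

    clear-denominator : ∀ {g a} → g * a ≈ 1# → ∀ z y b c → g * (z + y * (b * a) + c * a) ≈ z * g + y * b + c
    clear-denominator {g} {a} ga≈1 z y b c = begin
      g * (z + y * (b * a) + c * a)            ≈⟨ solve 6 (λ g a z y b c → g :* (z :+ y :* (b :* a) :+ c :* a) := z :* g :+ y :* b :* (g :* a) :+ c :* (g :* a)) refl g a z y b c ⟩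
      z * g + y * b * (g * a) + c * (g * a)    ≈⟨ +-cong (+-congˡ (trans (*-congˡ ga≈1) (*-identityʳ _))) (trans (*-congˡ ga≈1) (*-identityʳ _)) ⟩
      z * g + y * b + c                        ∎

    -- The target is, up to the unit g₀₀, the (2,0) entry of the translated matrix. By `relation` it
    -- equals z₀ - z + σ y (y₀ - y), and z₀ - z is the difference of the trace-zero parts, z₀ +
    -- N(y₀) τ - d, minus (N(y₀) - N(y)) τ, where N(y) = y σ y.
    approximate-corner : ∀ {k y₀ z₀ y z d} → z + σ z + y * σ y ≈ 0# → z ≈ d - y * σ y * τ → y₀ ∈ 𝔒 → y ∈ 𝔒 →
      (y₀ - y) ∈ 𝔓^ k → (z₀ + y₀ * σ y₀ * τ - d) ∈ 𝔓^ k → (σ z + σ y * y₀ + z₀) ∈ 𝔓^ k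
    approximate-corner {k} {y₀} {z₀} {y} {z} {d} relation z≈ y₀∈ y∈ e∈ t∈ = 𝔓^-cong (begin
      (z₀ + y₀ * σ y₀ * τ - d) - ((y₀ - y) * σ y₀ + y * σ (y₀ - y)) * τ + σ y * (y₀ - y)
        ≈⟨ +-congʳ (+-congˡ (-‿cong (*-congʳ (+-congˡ (*-congˡ (σ-- y₀ y)))))) ⟩
      (z₀ + y₀ * σ y₀ * τ - d) - ((y₀ - y) * σ y₀ + y * (σ y₀ - σ y)) * τ + σ y * (y₀ - y)
        ≈⟨ solve 8 (λ z₀ y₀ y̅₀ y y̅ τ d z̅ →
             ((z₀ :+ y₀ :* y̅₀ :* τ) :- d) :- ((y₀ :- y) :* y̅₀ :+ y :* (y̅₀ :- y̅)) :* τ :+ y̅ :* (y₀ :- y)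
               := (z̅ :+ y̅ :* y₀ :+ z₀) :- ((d :- y :* y̅ :* τ) :+ z̅ :+ y :* y̅)) refl
             z₀ y₀ (σ y₀) y (σ y) τ d (σ z) ⟩
      (σ z + σ y * y₀ + z₀) - ((d - y * σ y * τ) + σ z + y * σ y)
        ≈⟨ +-congˡ (-‿cong (trans (+-congʳ (+-congʳ (sym z≈))) relation)) ⟩
      (σ z + σ y * y₀ + z₀) - 0#
        ≈⟨ solve 1 (λ x → x :- :0 := x) refl _ ⟩
      σ z + σ y * y₀ + z₀ ∎)
      (𝔓^-+ (𝔓^-- t∈ (𝔒-*ʳ (𝔓^-+ (𝔒-*ʳ e∈ (σ∈𝔓^ y₀∈)) (𝔒-*ˡ y∈ (σ∈𝔓^ e∈))) τ∈𝔒)) (𝔒-*ˡ (σ∈𝔓^ y∈) e∈))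

  module LowerStep {r s m : ℕ} (r≤s : r ℕ.≤ s) (m≤s : m ℕ.≤ s) where

    Index : Set
    Index = Fin F.q ∧ (Fin F.q ∧ Fin F.q)

    abstract
      -- Since `τ` has trace 1, `- y σ y τ` solves z + σ z = - y σ y exactly. The other solutions
      -- differ from it by trace-zero elements, whose digits are multiples of `δ`.
      y z : Index → Carrier
      y (i , j , k) = E-digit (+ s) i j
      z I@(i , j , k) = F-digit (+ s) k * δ - y I * σ (y I) * τ

      y≈ : ∀ i j k → y (i , j , k) ≈ E-digit (+ s) i j
      y≈ i j k = refl

      z≈ : ∀ i j k → z (i , j , k) ≈ F-digit (+ s) k * δ - y (i , j , k) * σ (y (i , j , k)) * τ
      z≈ i j k = refl

    private
      y∈ : ∀ I → y I ∈ 𝔓^ (+ s)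
      y∈ (i , j , k) = 𝔓^-cong (sym (y≈ i j k)) (E-digit∈ i j)

      y∈𝔒 : ∀ I → y I ∈ 𝔒
      y∈𝔒 I = 𝔓^-weaken (ℤ.+≤+ ℕ.z≤n) (y∈ I)

      σy∈ : ∀ I → σ (y I) ∈ 𝔓^ (+ s)
      σy∈ I = σ∈𝔓^ (y∈ I)

      z∈ : ∀ I → z I ∈ 𝔓^ (+ s)
      z∈ I@(i , j , k) = 𝔓^-cong (sym (z≈ i j k)) (𝔓^-- (𝔒-*ʳ (F-digit∈ k) δ∈𝔒) (𝔒-*ʳ (𝔒-*ˡ (y∈𝔒 I) (σy∈ I)) τ∈𝔒))

      relation : ∀ I → z I + σ (z I) + y I * σ (y I) ≈ 0#
      relation I@(i , j , k) = begin
        z I + σ (z I) + N                                        ≈⟨ +-congʳ (+-congˡ σz) ⟩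
        z I + (d * - δ - N * σ τ) + N                            ≈⟨ +-congʳ (+-congʳ (z≈ i j k)) ⟩
        (d * δ - N * τ) + (d * - δ - N * σ τ) + N                            ≈⟨ solve 5 (λ d δ n t u → (d :* δ :- n :* t) :+ (d :* (:- δ) :- n :* u) :+ n := n :* (:1 :- (t :+ u))) refl d δ N τ (σ τ) ⟩
        N * (1# - (τ + σ τ))                                     ≈⟨ *-congˡ (trans (+-congˡ (-‿cong τ+στ)) (-‿inverseʳ 1#)) ⟩
        N * 0#                                                   ≈⟨ zeroʳ N ⟩
        0#                                                       ∎
        where
        d N : Carrier
        d = F-digit (+ s) k
        N = y I * σ (y I)

        σN : σ N ≈ N
        σN = trans (σ-* (y I) (σ (y I))) (trans (*-congˡ (σ-involutive (y I))) (*-comm (σ (y I)) (y I)))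

        σz : σ (z I) ≈ d * - δ - N * σ τ
        σz = trans (σ-cong (z≈ i j k)) (trans (σ-- (d * δ) (N * τ)) (+-cong (trans (σ-* d δ) (*-cong (σF-digit k) σδ)) (-‿cong (trans (σ-* N τ) (*-congʳ σN)))))

    representative : Index → Unitary
    representative I = L (y I) (z I) (relation I)

    private
      module Action (I : Index) (g : Unitary) where

        A : M₃
        A = matrix g

        B : M₃
        B = matrix (representative I ⧵ g)

        B≋ : B ≋ lower (- y I) (- σ (y I)) (σ (z I)) · A
        B≋ = ≋-trans (matrix-⧵ (representative I) g) (·-cong {B = A} (inv-L (y I) (z I) (relation I)) ≋-refl)

        row₀ : ∀ j → B 0F j ≈ A 0F j
        row₀ j = trans (B≋ 0F j) (lower-row₀ A j (- y I) (- σ (y I)) (σ (z I)))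

        B₁₀ : B 1F 0F ≈ A 1F 0F - y I * A 0F 0F
        B₁₀ = trans (B≋ 1F 0F) (trans (lower-row₁ A 0F (- y I) (- σ (y I)) (σ (z I)))
          (solve 3 (λ y a b → (:- y) :* a :+ b := b :- y :* a) refl (y I) (A 0F 0F) (A 1F 0F)))

        B₂₀ : B 2F 0F ≈ σ (z I) * A 0F 0F + σ (y I) * A 1F 0F + A 2F 0F
        B₂₀ = trans (B≋ 2F 0F) (trans (lower-row₂ A 0F (- y I) (- σ (y I)) (σ (z I)))
          (solve 5 (λ y z a b c → z :* a :- (:- y) :* b :+ c := z :* a :+ y :* b :+ c) refl (σ (y I)) (σ (z I)) (A 0F 0F) (A 1F 0F) (A 2F 0F)))

      stable : ∀ I g h → matrix h ≋ matrix (representative I) · matrix g → g ∈ K r s m → h ∈ K r s m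
      stable I g h h≋ = lower-stable {r} {s} {m} {y I} {σ (y I)} {z I} {g} {h} r≤s m≤s (y∈ I) (σy∈ I) (z∈ I)
        (≋-trans h≋ (·-cong {B = matrix g} (matrix-L (y I) (z I) (relation I)) ≋-refl))

    contains : ∀ I → translate (representative I) (K r (suc s) m) ⊆ K r s m
    contains I {g} = translate⊆ {r} {suc s} {m} {r} {s} {m} (representative I) ℕₚ.≤-refl (ℕₚ.n≤1+n s) ℕₚ.≤-refl (stable I) {g}

    private
      module Cover {g : Unitary} (g∈ : g ∈ K r s m) (g₀₀-unit : Unit (matrix g 0F 0F)) where

        A : M₃
        A = matrix g

        a : Carrier
        a = proj₁ (unit-reciprocal g₀₀-unit)

        g₀₀a≈1 : A 0F 0F * a ≈ 1#
        g₀₀a≈1 = proj₁ (proj₂ (unit-reciprocal g₀₀-unit))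

        a∈𝔒 : a ∈ 𝔒
        a∈𝔒 = unit⇒𝔒 (proj₂ (proj₂ (unit-reciprocal g₀₀-unit)))

        -- Affine coordinates of the isotropic line spanned by the first column. Their classes
        -- modulo `𝔓^ (suc s)` determine the coset.
        y₀ z₀ : Carrier
        y₀ = A 1F 0F * a
        z₀ = A 2F 0F * a

        y₀∈ : y₀ ∈ 𝔓^ (+ s)
        y₀∈ = 𝔒-*ʳ (entry g∈ 1F 0F) a∈𝔒

        z₀∈ : z₀ ∈ 𝔓^ (+ s)
        z₀∈ = 𝔒-*ʳ (entry g∈ 2F 0F) a∈𝔒

        column-isotropic : z₀ + σ z₀ + y₀ * σ y₀ ≈ 0#
        column-isotropic = isotropic-normalised g₀₀a≈1 (unitary-relation g 0F 0F)

        y-digits : ∃₂ λ i j → (y₀ - E-digit (+ s) i j) ∈ 𝔓^ (+ suc s)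
        y-digits = E-digit-of y₀∈

        -- `t` is `z₀` minus the particular solution `- N₀ τ`, hence exactly of trace zero, so its
        -- digit is a multiple of `δ`.
        N₀ t : Carrier
        N₀ = y₀ * σ y₀
        t = z₀ + N₀ * τ

        t∈ : t ∈ 𝔓^ (+ s)
        t∈ = 𝔓^-+ z₀∈ (𝔒-*ʳ (𝔒-*ˡ (𝔓^-weaken (ℤ.+≤+ ℕ.z≤n) y₀∈) (σ∈𝔓^ y₀∈)) τ∈𝔒)

        t+σt≈0 : t + σ t ≈ 0#
        t+σt≈0 = begin
          t + σ t                                   ≈⟨ +-congˡ (trans (σ-+ z₀ (N₀ * τ)) (+-congˡ (trans (σ-* N₀ τ) (*-congʳ σN₀)))) ⟩
          (z₀ + N₀ * τ) + (σ z₀ + N₀ * σ τ)         ≈⟨ solve 5 (λ z z̅ n t u → (z :+ n :* t) :+ (z̅ :+ n :* u) := (z :+ z̅) :+ n :* (t :+ u)) refl z₀ (σ z₀) N₀ τ (σ τ) ⟩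
          (z₀ + σ z₀) + N₀ * (τ + σ τ)              ≈⟨ +-congˡ (trans (*-congˡ τ+στ) (*-identityʳ N₀)) ⟩
          z₀ + σ z₀ + N₀                            ≈⟨ column-isotropic ⟩
          0#                                        ∎
          where
          σN₀ : σ N₀ ≈ N₀
          σN₀ = trans (σ-* y₀ (σ y₀)) (trans (*-congˡ (σ-involutive y₀)) (*-comm (σ y₀) y₀))

        z-digit : ∃[ k ] (t - F-digit (+ s) k * δ) ∈ 𝔓^ (+ suc s)
        z-digit = traceless-digit-of t∈ (≈0⇒∈𝔓^ t+σt≈0)

        I : Index
        I = proj₁ y-digits , proj₁ (proj₂ y-digits) , proj₁ z-digit

        e : Carrier
        e = y₀ - y I

        e∈ : e ∈ 𝔓^ (+ suc s)
        e∈ = 𝔓^-cong (+-congˡ (-‿cong (sym (y≈ _ _ (proj₁ z-digit))))) (proj₂ (proj₂ y-digits))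

        open Action I g using (B; B₁₀; B₂₀)

        B₁₀∈ : B 1F 0F ∈ 𝔓^ (+ suc s)
        B₁₀∈ = 𝔓^-cong (begin
          A 0F 0F * e                                   ≈⟨ solve 4 (λ g b a y → g :* (b :* a :- y) := b :* (g :* a) :- y :* g) refl (A 0F 0F) (A 1F 0F) a (y I) ⟩
          A 1F 0F * (A 0F 0F * a) - y I * A 0F 0F       ≈⟨ +-congʳ (trans (*-congˡ g₀₀a≈1) (*-identityʳ _)) ⟩
          A 1F 0F - y I * A 0F 0F                       ≈⟨ B₁₀ ⟨
          B 1F 0F                                       ∎)
          (𝔒-*ˡ (unit⇒𝔒 g₀₀-unit) e∈)

        B₂₀∈ : B 2F 0F ∈ 𝔓^ (+ suc s)
        B₂₀∈ = 𝔓^-cong (trans (clear-denominator g₀₀a≈1 (σ (z I)) (σ (y I)) (A 1F 0F) (A 2F 0F)) (sym B₂₀))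
          (𝔒-*ˡ (unit⇒𝔒 g₀₀-unit) (approximate-corner {+ suc s} {y₀} {z₀} {y I} {z I} (relation I) (z≈ _ _ (proj₁ z-digit))
            (𝔓^-weaken (ℤ.+≤+ ℕ.z≤n) y₀∈) (y∈𝔒 I) e∈ (proj₂ z-digit)))

        x⁻¹g : Unitary
        x⁻¹g = representative I ⧵ g

        x⁻¹g∈K : K r s m x⁻¹g
        x⁻¹g∈K = lower-stable {r} {s} {m} { - y I} { - σ (y I)} {σ (z I)} {g} {x⁻¹g} r≤s m≤s
          (𝔓^-neg (y∈ I)) (𝔓^-neg (σy∈ I)) (σ∈𝔓^ (z∈ I)) (Action.B≋ I g) g∈

        x⁻¹g∈K′ : K r (suc s) m x⁻¹g
        x⁻¹g∈K′ = K-refine-lower {r} {s} {m} {x⁻¹g} r≤s x⁻¹g∈K B₁₀∈ B₂₀∈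

    -- For `r < s` the unit condition holds on all of `K r s m`; for `r = s` it cuts out the big
    -- cell.
    covers : ∀ {g} → g ∈ K r s m → Unit (matrix g 0F 0F) → ∃[ I ] g ∈ translate (representative I) (K r (suc s) m)
    covers {g} g∈ g₀₀-unit = Cover.I {g} g∈ g₀₀-unit ,
      to-translate {r} {suc s} {m} (representative (Cover.I {g} g∈ g₀₀-unit)) g (Cover.x⁻¹g∈K′ {g} g∈ g₀₀-unit)

    private
      member : ∀ I g → g ∈ translate (representative I) (K r (suc s) m) → K r (suc s) m (representative I ⧵ g)
      member I g = from-translate {r} {suc s} {m} (representative I) g

    g₀₀-unit : ∀ I g → g ∈ translate (representative I) (K r (suc s) m) → Unit (matrix g 0F 0F)
    g₀₀-unit I g p = unit-cong (Action.row₀ I g 0F) (proj₁ (corner-units {r} {suc s} {m} {representative I ⧵ g} (member I g p)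
      (𝔓^-weaken (ℤ.+≤+ (ℕ.s≤s ℕ.z≤n)) (entry (member I g p) 1F 0F)) (𝔓^-weaken (ℤ.+≤+ (ℕ.s≤s r≤s)) (entry (member I g p) 2F 0F))))

    -- The (1,0) entries of the two translated matrices differ by (y - y′) g₀₀, which identifies the
    -- digits of `y`. Once these agree, the (2,0) entries differ by σ (z - z′) g₀₀, which identifies
    -- the last digit.
    disjoint : ∀ {I I′ g} → g ∈ translate (representative I) (K r (suc s) m) →
               g ∈ translate (representative I′) (K r (suc s) m) → I ≡ I′
    disjoint {I@(i , j , k)} {I′@(i′ , j′ , k′)} {g} p p′ = combine (E-digit-unique y~y′)
      where
      A : M₃
      A = matrix g

      u : Unit (A 0F 0F)
      u = g₀₀-unit I g p

      y~y′ : (E-digit (+ s) i j - E-digit (+ s) i′ j′) ∈ 𝔓^ (+ suc s)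
      y~y′ = 𝔓^-cong (+-cong (y≈ i j k) (-‿cong (y≈ i′ j′ k′))) (unit-cancelʳ u (𝔓^-cong
        (solve 4 (λ y y′ a b → (b :- y′ :* a) :- (b :- y :* a) := (y :- y′) :* a) refl (y I) (y I′) (A 0F 0F) (A 1F 0F))
        (𝔓^-- (𝔓^-cong (Action.B₁₀ I′ g) (entry (member I′ g p′) 1F 0F)) (𝔓^-cong (Action.B₁₀ I g) (entry (member I g p) 1F 0F)))))

      same-y : i ≡ i′ → j ≡ j′ → y I ≈ y I′
      same-y ≡.refl ≡.refl = trans (y≈ i j k) (sym (y≈ i j k′))

      z~z′ : y I ≈ y I′ → (z I - z I′) ∈ 𝔓^ (+ suc s)
      z~z′ y≈y′ = σ⁻¹∈𝔓^ (𝔓^-cong (sym (σ-- (z I) (z I′))) (unit-cancelʳ u (𝔓^-cong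
        (solve 4 (λ z z′ a b → (z :* a :+ b) :- (z′ :* a :+ b) := (z :- z′) :* a) refl (σ (z I)) (σ (z I′)) (A 0F 0F) (σ (y I) * A 1F 0F + A 2F 0F))
        (𝔓^-- (𝔓^-cong (trans (Action.B₂₀ I g) (+-assoc _ _ _)) (entry (member I g p) 2F 0F))
              (𝔓^-cong (trans (Action.B₂₀ I′ g) (trans (+-assoc _ _ _) (+-congˡ (+-congʳ (*-congʳ (σ-cong (sym y≈y′))))))) (entry (member I′ g p′) 2F 0F))))))

      k≡k′ : y I ≈ y I′ → k ≡ k′
      k≡k′ y≈y′ = traceless-digit-unique (𝔓^-cong
        (trans (+-cong (z≈ i j k) (-‿cong (trans (z≈ i′ j′ k′) (+-congˡ (-‿cong (*-congʳ (*-cong (sym y≈y′) (σ-cong (sym y≈y′)))))))))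
          (solve 3 (λ x x′ n → (x :- n) :- (x′ :- n) := x :- x′) refl (F-digit (+ s) k * δ) (F-digit (+ s) k′ * δ) (y I * σ (y I) * τ)))
        (z~z′ y≈y′))

      combine : i ≡ i′ ∧ j ≡ j′ → I ≡ I′
      combine (i≡i′ , j≡j′) = ≡.cong₂ _,_ i≡i′ (≡.cong₂ _,_ j≡j′ (k≡k′ (same-y i≡i′ j≡j′)))

  lower-transversal : ∀ {r s m} (r<s : r ℕ.< s) (m≤s : m ℕ.≤ s) →
    LowerStep.representative {r} {s} {m} (ℕₚ.<⇒≤ r<s) m≤s IsTransversal K r s m / K r (suc s) m
  lower-transversal {r} {s} {m} r<s m≤s = record
    { contains = λ I {g} → contains I {g}
    ; covers   = λ {g} g∈ → covers {g} g∈ (proj₁ (corner-units {r} {s} {m} {g} g∈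
        (𝔓^-weaken (ℤ.+≤+ (ℕₚ.≤-trans (ℕ.s≤s ℕ.z≤n) r<s)) (entry g∈ 1F 0F))
        (𝔓^-weaken (ℤ.+≤+ r<s) (entry g∈ 2F 0F))))
    ; disjoint = λ {I} {I′} {g} → disjoint {I} {I′} {g}
    }
    where open LowerStep {r} {s} {m} (ℕₚ.<⇒≤ r<s) m≤s

  module UpperStep {k s m : ℕ} (k<s : k ℕ.< s) where

    private
      κ : ℤ
      κ = ℤ.- (+ suc k)

      suc[κ]≡-k : ℤ.suc κ ≡ ℤ.- (+ k)
      suc[κ]≡-k = lemma k
        where
        lemma : ∀ k → ℤ.suc -[1+ k ] ≡ ℤ.- (+ k)
        lemma zero    = ≡.refl
        lemma (suc k) = ≡.refl

      suc[κ]⇒-k : ∀ {x} → x ∈ 𝔓^ (ℤ.suc κ) → x ∈ 𝔓^ (ℤ.- (+ k))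
      suc[κ]⇒-k {x} = ≡.subst (λ l → x ∈ 𝔓^ l) suc[κ]≡-k

      -k⇒suc[κ] : ∀ {x} → x ∈ 𝔓^ (ℤ.- (+ k)) → x ∈ 𝔓^ (ℤ.suc κ)
      -k⇒suc[κ] {x} = ≡.subst (λ l → x ∈ 𝔓^ l) (≡.sym suc[κ]≡-k)

    abstract
      w : Fin F.q → Carrier
      w i = F-digit κ i * δ

      w≈ : ∀ i → w i ≈ F-digit κ i * δ
      w≈ i = refl

    private
      w∈ : ∀ i → w i ∈ 𝔓^ κ
      w∈ i = 𝔓^-cong (sym (w≈ i)) (𝔒-*ʳ (F-digit∈ i) δ∈𝔒)

      relation : ∀ i → w i + σ (w i) ≈ 0#
      relation i = begin
        w i + σ (w i)                        ≈⟨ +-cong (w≈ i) (trans (σ-cong (w≈ i)) (trans (σ-* _ δ) (*-cong (σF-digit i) σδ))) ⟩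
        F-digit κ i * δ + F-digit κ i * - δ  ≈⟨ solve 2 (λ d δ → d :* δ :+ d :* (:- δ) := :0) refl (F-digit κ i) δ ⟩
        0#                                   ∎

    representative : Fin F.q → Unitary
    representative i = X (w i) (relation i)

    private
      module Action (i : Fin F.q) (g : Unitary) where

        A : M₃
        A = matrix g

        x⁻¹g : Unitary
        x⁻¹g = representative i ⧵ g

        B : M₃
        B = matrix x⁻¹g

        B≋ : B ≋ upper (- w i) · A
        B≋ = ≋-trans (matrix-⧵ (representative i) g) (·-cong {B = A} (inv-X (w i) (relation i)) ≋-refl)

        B₀₂ : B 0F 2F ≈ A 0F 2F - w i * A 2F 2F
        B₀₂ = trans (B≋ 0F 2F) (trans (upper-row₀ A 2F (- w i))
          (solve 3 (λ a w c → a :+ (:- w) :* c := a :- w :* c) refl (A 0F 2F) (w i) (A 2F 2F)))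

        B₂₂ : B 2F 2F ≈ A 2F 2F
        B₂₂ = trans (B≋ 2F 2F) (upper-row₂ A 2F (- w i))

      stable : ∀ i g h → matrix h ≋ matrix (representative i) · matrix g → g ∈ K (suc k) s m → h ∈ K (suc k) s m
      stable i g h h≋ = upper-stable {suc k} {s} {m} {w i} {g} {h} k<s (w∈ i)
        (≋-trans h≋ (·-cong {B = matrix g} (matrix-X (w i) (relation i)) ≋-refl))

    contains : ∀ i → translate (representative i) (K k s m) ⊆ K (suc k) s m
    contains i {g} = translate⊆ {k} {s} {m} {suc k} {s} {m} (representative i) (ℕₚ.n≤1+n k) ℕₚ.≤-refl ℕₚ.≤-refl (stable i) {g}

    private
      module Cover {g : Unitary} (g∈ : g ∈ K (suc k) s m) (g₂₂-unit : Unit (matrix g 2F 2F)) where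

        A : M₃
        A = matrix g

        a : Carrier
        a = proj₁ (unit-reciprocal g₂₂-unit)

        g₂₂a≈1 : A 2F 2F * a ≈ 1#
        g₂₂a≈1 = proj₁ (proj₂ (unit-reciprocal g₂₂-unit))

        a∈𝔒 : a ∈ 𝔒
        a∈𝔒 = unit⇒𝔒 (proj₂ (proj₂ (unit-reciprocal g₂₂-unit)))

        w₀ x₀ : Carrier
        w₀ = A 0F 2F * a
        x₀ = A 1F 2F * a

        -- The last column is read from bottom to top, so that g₂₂ plays the part of the leading
        -- entry.
        isotropic : w₀ + σ w₀ + x₀ * σ x₀ ≈ 0#
        isotropic = isotropic-normalised g₂₂a≈1 (trans
          (solve 3 (λ x y z → x :+ (y :+ z) := z :+ (y :+ x)) refl (σ (A 2F 2F) * A 0F 2F) (σ (A 1F 2F) * A 1F 2F) (σ (A 0F 2F) * A 2F 2F))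
          (unitary-relation g 2F 2F))

        x₀∈𝔒 : x₀ ∈ 𝔒
        x₀∈𝔒 = 𝔒-*ˡ (entry g∈ 1F 2F) a∈𝔒

        -- Isotropy of the last column makes the trace of `w₀` equal to `- x₀ σ x₀`, which is
        -- integral and so lies in `𝔓^ (- k)`: `w₀` has trace zero to the precision of one digit.
        trace∈ : (w₀ + σ w₀) ∈ 𝔓^ (ℤ.suc κ)
        trace∈ = -k⇒suc[κ] (𝔓^-weaken (ℤₚ.neg-mono-≤ (ℤ.+≤+ (ℕ.z≤n {k}))) (𝔓^-cong
          (trans (+-congʳ (sym isotropic)) (solve 2 (λ x n → (x :+ n) :- n := x) refl (w₀ + σ w₀) (x₀ * σ x₀)))
          (𝔓^-- 0∈𝔓^ (𝔒-*ˡ x₀∈𝔒 (σ∈𝔓^ x₀∈𝔒)))))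

        digit : ∃[ i ] (w₀ - F-digit κ i * δ) ∈ 𝔓^ (ℤ.suc κ)
        digit = traceless-digit-of (𝔒-*ʳ (entry g∈ 0F 2F) a∈𝔒) trace∈

        i : Fin F.q
        i = proj₁ digit

        open Action i g using (x⁻¹g; B; B≋; B₀₂)

        B₀₂∈ : B 0F 2F ∈ 𝔓^ (ℤ.- (+ k))
        B₀₂∈ = 𝔓^-cong (begin
          A 2F 2F * (w₀ - F-digit κ i * δ)              ≈⟨ *-congˡ (+-congˡ (-‿cong (w≈ i))) ⟨
          A 2F 2F * (w₀ - w i)                          ≈⟨ solve 4 (λ c b a w → c :* (b :* a :- w) := b :* (c :* a) :- w :* c) refl (A 2F 2F) (A 0F 2F) a (w i) ⟩
          A 0F 2F * (A 2F 2F * a) - w i * A 2F 2F       ≈⟨ +-congʳ (trans (*-congˡ g₂₂a≈1) (*-identityʳ _)) ⟩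
          A 0F 2F - w i * A 2F 2F                       ≈⟨ B₀₂ ⟨
          B 0F 2F                                       ∎)
          (suc[κ]⇒-k (𝔒-*ˡ (unit⇒𝔒 g₂₂-unit) (proj₂ digit)))

        x⁻¹g∈K : K (suc k) s m x⁻¹g
        x⁻¹g∈K = upper-stable {suc k} {s} {m} { - w i} {g} {x⁻¹g} k<s (𝔓^-neg (w∈ i)) B≋ g∈

        x⁻¹g∈K′ : K k s m x⁻¹g
        x⁻¹g∈K′ = K-refine-upper {suc k} {k} {s} {m} {x⁻¹g} x⁻¹g∈K B₀₂∈

    covers : ∀ {g} → g ∈ K (suc k) s m → Unit (matrix g 2F 2F) → ∃[ i ] g ∈ translate (representative i) (K k s m)
    covers {g} g∈ g₂₂-unit = Cover.i {g} g∈ g₂₂-unit ,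
      to-translate {k} {s} {m} (representative (Cover.i {g} g∈ g₂₂-unit)) g (Cover.x⁻¹g∈K′ {g} g∈ g₂₂-unit)

    private
      member : ∀ i g → g ∈ translate (representative i) (K k s m) → K k s m (representative i ⧵ g)
      member i g = from-translate {k} {s} {m} (representative i) g

    g₂₂-unit : ∀ i g → g ∈ translate (representative i) (K k s m) → Unit (matrix g 2F 2F)
    g₂₂-unit i g p = unit-cong (Action.B₂₂ i g) (proj₂ (corner-units {k} {s} {m} {representative i ⧵ g} (member i g p)
      (𝔓^-weaken (ℤ.+≤+ (ℕₚ.≤-trans (ℕ.s≤s ℕ.z≤n) k<s)) (entry (member i g p) 1F 0F)) (𝔓^-weaken (ℤ.+≤+ k<s) (entry (member i g p) 2F 0F))))

    disjoint : ∀ {i j g} → g ∈ translate (representative i) (K k s m) →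
               g ∈ translate (representative j) (K k s m) → i ≡ j
    disjoint {i} {j} {g} p q = traceless-digit-unique (𝔓^-cong (+-cong (w≈ i) (-‿cong (w≈ j))) (-k⇒suc[κ]
      (unit-cancelʳ (g₂₂-unit i g p) (𝔓^-cong
        (solve 4 (λ w w′ a c → (a :- w′ :* c) :- (a :- w :* c) := (w :- w′) :* c) refl (w i) (w j) (matrix g 0F 2F) (matrix g 2F 2F))
        (𝔓^-- (𝔓^-cong (Action.B₀₂ j g) (entry (member j g q) 0F 2F)) (𝔓^-cong (Action.B₀₂ i g) (entry (member i g p) 0F 2F)))))))

  upper-transversal : ∀ {k s m} (k+1<s : suc k ℕ.< s) →
    UpperStep.representative {k} {s} {m} (ℕₚ.<⇒≤ k+1<s) IsTransversal K (suc k) s m / K k s m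
  upper-transversal {k} {s} {m} k+1<s = record
    { contains = λ i {g} → contains i {g}
    ; covers   = λ {g} g∈ → covers {g} g∈ (proj₂ (corner-units {suc k} {s} {m} {g} g∈
        (𝔓^-weaken (ℤ.+≤+ (ℕₚ.≤-trans (ℕ.s≤s ℕ.z≤n) k+1<s)) (entry g∈ 1F 0F))
        (𝔓^-weaken (ℤ.+≤+ k+1<s) (entry g∈ 2F 0F))))
    ; disjoint = λ {i} {j} {g} → disjoint {i} {j} {g}
    }
    where open UpperStep {k} {s} {m} (ℕₚ.<⇒≤ k+1<s)

  module DiagonalStep {r s m : ℕ} {I : Set} (m<s : m ℕ.< s) (system : NormOneSystem m I) where

    open NormOneSystem system

    private
      abstract
        β : I → Carrier
        β i = proj₁ (unit-reciprocal (α-unit i))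

        αβ≈1 : ∀ i → α i * β i ≈ 1#
        αβ≈1 i = proj₁ (proj₂ (unit-reciprocal (α-unit i)))

        β-unit : ∀ i → Unit (β i)
        β-unit i = proj₂ (proj₂ (unit-reciprocal (α-unit i)))

      σασβ≈1 : ∀ i → σ (α i) * σ (β i) ≈ 1#
      σασβ≈1 i = trans (sym (σ-* (α i) (β i))) (trans (σ-cong (αβ≈1 i)) σ-1)

      u u̅ : I → Carrier
      u i = α i * σ (β i)
      u̅ i = σ (α i) * β i

      σu : ∀ i → σ (u i) ≈ u̅ i
      σu i = trans (σ-* (α i) (σ (β i))) (*-congˡ (σ-involutive (β i)))

      uu̅≈1 : ∀ i → u i * u̅ i ≈ 1#
      uu̅≈1 i = begin
        u i * u̅ i                                    ≈⟨ solve 4 (λ a b a̅ b̅ → (a :* b̅) :* (a̅ :* b) := (a :* b) :* (a̅ :* b̅)) refl (α i) (β i) (σ (α i)) (σ (β i)) ⟩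
        (α i * β i) * (σ (α i) * σ (β i))            ≈⟨ *-cong (αβ≈1 i) (σασβ≈1 i) ⟩
        1# * 1#                                      ≈⟨ *-identityˡ 1# ⟩
        1#                                           ∎

      β∈𝔒 : ∀ i → β i ∈ 𝔒
      β∈𝔒 i = unit⇒𝔒 (β-unit i)

      u∈𝔒 : ∀ i → u i ∈ 𝔒
      u∈𝔒 i = 𝔒-*ˡ (unit⇒𝔒 (α-unit i)) (σ∈𝔓^ (β∈𝔒 i))

      u̅∈𝔒 : ∀ i → u̅ i ∈ 𝔒
      u̅∈𝔒 i = 𝔒-*ˡ (σ∈𝔓^ (unit⇒𝔒 (α-unit i))) (β∈𝔒 i)

      u~1 : ∀ i → (u i - 1#) ∈ 𝔓^ (+ m)
      u~1 i = 𝔓^-cong (trans (solve 3 (λ a a̅ b̅ → (a :- a̅) :* b̅ := a :* b̅ :- a̅ :* b̅) refl (α i) (σ (α i)) (σ (β i)))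
          (+-congˡ (-‿cong (σασβ≈1 i))))
        (𝔒-*ʳ (α~σα i) (σ∈𝔓^ (β∈𝔒 i)))

      u̅~1 : ∀ i → (u̅ i - 1#) ∈ 𝔓^ (+ m)
      u̅~1 i = 𝔓^-cong (trans (solve 3 (λ a a̅ b → (:- (a :- a̅)) :* b := a̅ :* b :- a :* b) refl (α i) (σ (α i)) (β i))
          (+-congˡ (-‿cong (αβ≈1 i))))
        (𝔒-*ʳ (𝔓^-neg (α~σα i)) (β∈𝔒 i))

    representative : I → Unitary
    representative i = D (u i) (u̅ i) (σu i) (uu̅≈1 i)

    private
      module Action (i : I) (g : Unitary) where

        A : M₃
        A = matrix g

        x⁻¹g : Unitary
        x⁻¹g = representative i ⧵ g

        B : M₃
        B = matrix x⁻¹g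

        B≋ : B ≋ diagonal (u̅ i) · A
        B≋ = ≋-trans (matrix-⧵ (representative i) g) (·-cong {B = A} (inv-D (u i) (u̅ i) (σu i) (uu̅≈1 i)) ≋-refl)

        B₁₁ : B 1F 1F ≈ u̅ i * A 1F 1F
        B₁₁ = trans (B≋ 1F 1F) (diagonal-row₁ A 1F (u̅ i))

        β-scaled : β i * (A 1F 1F * σ (α i) - α i) ≈ B 1F 1F - 1#
        β-scaled = begin
          β i * (A 1F 1F * σ (α i) - α i)             ≈⟨ solve 4 (λ b w a̅ a → b :* (w :* a̅ :- a) := (a̅ :* b) :* w :- a :* b) refl (β i) (A 1F 1F) (σ (α i)) (α i) ⟩
          u̅ i * A 1F 1F - α i * β i                   ≈⟨ +-cong (sym B₁₁) (-‿cong (αβ≈1 i)) ⟩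
          B 1F 1F - 1#                                ∎

      stable : ∀ i g h → matrix h ≋ matrix (representative i) · matrix g → g ∈ K r s m → h ∈ K r s m
      stable i g h h≋ = diagonal-stable {r} {s} {m} {u i} {g} {h} (u∈𝔒 i) (u~1 i)
        (≋-trans h≋ (·-cong {B = matrix g} (matrix-D (u i) (u̅ i) (σu i) (uu̅≈1 i)) ≋-refl))

    transversal : representative IsTransversal K r s m / K r s (suc m)
    transversal = record
      { contains = λ i {g} → translate⊆ {r} {s} {suc m} {r} {s} {m} (representative i) ℕₚ.≤-refl ℕₚ.≤-refl (ℕₚ.n≤1+n m) (stable i) {g}
      ; covers   = λ {g} → covers {g}
      ; disjoint = λ {i} {j} {g} → disjoint {i} {j} {g}
      }
      where
      covers : ∀ {g} → g ∈ K r s m → ∃[ i ] g ∈ translate (representative i) (K r s (suc m))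
      covers {g} g∈ = i , to-translate {r} {s} {suc m} (representative i) g (K-intro refined)
        where
        A : M₃
        A = matrix g

        -- The middle column has Hermitian square 1, and its outer terms contain g₂₁ or its
        -- conjugate, which lie in `𝔓^ s`. Here `m < s` gives the precision `suc m`.
        norm : (A 1F 1F * σ (A 1F 1F) - 1#) ∈ 𝔓^ (+ suc m)
        norm = 𝔓^-cong
          (trans (solve 4 (λ x w w̅ y → :- (x :+ y) := w :* w̅ :- (x :+ (w̅ :* w :+ y))) refl (σ (A 0F 1F) * A 2F 1F) (A 1F 1F) (σ (A 1F 1F)) (σ (A 2F 1F) * A 0F 1F))
                 (+-congˡ (-‿cong (unitary-relation g 1F 1F))))
          (𝔓^-neg (𝔓^-weaken (ℤ.+≤+ m<s) (𝔓^-+ (𝔒-*ˡ (σ∈𝔓^ (entry g∈ 0F 1F)) (entry g∈ 2F 1F))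
                                               (𝔒-*ʳ (σ∈𝔓^ (entry g∈ 2F 1F)) (entry g∈ 0F 1F)))))

        found : ∃[ i ] (A 1F 1F * σ (α i) - α i) ∈ 𝔓^ (+ suc m)
        found = α-covers (entry g∈ 1F 1F) norm

        i : I
        i = proj₁ found

        open Action i g using (x⁻¹g; B; B≋; β-scaled)

        x⁻¹g∈K : K r s m x⁻¹g
        x⁻¹g∈K = diagonal-stable {r} {s} {m} {u̅ i} {g} {x⁻¹g} (u̅∈𝔒 i) (u̅~1 i) B≋ g∈

        refined : ∀ i j → B i j ∈ K-entry r s (suc m) i j
        refined 0F 0F = entry x⁻¹g∈K 0F 0F
        refined 0F 1F = entry x⁻¹g∈K 0F 1F
        refined 0F 2F = entry x⁻¹g∈K 0F 2F
        refined 1F 0F = entry x⁻¹g∈K 1F 0F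
        refined 1F 1F = 𝔓^-cong β-scaled (𝔒-*ˡ (β∈𝔒 i) (proj₂ found))
        refined 1F 2F = entry x⁻¹g∈K 1F 2F
        refined 2F 0F = entry x⁻¹g∈K 2F 0F
        refined 2F 1F = entry x⁻¹g∈K 2F 1F
        refined 2F 2F = entry x⁻¹g∈K 2F 2F

      disjoint : ∀ {i j g} → g ∈ translate (representative i) (K r s (suc m)) →
                 g ∈ translate (representative j) (K r s (suc m)) → i ≡ j
      -- Eliminates g₁₁ between the congruences g₁₁ σ α ≡ α for `i` and for `j`.
      disjoint {i} {j} {g} p q = α-unique (𝔓^-cong
          (solve 5 (λ w a b a̅ b̅ → (w :* b̅ :- b) :* a̅ :- (w :* a̅ :- a) :* b̅ := a :* b̅ :- a̅ :* b) refl
            (matrix g 1F 1F) (α i) (α j) (σ (α i)) (σ (α j)))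
          (𝔓^-- (𝔒-*ʳ (close j q) (σα∈𝔒 i)) (𝔒-*ʳ (close i p) (σα∈𝔒 j))))
        where
        σα∈𝔒 : ∀ i → σ (α i) ∈ 𝔒
        σα∈𝔒 i = σ∈𝔓^ (unit⇒𝔒 (α-unit i))

        close : ∀ i → g ∈ translate (representative i) (K r s (suc m)) → (matrix g 1F 1F * σ (α i) - α i) ∈ 𝔓^ (+ suc m)
        close i p = unit-cancelˡ (β-unit i) (𝔓^-cong (sym (Action.β-scaled i g))
          (entry (from-translate {r} {s} {suc m} (representative i) g p) 1F 1F))

  module Swap (n : ℕ) where

    private
      ϖ : ∃[ a ] F.v a ≡ [ ℤ.- (+ n) ]
      ϖ = F.v-normalised (ℤ.- (+ n))

      ϖ⁻¹ : ∃[ a⁻¹ ] (proj₁ ϖ F.* a⁻¹ F.≈ F.1# ∧ F.v a⁻¹ ≡ [ ℤ.- (ℤ.- (+ n)) ])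
      ϖ⁻¹ = F.reciprocal (proj₂ ϖ)

    abstract
      p p⁻¹ : Carrier
      p = ι (proj₁ ϖ)
      p⁻¹ = ι (proj₁ ϖ⁻¹)

      vp : v p ≡ [ ℤ.- (+ n) ]
      vp = v-ι (proj₂ ϖ)

      vp⁻¹ : v p⁻¹ ≡ [ + n ]
      vp⁻¹ = v-ι (≡.trans (proj₂ (proj₂ ϖ⁻¹)) (≡.cong [_] (ℤₚ.neg-involutive (+ n))))

      swap : Unitary
      swap = T p p⁻¹ (σ-fixes (proj₁ ϖ)) (σ-fixes (proj₁ ϖ⁻¹))
        (trans (sym (ι-* (proj₁ ϖ) (proj₁ ϖ⁻¹))) (trans (ι-cong (proj₁ (proj₂ ϖ⁻¹))) ι-1))

      matrix-swap : matrix swap ≋ antidiagonal p p⁻¹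
      matrix-swap = matrix-T p p⁻¹ _ _ _

      inv-swap : inv swap ≋ antidiagonal p p⁻¹
      inv-swap = inv-T p p⁻¹ _ _ _

    p∈ : p ∈ 𝔓^ (ℤ.- (+ n))
    p∈ = v≡⇒∈𝔓^ vp

    p⁻¹∈ : p⁻¹ ∈ 𝔓^ (+ n)
    p⁻¹∈ = v≡⇒∈𝔓^ vp⁻¹

    swap⁻¹-matrix : ∀ g → matrix (swap ⧵ g) ≋ antidiagonal p p⁻¹ · matrix g
    swap⁻¹-matrix g = ≋-trans (matrix-⧵ swap g) (·-cong {B = matrix g} inv-swap ≋-refl)

    swap⁻¹∈ : ∀ g → g ∈ K n n n → K n n n (swap ⧵ g)
    swap⁻¹∈ g g∈ = antidiagonal-stable {n} {p} {p⁻¹} {g} {swap ⧵ g} p∈ p⁻¹∈ (swap⁻¹-matrix g) g∈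

    swap-stable : ∀ g h → matrix h ≋ matrix swap · matrix g → g ∈ K n n n → h ∈ K n n n
    swap-stable g h h≋ g∈ = antidiagonal-stable {n} {p} {p⁻¹} {g} {h} p∈ p⁻¹∈
      (≋-trans h≋ (·-cong {B = matrix g} matrix-swap ≋-refl)) g∈

    swap⁻¹-row₀ : ∀ g j → matrix (swap ⧵ g) 0F j ≈ p * matrix g 2F j
    swap⁻¹-row₀ g j = trans (swap⁻¹-matrix g 0F j) (antidiagonal-row₀ (matrix g) j p p⁻¹)

    swap⁻¹-row₁ : ∀ g j → matrix (swap ⧵ g) 1F j ≈ matrix g 1F j
    swap⁻¹-row₁ g j = trans (swap⁻¹-matrix g 1F j) (antidiagonal-row₁ (matrix g) j p p⁻¹)

    swap⁻¹-row₂ : ∀ g j → matrix (swap ⧵ g) 2F j ≈ p⁻¹ * matrix g 0F j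
    swap⁻¹-row₂ g j = trans (swap⁻¹-matrix g 2F j) (antidiagonal-row₂ (matrix g) j p p⁻¹)

  module UpperBigCell (k : ℕ) where

    private
      -k-1+1 : ∀ k → ℤ.- (+ 1 ℤ.+ k) ℤ.+ + 1 ≡ ℤ.- k
      -k-1+1 = ℤ-RingSolver.solve-∀

      contains-swap : translate (Swap.swap (suc k)) (K k (suc k) (suc k)) ⊆ K (suc k) (suc k) (suc k)
      contains-swap {g} = translate⊆ {k} {suc k} {suc k} {suc k} {suc k} {suc k} (Swap.swap (suc k)) (ℕₚ.n≤1+n k) ℕₚ.≤-refl ℕₚ.≤-refl (Swap.swap-stable (suc k)) {g}

      point : ∀ g → g ∈ K (suc k) (suc k) (suc k) → matrix g 2F 2F ∈ 𝔓 → g ∈ translate (Swap.swap (suc k)) (K k (suc k) (suc k))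
      point g g∈ g₂₂∈𝔓 = to-translate {k} {suc k} {suc k} (Swap.swap (suc k)) g
        (K-refine-upper {suc k} {k} {suc k} {suc k} {Swap.swap (suc k) ⧵ g} (Swap.swap⁻¹∈ (suc k) g g∈) (𝔓^-cong (sym (Swap.swap⁻¹-row₀ (suc k) g 2F))
          (𝔓^-*≤ (ℤₚ.≤-reflexive (≡.sym (-k-1+1 (+ k)))) (Swap.p∈ (suc k)) g₂₂∈𝔓)))

      swap⇒g₂₂∈𝔓 : ∀ g → g ∈ translate (Swap.swap (suc k)) (K k (suc k) (suc k)) → matrix g 2F 2F ∈ 𝔓
      swap⇒g₂₂∈𝔓 g g∈ = 𝔓^-cancelˡ (Swap.vp (suc k)) (𝔓^-weaken (ℤₚ.≤-reflexive (-k-1+1 (+ k)))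
        (𝔓^-cong (Swap.swap⁻¹-row₀ (suc k) g 2F) (entry (from-translate {k} {suc k} {suc k} (Swap.swap (suc k)) g g∈) 0F 2F)))

    -- The two cells are told apart by whether g₂₂ is a unit. If it lies in `𝔓`, multiplication by
    -- `p`, of valuation -(k+1), brings it into `𝔓^ (- k)`, so `g` lies in the coset of the Weyl
    -- element.
    transversal : [ (λ (_ : ⊤) → Swap.swap (suc k)) , UpperStep.representative {k} {suc k} {suc k} ℕₚ.≤-refl ]′
      IsTransversal K (suc k) (suc k) (suc k) / (K k (suc k) (suc k))
    transversal = adjoin-representative {Fin F.q} {Swap.swap (suc k)} { (UpperStep.representative {k} {suc k} {suc k} ℕₚ.≤-refl)} {K (suc k) (suc k) (suc k)} {K k (suc k) (suc k)} 
      (λ {g} → contains-swap {g}) (λ i {g} → UpperStep.contains {k} {suc k} {suc k} ℕₚ.≤-refl i {g})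
      (λ {g} g∈ → [ (λ u → inj₁ (UpperStep.covers {k} {suc k} {suc k} ℕₚ.≤-refl {g} g∈ u)) , (λ p → inj₂ (point g g∈ p)) ]′ (unit⊎𝔓 (entry g∈ 2F 2F)))
      (λ i {g} g∈ g∈swap → unit∉𝔓 (UpperStep.g₂₂-unit {k} {suc k} {suc k} ℕₚ.≤-refl i g g∈) (swap⇒g₂₂∈𝔓 g g∈swap))
      (λ {i} {j} {g} → UpperStep.disjoint {k} {suc k} {suc k} ℕₚ.≤-refl {i} {j} {g})

  module LowerBigCell where

    private
      contains-swap : translate (Swap.swap 0) (K 0 1 0) ⊆ K 0 0 0
      contains-swap {g} = translate⊆ {0} {1} {0} {0} {0} {0} (Swap.swap 0) ℕₚ.≤-refl (ℕ.z≤n {1}) ℕₚ.≤-refl (Swap.swap-stable 0) {g}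

      module _ (g : Unitary) (g∈ : g ∈ K 0 0 0) (g₀₀∈𝔓 : matrix g 0F 0F ∈ 𝔓) where

        a b c′ : Carrier
        a = matrix g 0F 0F
        b = matrix g 1F 0F
        c′ = matrix g 2F 0F

        -- Uniqueness of the isotropic line at infinity: when g₀₀ vanishes in the residue field,
        -- isotropy of the first column makes the norm of g₁₀ vanish, hence g₁₀ itself.
        norm-b∈𝔓 : (σ b * b) ∈ 𝔓
        norm-b∈𝔓 = 𝔓^-cong
          (trans (+-congʳ (sym (unitary-relation g 0F 0F)))
            (solve 3 (λ x y z → (x :+ (y :+ z)) :- (x :+ z) := y) refl (σ a * c′) (σ b * b) (σ c′ * a)))
          (𝔓^-- 0∈𝔓^ (𝔓^-+ (𝔒-*ʳ (σ∈𝔓^ g₀₀∈𝔓) (entry g∈ 2F 0F)) (𝔒-*ˡ (σ∈𝔓^ (entry g∈ 2F 0F)) g₀₀∈𝔓)))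

        b∈𝔓 : b ∈ 𝔓
        b∈𝔓 = [ (λ u → ⊥-elim (unit∉𝔓 (unit-* (σ-unit u) u) norm-b∈𝔓)) , (λ b∈ → b∈) ]′ (unit⊎𝔓 (entry g∈ 1F 0F))

        point : g ∈ translate (Swap.swap 0) (K 0 1 0)
        point = to-translate {0} {1} {0} (Swap.swap 0) g (K-refine-lower {0} {0} {0} {Swap.swap 0 ⧵ g} ℕₚ.≤-refl (Swap.swap⁻¹∈ 0 g g∈)
          (𝔓^-cong (sym (Swap.swap⁻¹-row₁ 0 g 0F)) b∈𝔓)
          (𝔓^-cong (sym (Swap.swap⁻¹-row₂ 0 g 0F)) (𝔒-*ˡ (Swap.p⁻¹∈ 0) g₀₀∈𝔓)))

      swap⇒g₀₀∈𝔓 : ∀ g → g ∈ translate (Swap.swap 0) (K 0 1 0) → matrix g 0F 0F ∈ 𝔓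
      swap⇒g₀₀∈𝔓 g g∈ = unit-cancelˡ (Swap.vp⁻¹ 0)
        (𝔓^-cong (Swap.swap⁻¹-row₂ 0 g 0F) (entry (from-translate {0} {1} {0} (Swap.swap 0) g g∈) 2F 0F))

    -- The q³ affine isotropic lines, with g₀₀ a unit, together with the single line at infinity.
    transversal : [ (λ (_ : ⊤) → Swap.swap 0) , LowerStep.representative {0} {0} {0} ℕₚ.≤-refl ℕₚ.≤-refl ]′
      IsTransversal K 0 0 0 / (K 0 1 0)
    transversal = adjoin-representative {LowerStep.Index {0} {0} {0} ℕₚ.≤-refl ℕₚ.≤-refl} {Swap.swap 0} { (LowerStep.representative {0} {0} {0} ℕₚ.≤-refl ℕₚ.≤-refl)} {K 0 0 0} {K 0 1 0} 
      (λ {g} → contains-swap {g}) (λ I {g} → LowerStep.contains {0} {0} {0} ℕₚ.≤-refl ℕₚ.≤-refl I {g})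
      (λ {g} g∈ → [ (λ u → inj₁ (LowerStep.covers {0} {0} {0} ℕₚ.≤-refl ℕₚ.≤-refl {g} g∈ u)) , (λ p → inj₂ (point g g∈ p)) ]′ (unit⊎𝔓 (entry g∈ 0F 0F)))
      (λ I {g} g∈ g∈swap → unit∉𝔓 (LowerStep.g₀₀-unit {0} {0} {0} ℕₚ.≤-refl ℕₚ.≤-refl I g g∈) (swap⇒g₀₀∈𝔓 g g∈swap))
      (λ {I} {J} {g} → LowerStep.disjoint {0} {0} {0} ℕₚ.≤-refl ℕₚ.≤-refl {I} {J} {g})

  Γ≐K : ∀ n → Γ n ⊆ K n n n ∧ K n n n ⊆ Γ n
  Γ≐K n = (λ {g} (g∈ , _) → K-intro λ i j → to i j (g∈ i j)) , (λ {g} (K-intro g∈) → (λ i j → from i j (g∈ i j)) , det-unit g)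
    where
    to : ∀ i j {x} → x ∈ Γ-entry n i j → x ∈ K-entry n n n i j
    to 0F 0F p = p
    to 0F 1F p = p
    to 0F 2F p = p
    to 1F 0F p = p
    to 1F 1F p = p
    to 1F 2F p = p
    to 2F 0F p = p
    to 2F 1F p = p
    to 2F 2F p = p

    from : ∀ i j {x} → x ∈ K-entry n n n i j → x ∈ Γ-entry n i j
    from 0F 0F p = p
    from 0F 1F p = p
    from 0F 2F p = p
    from 1F 0F p = p
    from 1F 1F p = p
    from 1F 2F p = p
    from 2F 0F p = p
    from 2F 1F p = p
    from 2F 2F p = p

-- Rational arithmetic with negative powers of `q`.

private
  /-+ : ∀ m n d .{{_ : ℕ.NonZero d}} → + m ℚ./ d ℚ.+ + n ℚ./ d ≡ + (m ℕ.+ n) ℚ./ d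
  /-+ m n (suc d) = ℚₚ.toℚᵘ-injective (begin
    ℚ.toℚᵘ (+ m ℚ./ suc d ℚ.+ + n ℚ./ suc d)                  ≈⟨ ℚₚ.toℚᵘ-homo-+ (+ m ℚ./ suc d) (+ n ℚ./ suc d) ⟩
    ℚ.toℚᵘ (+ m ℚ./ suc d) ℚᵘ.+ ℚ.toℚᵘ (+ n ℚ./ suc d)        ≈⟨ ℚᵘₚ.+-cong (ℚₚ.toℚᵘ-fromℚᵘ (ℚᵘ.mkℚᵘ (+ m) d)) (ℚₚ.toℚᵘ-fromℚᵘ (ℚᵘ.mkℚᵘ (+ n) d)) ⟩
    ℚᵘ.mkℚᵘ (+ m) d ℚᵘ.+ ℚᵘ.mkℚᵘ (+ n) d                      ≈⟨ ℚᵘ.*≡* (numerators (+ m) (+ n) (+ suc d)) ⟩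
    ℚᵘ.mkℚᵘ (+ (m ℕ.+ n)) d                                   ≈⟨ ℚₚ.toℚᵘ-fromℚᵘ (ℚᵘ.mkℚᵘ (+ (m ℕ.+ n)) d) ⟨
    ℚ.toℚᵘ (+ (m ℕ.+ n) ℚ./ suc d)                            ∎)
    where
    open ≈-Reasoning ℚᵘₚ.≃-setoid
    numerators : ∀ m n d → (m ℤ.* d ℤ.+ n ℤ.* d) ℤ.* d ≡ (m ℤ.+ n) ℤ.* (d ℤ.* d)
    numerators = ℤ-RingSolver.solve-∀

  ×-/ : ∀ n d .{{_ : ℕ.NonZero d}} → n × (+ 1 ℚ./ d) ≡ + n ℚ./ d
  ×-/ zero    (suc d) = ≡.sym (ℚₚ.fromℚᵘ-cong {ℚᵘ.mkℚᵘ (+ 0) d} {ℚᵘ.mkℚᵘ (+ 0) 0} (ℚᵘ.*≡* ≡.refl))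
  ×-/ (suc n) d       = ≡.trans (≡.cong (+ 1 ℚ./ d ℚ.+_) (×-/ n d)) (/-+ 1 n d)

  /-cancel : ∀ q e .{{_ : ℕ.NonZero q}} .{{_ : ℕ.NonZero e}} .{{_ : ℕ.NonZero (q ℕ.* e)}} →
             + q ℚ./ (q ℕ.* e) ≡ + 1 ℚ./ e
  /-cancel (suc q) (suc e) = ℚₚ.fromℚᵘ-cong {ℚᵘ.mkℚᵘ (+ suc q) _} {ℚᵘ.mkℚᵘ (+ 1) e}
    (ℚᵘ.*≡* (≡.trans (≡.sym (ℤₚ.pos-* (suc q) (suc e))) (≡.sym (ℤₚ.*-identityˡ (+ (suc q ℕ.* suc e))))))

×-^- : ∀ q k .{{_ : ℕ.NonZero q}} → q × (q ^- suc k) ≡ q ^- k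
×-^- q k = ≡.trans (×-/ q (q ℕ.^ suc k) {{ℕₚ.m^n≢0 q (suc k)}})
  (/-cancel q (q ℕ.^ k) {{it}} {{ℕₚ.m^n≢0 q k}} {{ℕₚ.m^n≢0 q (suc k)}})

-- The volumes along the chain of subgroups.

module Volumes {c₁ ℓ₁ c ℓ : Level} {F : LocalField c₁ ℓ₁} {E : LocalField c ℓ}
  (E/F : UnramifiedQuadraticExtension F E)
  (μ : Haar.HaarMeasure (UnitaryGroup.U E/F) (UnitaryGroup.IsOpen E/F)) where

  open UnitaryGroup E/F
  open Haar U IsOpen
  open HaarMeasure μ using (vol; vol-cong)
  open Subgroups E/F using (K; K-isOpen; _IsTransversal_/_; vol-transversal)
  open NormOneDigits E/F using (normOneSystem₀; normOneSystem₊)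
  open Transversals E/F using (lower-transversal; upper-transversal; Γ≐K; module DiagonalStep; module UpperBigCell; module LowerBigCell)

  q : ℕ
  q = LocalField.q F

  private instance
    q≢0 : ℕ.NonZero q
    q≢0 = LocalField.q-nonZero F

  volK : ℕ → ℕ → ℕ → ℝ∞
  volK r s m = vol (K r s m) (isOpen (K-isOpen r s m))

  private
    volume-up : ∀ {I : Set} {N} (I↔N : I ↔ Fin N) {x : I → Unitary} {r s m r′ s′ m′} →
      x IsTransversal K r s m / K r′ s′ m′ → ∀ {p} → volK r′ s′ m′ ≃ fromℚ p → volK r s m ≃ fromℚ (N × p)
    volume-up {N = N} I↔N {x} {r} {s} {m} {r′} {s′} {m′} transversal {p} B≃p =
      ≃-trans {volK r s m} {N ⊗ volK r′ s′ m′} {fromℚ (N × p)}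
        (vol-transversal μ I↔N transversal (K-isOpen r s m) (K-isOpen r′ s′ m′)) (⊗-fromℚ N {volK r′ s′ m′} B≃p)

    volume-down : ∀ {I : Set} {N} (I↔N : I ↔ Fin (suc N)) {x : I → Unitary} {r s m r′ s′ m′} →
      x IsTransversal K r s m / K r′ s′ m′ → ∀ {p} → volK r s m ≃ fromℚ (suc N × p) → volK r′ s′ m′ ≃ fromℚ p
    volume-down {N = N} I↔N {x} {r} {s} {m} {r′} {s′} {m′} transversal {p} A≃Np =
      ⊗-cancel N {volK r′ s′ m′} (≃-trans {suc N ⊗ volK r′ s′ m′} {volK r s m} {fromℚ (suc N × p)}
        (≃-sym {volK r s m} {suc N ⊗ volK r′ s′ m′}
          (vol-transversal μ I↔N transversal (K-isOpen r s m) (K-isOpen r′ s′ m′)))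
        A≃Np)

    q³ : ℕ
    q³ = q ℕ.* (q ℕ.* q)

    residue↔ : Fin q ↔ Fin q
    residue↔ = ↔-refl

    triples↔ : (Fin q ∧ (Fin q ∧ Fin q)) ↔ Fin q³
    triples↔ = ↔-trans (↔-refl ×-↔ ↔-sym Finₚ.*↔×) (↔-sym Finₚ.*↔×)

    adjoined↔ : ∀ {I : Set} {N} → I ↔ Fin N → (⊤ ⊎ I) ↔ Fin (suc N)
    adjoined↔ I↔N = ↔-trans (↔-sym Finₚ.1↔⊤ ⊎-↔ I↔N) (↔-sym Finₚ.+↔⊎)

    -- `volume-down` divides by a number in successor form. This and `nonzero↔` bring the indices
    -- `q` and `q³` into that form.
    pred-× : ∀ n .{{_ : ℕ.NonZero n}} p → suc (ℕ.pred n) × p ≡ n × p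
    pred-× n p = ≡.cong (_× p) (ℕₚ.suc-pred n)

    nonzero↔ : ∀ {I : Set} {n} .{{_ : ℕ.NonZero n}} → I ↔ Fin n → I ↔ Fin (suc (ℕ.pred n))
    nonzero↔ {I} {n} = ≡.subst (λ n → I ↔ Fin n) (≡.sym (ℕₚ.suc-pred n))

  1+q^-3⁻¹ : ℚ
  1+q^-3⁻¹ = (ℚ.1/ (1ℚ ℚ.+ q ^- 3)) {{1+q^-k≢0 q 3}}

  κ volΓ : ℕ → ℚ
  κ k = (q ^- k) ℚ.* 1+q^-3⁻¹
  volΓ k = κ (3 ℕ.* k)

  private
    ℚ-semiring = CommutativeRing.semiring ℚₚ.+-*-commutativeRing

    -- The values to be established for the Iwahori subgroup `K k (suc k) (suc k)` and for the
    -- common part `K k (suc (suc k)) (suc (suc k))`. The factor `suc q ^- 1` is 1 / (q + 1).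
    volI volJ : ℕ → ℚ
    volI k = volΓ (suc k) ℚ.* (suc q ^- 1)
    volJ k = κ (suc (3 ℕ.* suc (suc k))) ℚ.* (suc q ^- 1)

    ×-*ʳ : ∀ n p r → n × (p ℚ.* r) ≡ (n × p) ℚ.* r
    ×-*ʳ n p r = ≡.sym (SemiringMult.×-assoc-* ℚ-semiring n p r)

    ×-*ˡ : ∀ n p r → n × (p ℚ.* r) ≡ p ℚ.* (n × r)
    ×-*ˡ n p r = ≡.sym (SemiringMult.×-comm-* ℚ-semiring n p r)

    q×κ : ∀ k → q × κ (suc k) ≡ κ k
    q×κ k = ≡.trans (×-*ʳ q (q ^- suc k) 1+q^-3⁻¹) (≡.cong (ℚ._* 1+q^-3⁻¹) (×-^- q k))

    q³×^- : ∀ k → q³ × (q ^- (3 ℕ.+ k)) ≡ q ^- k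
    q³×^- k = begin
      q³ × (q ^- (3 ℕ.+ k))                    ≡⟨ MonoidMult.×-assocˡ ℚₚ.+-0-monoid (q ^- (3 ℕ.+ k)) q (q ℕ.* q) ⟨
      q × (q ℕ.* q) × (q ^- (3 ℕ.+ k))         ≡⟨ ≡.cong (q ×_) (MonoidMult.×-assocˡ ℚₚ.+-0-monoid (q ^- (3 ℕ.+ k)) q q) ⟨
      q × q × q × (q ^- (3 ℕ.+ k))             ≡⟨ ≡.cong (λ p → q × q × p) (×-^- q (2 ℕ.+ k)) ⟩
      q × q × (q ^- (2 ℕ.+ k))                 ≡⟨ ≡.cong (q ×_) (×-^- q (1 ℕ.+ k)) ⟩
      q × (q ^- (1 ℕ.+ k))                     ≡⟨ ×-^- q k ⟩
      q ^- k                                   ∎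
      where open ≡.≡-Reasoning

    -- The origin of the factor (1 + q⁻³)⁻¹: the q³ + 1 isotropic lines contribute (q³ + 1) q⁻³ = 1
    -- + q⁻³.
    [1+q³]×volΓ₁≡1 : suc q³ × volΓ 1 ≡ 1ℚ
    [1+q³]×volΓ₁≡1 = begin
      suc q³ × ((q ^- 3) ℚ.* 1+q^-3⁻¹)                     ≡⟨ ×-*ʳ (suc q³) (q ^- 3) 1+q^-3⁻¹ ⟩
      ((q ^- 3) ℚ.+ q³ × (q ^- 3)) ℚ.* 1+q^-3⁻¹            ≡⟨ ≡.cong (λ p → ((q ^- 3) ℚ.+ p) ℚ.* 1+q^-3⁻¹) (q³×^- 0) ⟩
      ((q ^- 3) ℚ.+ 1ℚ) ℚ.* 1+q^-3⁻¹                       ≡⟨ ≡.cong (ℚ._* 1+q^-3⁻¹) (ℚₚ.+-comm (q ^- 3) 1ℚ) ⟩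
      (1ℚ ℚ.+ (q ^- 3)) ℚ.* 1+q^-3⁻¹                       ≡⟨ ℚₚ.*-inverseʳ (1ℚ ℚ.+ q ^- 3) {{1+q^-k≢0 q 3}} ⟩
      1ℚ                                                   ∎
      where open ≡.≡-Reasoning

    [1+q]×volI : ∀ k → suc q × volI k ≡ volΓ (suc k)
    [1+q]×volI k = begin
      suc q × (volΓ (suc k) ℚ.* (suc q ^- 1))              ≡⟨ ×-*ˡ (suc q) (volΓ (suc k)) (suc q ^- 1) ⟩
      volΓ (suc k) ℚ.* (suc q × (suc q ^- 1))              ≡⟨ ≡.cong (volΓ (suc k) ℚ.*_) (×-^- (suc q) 0) ⟩
      volΓ (suc k) ℚ.* 1ℚ                                  ≡⟨ ℚₚ.*-identityʳ (volΓ (suc k)) ⟩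
      volΓ (suc k)                                         ∎
      where open ≡.≡-Reasoning

    q×volJ : ∀ k → q × volJ k ≡ volI (suc k)
    q×volJ k = ≡.trans (×-*ʳ q (κ (suc (3 ℕ.* suc (suc k)))) (suc q ^- 1))
      (≡.cong (ℚ._* (suc q ^- 1)) (q×κ (3 ℕ.* suc (suc k))))

    q³×volI : ∀ k → q³ × volI (suc k) ≡ volI k
    q³×volI k = begin
      q³ × (κ (3 ℕ.* suc (suc k)) ℚ.* (suc q ^- 1))        ≡⟨ ×-*ʳ q³ (κ (3 ℕ.* suc (suc k))) (suc q ^- 1) ⟩
      (q³ × κ (3 ℕ.* suc (suc k))) ℚ.* (suc q ^- 1)        ≡⟨ ≡.cong (ℚ._* (suc q ^- 1)) q³×κ ⟩
      volI k                                               ∎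
      where
      open ≡.≡-Reasoning
      q³×κ : q³ × κ (3 ℕ.* suc (suc k)) ≡ volΓ (suc k)
      q³×κ = begin
        q³ × κ (3 ℕ.* suc (suc k))                         ≡⟨ ≡.cong (λ n → q³ × κ n) (ℕₚ.*-suc 3 (suc k)) ⟩
        q³ × κ (3 ℕ.+ 3 ℕ.* suc k)                         ≡⟨ ×-*ʳ q³ (q ^- (3 ℕ.+ 3 ℕ.* suc k)) 1+q^-3⁻¹ ⟩
        (q³ × (q ^- (3 ℕ.+ 3 ℕ.* suc k))) ℚ.* 1+q^-3⁻¹     ≡⟨ ≡.cong (ℚ._* 1+q^-3⁻¹) (q³×^- (3 ℕ.* suc k)) ⟩
        volΓ (suc k)                                       ∎

  module _ (volK₀ : volK 0 0 0 ≃ fromℚ 1ℚ) where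

    private
      rewrite-volume : ∀ {r s m p p′} → p ≡ p′ → volK r s m ≃ fromℚ p → volK r s m ≃ fromℚ p′
      rewrite-volume {r} {s} {m} = ≡.subst (λ p → volK r s m ≃ fromℚ p)

      volK-010 : volK 0 1 0 ≃ fromℚ (volΓ 1)
      volK-010 = volume-down (adjoined↔ triples↔) LowerBigCell.transversal
        (rewrite-volume {0} {0} {0} (≡.sym [1+q³]×volΓ₁≡1) volK₀)

      volK-011 : volK 0 1 1 ≃ fromℚ (volI 0)
      volK-011 = volume-down (adjoined↔ residue↔) (DiagonalStep.transversal (ℕ.s≤s ℕ.z≤n) normOneSystem₀)
        (rewrite-volume {0} {1} {0} (≡.sym ([1+q]×volI 0)) volK-010)

      -- Each step divides by q³ and by q on the way down to the common part, then multiplies by q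
      -- on the way up to the next Iwahori subgroup; the net factor is q⁻³.
      vol-Iwahori : ∀ k → volK k (suc k) (suc k) ≃ fromℚ (volI k)
      vol-Iwahori zero    = volK-011
      vol-Iwahori (suc k) = rewrite-volume {suc k} {suc (suc k)} {suc (suc k)} (q×volJ k)
        (volume-up residue↔ (upper-transversal ℕₚ.≤-refl) vol-J)
        where
        instance
          q³≢0 : ℕ.NonZero q³
          q³≢0 = ℕₚ.m*n≢0 q (q ℕ.* q) {{it}} {{ℕₚ.m*n≢0 q q}}

        vol-lower : volK k (suc (suc k)) (suc k) ≃ fromℚ (volI (suc k))
        vol-lower = volume-down (nonzero↔ triples↔) (lower-transversal ℕₚ.≤-refl ℕₚ.≤-refl)
          (rewrite-volume {k} {suc k} {suc k} (≡.trans (≡.sym (q³×volI k)) (≡.sym (pred-× q³ (volI (suc k))))) (vol-Iwahori k))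

        vol-J : volK k (suc (suc k)) (suc (suc k)) ≃ fromℚ (volJ k)
        vol-J = volume-down (nonzero↔ residue↔) (DiagonalStep.transversal ℕₚ.≤-refl (normOneSystem₊ k))
          (rewrite-volume {k} {suc (suc k)} {suc k} (≡.trans (≡.sym (q×volJ k)) (≡.sym (pred-× q (volJ k)))) vol-lower)

    volK-diagonal : ∀ k → volK (suc k) (suc k) (suc k) ≃ fromℚ (volΓ (suc k))
    volK-diagonal k = rewrite-volume {suc k} {suc k} {suc k} ([1+q]×volI k)
      (volume-up (adjoined↔ residue↔) (UpperBigCell.transversal k) (vol-Iwahori k))

  vol-Γ≃volK : ∀ n → vol (Γ n) (isOpen (Γ-isOpen n)) ≃ volK n n n
  vol-Γ≃volK n = vol-cong (isOpen (Γ-isOpen n)) (isOpen (K-isOpen n n n)) (Γ≐K n)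

open import Data.Nat using (_*_; _≥_)
open import Data.Rational using (1/_) renaming (_+_ to _+ℚ_; _*_ to _*ℚ_)

theorem2 : ∀ {c₁ ℓ₁ c ℓ : Level} (F : LocalField c₁ ℓ₁) (E : LocalField c ℓ) →
  CharacteristicZero F → CharacteristicZero E →
  (E/F : UnramifiedQuadraticExtension F E) →
  let open UnitaryGroup E/F
      open Haar U IsOpen
      q_F = LocalField.q F
      instance q_F-nonZero = LocalField.q-nonZero F
  in
  (μ : HaarMeasure) →
  let open HaarMeasure μ
      volΓ = λ n → vol (Γ n) (isOpen (Γ-isOpen n))
  in
  volΓ 0 ≃ fromℚ 1ℚ →
  ∀ n → n ≥ 1 →
  volΓ n ≃ fromℚ (q_F ^- (3 * n) *ℚ (1/ (1ℚ +ℚ q_F ^- 3)) {{1+q^-k≢0 q_F 3}})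
theorem2 F E _ _ E/F μ volΓ₀ (suc k) _ =
  ≃-trans {vol (Γ (suc k)) (isOpen (Γ-isOpen (suc k)))} {volK (suc k) (suc k) (suc k)}
    {fromℚ (volΓ (suc k))} (vol-Γ≃volK (suc k)) (volK-diagonal volK₀ k)
  where
  open UnitaryGroup E/F
  open Haar U IsOpen
  open HaarMeasure μ
  open Volumes E/F μ

  volK₀ : volK 0 0 0 ≃ fromℚ 1ℚ
  volK₀ = ≃-trans {volK 0 0 0} {vol (Γ 0) (isOpen (Γ-isOpen 0))} {fromℚ 1ℚ}
    (≃-sym {vol (Γ 0) (isOpen (Γ-isOpen 0))} {volK 0 0 0} (vol-Γ≃volK 0)) volΓ₀
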